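{- Let $k>r>2$ and $t\ge 1$ be integers. Then for all sufficiently large $n$, $$ex_r(n,\mathbb{B}_t^rK_k)=ex_r(n,\mathbb{H}_t^rK_k)=|\mathcal{Q}^r_t(n,k-1)|.$$
   Context: A hypergraph consists of a finite vertex set and a set of distinct subsets of it (hyperedges); it is $r$-uniform if all hyperedges have size $r$. For an integer $t\ge1$ and a graph $F$, a hypergraph $\mathcal{F}$ is a $t$-heavy copy of $F$ if there exist an injection $i:V(F)\to V(\mathcal{F})$ and a map $h$ assigning to each edge $e$ of $F$ a set $h(e)$ of $t$ distinct hyperedges of $\mathcal{F}$ such that for every edge $e=xy$ of $F$, $\{i(x),i(y)\}\subseteq A$ for all $A\in h(e)$. It is a $t$-wise Berge copy of $F$ if moreover $|E(\mathcal{F})|=t|E(F)|$ and such $i,h$ exist with $h(e)\cap h(e')=\emptyset$ for distinct edges $e,e'$. $\mathbb{H}_t^rF$, $\mathbb{B}_t^rF$ denote the families of $r$-uniform $t$-heavy, resp. $t$-wise Berge, copies of $F$. $ex_r(n,\mathbb{F})$ is the maximum number of hyperedges in an $r$-uniform hypergraph on $n$ vertices containing no member of $\mathbb{F}$ as a subhypergraph. $\mathcal{T}^r(n,k-1)$ is the complete balanced $(k-1)$-partite $r$-uniform hypergraph on $n$ vertices: the vertex set is partitioned into $k-1$ parts whose sizes differ by at most one, and the hyperedges are all $r$-sets meeting each part in at most one vertex. $\mathcal{Q}^r_t(n,k-1)$ is obtained from $\mathcal{T}^r(n,k-1)$ as follows: for every pair $u,v$ of vertices lying in the same part, choose $t-1$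 different $(r-2)$-sets each of which meets $r-2$ other parts (one vertex in each), and add the $t-1$ sets $\{u,v\}\cup S$ as hyperedges (this is possible for $n$ large). -}

module Defs where

open import Data.Nat using (ℕ; _≤_; _+_; _*_; _∸_)
open import Data.Nat.Combinatorics using (_C_)
open import Data.Fin using (Fin) renaming (_<_ to _<ᶠ_)
open import Data.Fin.Subset using (Subset; ∣_∣) renaming (_∈_ to _∈ₛ_)
open import Data.Vec using (tabulate)
open import Data.Bool using (Bool)
open import Data.List using (List; length)
open import Data.List.Membership.Propositional using (_∈_)
open import Data.List.Relation.Unary.All using (All)
open import Data.List.Relation.Unary.Unique.Propositional using (Unique)
open import Data.Product using (Σ; ∃; _×_)
open import Data.Sum using (_⊎_)
open import Function.Definitions using (Injective)
open import Relation.Binary.PropositionalEquality using (_≡_; _≢_)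
open import Relation.Nullary using (¬_)
open import Relation.Nullary.Decidable using (⌊_⌋)
open import Data.Fin using (_≟_)

record Hypergraph (n : ℕ) : Set where
  constructor hg
  field
    edges    : List (Subset n)
    distinct : Unique edges
open Hypergraph public

∣E∣ : ∀ {n} → Hypergraph n → ℕ
∣E∣ H = length (edges H)

Uniform : ∀ {n} → ℕ → Hypergraph n → Set
Uniform r H = All (λ e → ∣ e ∣ ≡ r) (edges H)

_⊑_ : ∀ {n} → Hypergraph n → Hypergraph n → Set
F ⊑ H = ∀ {e} → e ∈ edges F → e ∈ edges H

record HeavyCopy (t k : ℕ) {n : ℕ} (F : Hypergraph n) : Set where
  field
    i     : Fin k → Fin n
    i-inj : Injective _≡_ _≡_ i
    h     : (x y : Fin k) → x <ᶠ y → List (Subset n)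
    h-size : ∀ x y (p : x <ᶠ y) → length (h x y p) ≡ t
    h-distinct : ∀ x y (p : x <ᶠ y) → Unique (h x y p)
    h-in  : ∀ x y (p : x <ᶠ y) → All (λ A → A ∈ edges F) (h x y p)
    h-contains : ∀ x y (p : x <ᶠ y) → All (λ A → (i x ∈ₛ A) × (i y ∈ₛ A)) (h x y p)

record BergeCopy (t k : ℕ) {n : ℕ} (F : Hypergraph n) : Set where
  field
    heavy : HeavyCopy t k F
    size  : ∣E∣ F ≡ t * (k C 2)
    disjoint : ∀ x y (p : x <ᶠ y) x' y' (p' : x' <ᶠ y') A →
               A ∈ HeavyCopy.h heavy x y p → A ∈ HeavyCopy.h heavy x' y' p' →
               (x ≡ x') × (y ≡ y')

-- H contains a member of 𝔹_t^r K_k / ℍ_t^r K_k as a subhypergraph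
-- (r-uniformity of the copy is inherited from H).
ContainsBerge : (t k : ℕ) → ∀ {n} → Hypergraph n → Set
ContainsBerge t k {n} H = Σ (Hypergraph n) λ F → F ⊑ H × BergeCopy t k F

ContainsHeavy : (t k : ℕ) → ∀ {n} → Hypergraph n → Set
ContainsHeavy t k {n} H = Σ (Hypergraph n) λ F → F ⊑ H × HeavyCopy t k F

-- ex_r(n, 𝔽) = m, where "contains a member of 𝔽" is the predicate P.
ExEq : (r n : ℕ) → (Hypergraph n → Set) → ℕ → Set
ExEq r n P m =
  (Σ (Hypergraph n) λ H → Uniform r H × ¬ P H × ∣E∣ H ≡ m) ×
  (∀ (H : Hypergraph n) → Uniform r H → ¬ P H → ∣E∣ H ≤ m)

partSize : ∀ {n m} → (Fin n → Fin m) → Fin m → ℕ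
partSize p j = ∣ tabulate (λ v → ⌊ p v ≟ j ⌋) ∣

Balanced : ∀ {n m} → (Fin n → Fin m) → Set
Balanced p = ∀ j j' → partSize p j ≤ partSize p j' + 1

TEdge : ∀ {n m} → ℕ → (Fin n → Fin m) → Subset n → Set
TEdge r p e = ∣ e ∣ ≡ r × (∀ u v → u ∈ₛ e → v ∈ₛ e → p u ≡ p v → u ≡ v)

-- e = {u,v} ∪ S with |e| = r, where S is an (r-2)-set meeting r-2 parts other
-- than the part of u,v, one vertex in each
PairEdge : ∀ {n m} → ℕ → (Fin n → Fin m) → Fin n → Fin n → Subset n → Set
PairEdge r p u v e =
  (u ∈ₛ e) × (v ∈ₛ e) × (∣ e ∣ ≡ r) ×
  (∀ w → w ∈ₛ e → p w ≡ p u → (w ≡ u) ⊎ (w ≡ v)) ×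
  (∀ w w' → w ∈ₛ e → w' ∈ₛ e → p w ≡ p w' → p w ≢ p u → w ≡ w')

IsQ : (r t m : ℕ) → ∀ {n} → Hypergraph n → Set
IsQ r t m {n} H = Σ (Fin n → Fin m) λ p →
  Balanced p ×
  (∀ e → TEdge r p e → e ∈ edges H) ×
  (∀ e → e ∈ edges H →
     TEdge r p e ⊎ (Σ (Fin n) λ u → Σ (Fin n) λ v →
                      (u <ᶠ v) × (p u ≡ p v) × PairEdge r p u v e)) ×
  (∀ u v → u <ᶠ v → p u ≡ p v →
     Σ (List (Subset n)) λ L →
       (length L ≡ t ∸ 1) × Unique L ×
       All (λ e → e ∈ edges H) L × All (PairEdge r p u v) L ×
       (∀ e → e ∈ edges H → PairEdge r p u v e → e ∈ L))

-- Throughout k = m + 1, r = d + 3 and t = s + 1. Call a pair fat if it lies in at least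
-- D = t + t·(k choose 2) edges of H. A fat K_k, or one in which a single pair has codegree t, gives
-- a t-wise Berge K_k greedily, so in a Berge-free H the fat graph has no K_k. All but O(n²) edges
-- of H are r-cliques of the fat graph. Replacing one after the other the non-neighbourhoods of
-- vertices in most r-cliques by independent sets joined to everything else produces a partition p
-- into m parts for which (r-cliques) + (non-transversal r-cliques) is at most the number of
-- transversal r-sets. If |H| ≥ |𝒬| this forces linear part sizes, all but O(n²) transversals in H,
-- and only O(n) cross pairs that are not fat. Hence all but O(√n) vertices are typical (fewer than
-- about √n non-fat cross pairs). Put every vertex x into a part p′ x with few fat typical
-- neighbours. If u, v lie in the same part and both have few non-fat typical neighbours in the
-- other parts, then uv has codegree at most t - 1, since otherwise it extends to a Berge K_k. Every
-- other vertex misses more transversals than it has edges meeting its own part twice. So |H| is at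
-- most (transversals of p′) + (t - 1)(pairs inside parts), and part sizes maximising this
-- quantity are balanced when n is large.

module Submission where

open import Defs
open import Data.Nat hiding (_≟_)
open import Data.Nat.DivMod using (m/n*n≤m; m≡m%n+[m/n]*n; m%n<n)
open import Data.Nat.Combinatorics using (_C_; nC1≡n; nCk+nC[k+1]≡[n+1]C[k+1])
open import Data.Nat.Tactic.RingSolver using (solve-∀)
import Data.Nat.Properties as ℕₚ
open ℕₚ hiding (_≟_; suc-injective)
open import Data.Bool using (Bool; true; false)
import Data.Bool.Properties as Boolₚ
open import Data.Fin using (Fin; zero; suc; toℕ; fromℕ<; punchIn; _≟_) renaming (_<_ to _<ᶠ_)
import Data.Fin.Properties as Finₚ
open import Data.Fin.Subset using (Subset; ∣_∣; ⊥) renaming (_∈_ to _∈ₛ_; _∉_ to _∉ₛ_)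
open import Data.Fin.Subset.Properties using (_∈?_; _⊆?_; ∉⊥; ∣⊥∣≡0; p⊆q⇒∣p∣≤∣q∣; drop-∷-⊆)
open import Data.Vec using ([]; _∷_; here; there) renaming (_[_]≔_ to infixl 6 _[_]≔_)
import Data.Vec.Properties as Vecₚ
open import Data.List using (List; []; _∷_; _++_; map; length; filter; take; allFin)
import Data.List as List
import Data.List.Properties as Listₚ
open import Data.List.Membership.Propositional using (_∈_; _∉_)
import Data.List.Membership.Propositional.Properties as ∈ₚ
import Data.List.Membership.DecPropositional as DecMembership
open import Data.List.Relation.Unary.Any using (here; there)
open import Data.List.Relation.Unary.All using (All; []; _∷_)
import Data.List.Relation.Unary.All as All
import Data.List.Relation.Unary.All.Properties as Allₚ
open import Data.List.Relation.Unary.AllPairs using (AllPairs; []; _∷_)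
import Data.List.Relation.Unary.AllPairs as AllPairs
open import Data.List.Relation.Unary.Unique.Propositional using (Unique)
import Data.List.Relation.Unary.Unique.Propositional.Properties as Uniqueₚ
open import Data.List.Relation.Binary.Permutation.Propositional using (_↭_; refl; prep; swap; trans)
import Data.List.Relation.Binary.Permutation.Propositional.Properties as ↭ₚ
open import Data.Product using (Σ; ∃; _×_; _,_; proj₁; proj₂)
import Data.Product.Properties as Productₚ
open import Data.Sum using (_⊎_; inj₁; inj₂)
open import Data.Unit using (⊤)
open import Function using (_∘_; id; case_of_)
open import Relation.Nullary using (¬_; Dec; yes; no; contradiction)
open import Relation.Nullary.Decidable using (_×-dec_; _⊎-dec_; _→-dec_; ¬?)
open import Relation.Binary.Definitions using (Tri; tri<; tri≈; tri>)
open import Relation.Unary using (Decidable)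
open import Relation.Binary.PropositionalEquality as Eq using (_≡_; _≢_; refl; sym; cong; cong₂; subst; module ≡-Reasoning)

-- Counting with indicators

-- The size of `𝒬` is never put into closed form. Both bounds are measured against the maximum of
-- `φ`, a polynomial in the part sizes, over all compositions of `n`; that the maximiser is balanced
-- is a separate fact. Every Berge copy is heavy, so one construction free of heavy copies and one
-- upper bound for Berge-free hypergraphs settle both numbers. Stability comes from the extra
-- summand in the symmetrisation inequality: a clique with two vertices in the class made
-- independent is counted twice, so the count that bounds all cliques also pays for the
-- non-transversal ones. If `|H| ≥ |𝒬|`, only O(n²) errors remain, small against n^r because r > 2.
-- The obstacle is the few atypical vertices: nothing places them in the right part, and pairs
-- containing them may have large codegree. The threshold √n is a compromise. The non-fat cross
-- pairs number O(n), so a threshold σ near √n leaves O(√n) atypical vertices, while a greedy clique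
-- loses only O(σ) candidates per part. Both quantities are eventually below a small fraction q of
-- n.

private variable
  A B : Set
  P R S : Set

-- The Iverson bracket of a decision. Cardinalities are sums of these over explicit enumerations, so
-- that double counting becomes `∑-swap` and union bounds become pointwise inequalities.
ι : Dec P → ℕ
ι (yes _) = 1
ι (no _)  = 0

ι≤1 : (d : Dec P) → ι d ≤ 1
ι≤1 (yes _) = ≤-refl
ι≤1 (no _)  = z≤n

ι-yes : (d : Dec P) → P → ι d ≡ 1
ι-yes (yes _) _ = refl
ι-yes (no ¬p) p = contradiction p ¬p

ι-no : (d : Dec P) → ¬ P → ι d ≡ 0
ι-no (yes p) ¬p = contradiction p ¬p
ι-no (no _)  _  = refl

ι-≤ : (d : Dec P) {x : ℕ} → (P → 1 ≤ x) → ι d ≤ x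
ι-≤ (yes p) f = f p
ι-≤ (no _)  f = z≤n

ι-≥1 : (d : Dec P) → P → 1 ≤ ι d
ι-≥1 d p = ≤-reflexive (sym (ι-yes d p))

ι-mono : (d : Dec P) (d′ : Dec R) → (P → R) → ι d ≤ ι d′
ι-mono d d′ f = ι-≤ d (ι-≥1 d′ ∘ f)

ι-cong : (d : Dec P) (d′ : Dec R) → (P → R) → (R → P) → ι d ≡ ι d′
ι-cong d d′ f g = ≤-antisym (ι-mono d d′ f) (ι-mono d′ d g)

ι-* : (d : Dec P) (d′ : Dec R) → ι (d ×-dec d′) ≡ ι d * ι d′
ι-* (yes _) (yes _) = refl
ι-* (yes _) (no _)  = refl
ι-* (no _)  _       = refl

ι-*ˡ : (d : Dec P) {x y : ℕ} → (P → x ≤ y) → ι d * x ≤ ι d * y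
ι-*ˡ (yes p) f = *-monoʳ-≤ 1 (f p)
ι-*ˡ (no _)  f = z≤n

ι-⊎ : (d : Dec P) (e : Dec R) (f : Dec S) → (P → R ⊎ S) → ι d ≤ ι e + ι f
ι-⊎ d e f g = ι-≤ d λ p → case g p of λ where
  (inj₁ r) → ≤-trans (ι-≥1 e r) (m≤m+n _ _)
  (inj₂ s) → ≤-trans (ι-≥1 f s) (m≤n+m _ _)

ι-pos : (d : Dec P) → 0 < ι d → P
ι-pos (yes p) _ = p

∑ : List A → (A → ℕ) → ℕ
∑ []       f = 0
∑ (x ∷ xs) f = f x + ∑ xs f

# : {Q : A → Set} → List A → Decidable Q → ℕ
# xs Q? = ∑ xs (λ x → ι (Q? x))

∑-mono : (xs : List A) {f g : A → ℕ} → (∀ x → f x ≤ g x) → ∑ xs f ≤ ∑ xs g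
∑-mono []       f≤g = z≤n
∑-mono (x ∷ xs) f≤g = +-mono-≤ (f≤g x) (∑-mono xs f≤g)

∑-cong : (xs : List A) {f g : A → ℕ} → (∀ x → f x ≡ g x) → ∑ xs f ≡ ∑ xs g
∑-cong []       f≡g = refl
∑-cong (x ∷ xs) f≡g = cong₂ _+_ (f≡g x) (∑-cong xs f≡g)

∑-+ : (xs : List A) {f g : A → ℕ} → ∑ xs (λ x → f x + g x) ≡ ∑ xs f + ∑ xs g
∑-+ []       = refl
∑-+ (x ∷ xs) {f} {g} = Eq.trans (cong (f x + g x +_) (∑-+ xs)) (rearrange (f x) (g x) _ _)
  where
  rearrange : ∀ a b c d → (a + b) + (c + d) ≡ (a + c) + (b + d)
  rearrange = solve-∀

∑-*ʳ : (xs : List A) {f : A → ℕ} (c : ℕ) → ∑ xs (λ x → f x * c) ≡ ∑ xs f * c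
∑-*ʳ []       c = refl
∑-*ʳ (x ∷ xs) {f} c = Eq.trans (cong (f x * c +_) (∑-*ʳ xs c)) (sym (*-distribʳ-+ c (f x) _))

∑-*ˡ : (xs : List A) {f : A → ℕ} (c : ℕ) → ∑ xs (λ x → c * f x) ≡ c * ∑ xs f
∑-*ˡ xs {f} c = begin
  ∑ xs (λ x → c * f x) ≡⟨ ∑-cong xs (λ x → *-comm c (f x)) ⟩
  ∑ xs (λ x → f x * c) ≡⟨ ∑-*ʳ xs c ⟩
  ∑ xs f * c           ≡⟨ *-comm _ c ⟩
  c * ∑ xs f           ∎
  where open ≡-Reasoning

∑-0 : (xs : List A) → ∑ xs (λ _ → 0) ≡ 0
∑-0 []       = refl
∑-0 (x ∷ xs) = ∑-0 xs

∑-const : (xs : List A) (c : ℕ) → ∑ xs (λ _ → c) ≡ length xs * c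
∑-const []       c = refl
∑-const (x ∷ xs) c = cong (c +_) (∑-const xs c)

∑-swap : (xs : List A) (ys : List B) {f : A → B → ℕ} →
         ∑ xs (λ x → ∑ ys (f x)) ≡ ∑ ys (λ y → ∑ xs (λ x → f x y))
∑-swap []       ys = sym (∑-0 ys)
∑-swap (x ∷ xs) ys {f} = Eq.trans (cong (∑ ys (f x) +_) (∑-swap xs ys)) (sym (∑-+ ys))

∑-++ : (xs ys : List A) {f : A → ℕ} → ∑ (xs ++ ys) f ≡ ∑ xs f + ∑ ys f
∑-++ []       ys = refl
∑-++ (x ∷ xs) ys {f} = Eq.trans (cong (f x +_) (∑-++ xs ys)) (sym (+-assoc (f x) _ _))

∑-map : (g : B → A) (xs : List B) {f : A → ℕ} → ∑ (map g xs) f ≡ ∑ xs (f ∘ g)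
∑-map g []       = refl
∑-map g (x ∷ xs) = cong (_ +_) (∑-map g xs)

∑-∈ : {xs : List A} (f : A → ℕ) {x : A} → x ∈ xs → f x ≤ ∑ xs f
∑-∈ f (here refl) = m≤m+n _ _
∑-∈ f (there x∈xs) = ≤-trans (∑-∈ f x∈xs) (m≤n+m _ _)

∑-pos : (xs : List A) (f : A → ℕ) → 0 < ∑ xs f → ∃ λ x → x ∈ xs × 0 < f x
∑-pos (x ∷ xs) f pos with f x in eq
... | suc _ = x , here refl , subst (0 <_) (sym eq) z<s
... | zero  with y , y∈ , fy ← ∑-pos xs f pos = y , there y∈ , fy

∑-tabulate : ∀ {n} (g : Fin n → A) {f : A → ℕ} → ∑ (List.tabulate g) f ≡ ∑ (allFin n) (f ∘ g)
∑-tabulate g {f} = Eq.trans (cong (λ l → ∑ l f) (sym (Listₚ.map-tabulate id g))) (∑-map g (allFin _) {f})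

∑-allFin-suc : ∀ {n} (f : Fin (suc n) → ℕ) → ∑ (allFin (suc n)) f ≡ f zero + ∑ (allFin n) (f ∘ suc)
∑-allFin-suc {n} f = cong (f zero +_) (∑-tabulate {n = n} suc {f})

#-pos : {Q : A → Set} (xs : List A) (Q? : Decidable Q) → 0 < # xs Q? → ∃ λ x → x ∈ xs × Q x
#-pos xs Q? pos with x , x∈ , px ← ∑-pos xs _ pos = x , x∈ , ι-pos (Q? x) px

#-∈ : {Q : A → Set} {xs : List A} (Q? : Decidable Q) {x : A} → x ∈ xs → Q x → 1 ≤ # xs Q?
#-∈ Q? x∈ q = ≤-trans (ι-≥1 (Q? _) q) (∑-∈ _ x∈)

#-mono : {Q Q′ : A → Set} (xs : List A) (Q? : Decidable Q) (Q′? : Decidable Q′) →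
         (∀ x → Q x → Q′ x) → # xs Q? ≤ # xs Q′?
#-mono xs Q? Q′? f = ∑-mono xs λ x → ι-mono (Q? x) (Q′? x) (f x)

#-cong : {Q Q′ : A → Set} (xs : List A) (Q? : Decidable Q) (Q′? : Decidable Q′) →
         (∀ x → Q x → Q′ x) → (∀ x → Q′ x → Q x) → # xs Q? ≡ # xs Q′?
#-cong xs Q? Q′? f g = ∑-cong xs λ x → ι-cong (Q? x) (Q′? x) (f x) (g x)

#-none : {Q : A → Set} (xs : List A) (Q? : Decidable Q) → (∀ x → ¬ Q x) → # xs Q? ≡ 0
#-none xs Q? ¬Q = Eq.trans (∑-cong xs λ x → ι-no (Q? x) (¬Q x)) (∑-0 xs)

#-≤1 : {Q : A → Set} {xs : List A} (Q? : Decidable Q) → Unique xs →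
       (∀ x y → Q x → Q y → x ≡ y) → # xs Q? ≤ 1
#-≤1 Q? [] uniq = z≤n
#-≤1 {xs = x ∷ xs} Q? (x∉ ∷ u) uniq with Q? x
... | no _  = #-≤1 Q? u uniq
... | yes q = s≤s (≮⇒≥ λ pos → let y , y∈ , qy = #-pos xs Q? pos
                                in All.lookup x∉ y∈ (uniq x y q qy))

length-filter-# : {Q : A → Set} (xs : List A) (Q? : Decidable Q) → length (filter Q? xs) ≡ # xs Q?
length-filter-# []       Q? = refl
length-filter-# (x ∷ xs) Q? with Q? x
... | yes _ = cong suc (length-filter-# xs Q?)
... | no _  = length-filter-# xs Q?

#-single : {Q : A → Set} {xs : List A} (Q? : Decidable Q) → Unique xs → ∀ {x} → x ∈ xs →
           Q x → (∀ y → Q y → y ≡ x) → # xs Q? ≡ 1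
#-single Q? u x∈ q uniq =
  ≤-antisym (#-≤1 Q? u λ y z qy qz → Eq.trans (uniq y qy) (sym (uniq z qz))) (#-∈ Q? x∈ q)

unique-⊆-length : {xs ys : List A} → Unique xs → (∀ {x} → x ∈ xs → x ∈ ys) → length xs ≤ length ys
unique-⊆-length [] _ = z≤n
unique-⊆-length {ys = ys} (x∉ ∷ u) sub
  with ys₁ , ys₂ , refl ← ∈ₚ.∈-∃++ (sub (here refl)) =
  subst (_ ≤_) (sym (Listₚ.length-++-sucʳ ys₁ _ ys₂))
    (s≤s (unique-⊆-length u λ z∈ → drop (λ z≡x → All.lookup x∉ z∈ (sym z≡x)) (sub (there z∈))))
  where
  drop : ∀ {z x} → z ≢ x → z ∈ ys₁ ++ x ∷ ys₂ → z ∈ ys₁ ++ ys₂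
  drop z≢x z∈ with ∈ₚ.∈-++⁻ ys₁ z∈
  ... | inj₁ p         = ∈ₚ.∈-++⁺ˡ p
  ... | inj₂ (here e)  = contradiction e z≢x
  ... | inj₂ (there p) = ∈ₚ.∈-++⁺ʳ ys₁ p

#-≥length : {Q : A → Set} {xs L : List A} (Q? : Decidable Q) → Unique L →
            All Q L → (∀ {x} → x ∈ L → x ∈ xs) → length L ≤ # xs Q?
#-≥length {xs = xs} Q? u qs sub = subst (_ ≤_) (length-filter-# xs Q?)
  (unique-⊆-length u λ z∈ → ∈ₚ.∈-filter⁺ Q? (sub z∈) (All.lookup qs z∈))

max-∃ : (f : A → ℕ) {x : A} (xs : List A) → x ∈ xs → ∃ λ y → y ∈ xs × (∀ {z} → z ∈ xs → f z ≤ f y)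
max-∃ f (x ∷ []) _ = x , here refl , λ { (here refl) → ≤-refl }
max-∃ f (x ∷ xs@(_ ∷ _)) _ with y , y∈ , max ← max-∃ f xs (here refl) with ≤-total (f x) (f y)
... | inj₁ x≤y = y , there y∈ , λ { (here refl) → x≤y ; (there z∈) → max z∈ }
... | inj₂ y≤x = x , here refl , λ { (here refl) → ≤-refl ; (there z∈) → ≤-trans (max z∈) y≤x }

subs : ∀ n → List (Subset n)
subs zero    = [] ∷ []
subs (suc n) = map (true ∷_) (subs n) ++ map (false ∷_) (subs n)

∈-subs : ∀ {n} (e : Subset n) → e ∈ subs n
∈-subs []          = here refl
∈-subs (true ∷ e)  = ∈ₚ.∈-++⁺ˡ (∈ₚ.∈-map⁺ _ (∈-subs e))
∈-subs (false ∷ e) = ∈ₚ.∈-++⁺ʳ _ (∈ₚ.∈-map⁺ _ (∈-subs e))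

subs-unique : ∀ n → Unique (subs n)
subs-unique zero    = [] ∷ []
subs-unique (suc n) = Uniqueₚ.++⁺ (Uniqueₚ.map⁺ Vecₚ.∷-injectiveʳ (subs-unique n))
                                  (Uniqueₚ.map⁺ Vecₚ.∷-injectiveʳ (subs-unique n))
  λ (p , q) → case ∈ₚ.∈-map⁻ _ p , ∈ₚ.∈-map⁻ _ q of λ { ((_ , _ , refl) , (_ , _ , ())) }

∑-subs-suc : ∀ {n} (f : Subset (suc n) → ℕ) →
             ∑ (subs (suc n)) f ≡ ∑ (subs n) (f ∘ (true ∷_)) + ∑ (subs n) (f ∘ (false ∷_))
∑-subs-suc {n} f = Eq.trans (∑-++ (map (true ∷_) (subs n)) _)
  (cong₂ _+_ (∑-map (true ∷_) (subs n)) (∑-map (false ∷_) (subs n)))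

#-members : ∀ {n} (e : Subset n) → # (allFin n) (_∈? e) ≡ ∣ e ∣
#-members []      = refl
#-members (b ∷ e) = Eq.trans (∑-allFin-suc (λ u → ι (u ∈? (b ∷ e)))) (Eq.trans (cong (ι (zero ∈? (b ∷ e)) +_) tail) (head b))
  where
  tail = Eq.trans (#-cong (allFin _) (λ u → suc u ∈? (b ∷ e)) (_∈? e) (λ { _ (there p) → p }) (λ _ → there)) (#-members e)
  head : ∀ b → ι (zero ∈? (b ∷ e)) + ∣ e ∣ ≡ ∣ b ∷ e ∣
  head true  = refl
  head false = refl

_≟ₛ_ : ∀ {n} (d e : Subset n) → Dec (d ≡ e)
_≟ₛ_ = Vecₚ.≡-dec Boolₚ._≟_

ext-∈ : ∀ {n} {d e : Subset n} → (∀ u → u ∈ₛ d → u ∈ₛ e) → (∀ u → u ∈ₛ e → u ∈ₛ d) → d ≡ e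
ext-∈ {d = []}    {[]}    _ _ = refl
ext-∈ {d = x ∷ d} {y ∷ e} f g = cong₂ _∷_ (head x y (f zero) (g zero))
  (ext-∈ (λ u p → case f (suc u) (there p) of λ { (there q) → q })
         (λ u p → case g (suc u) (there p) of λ { (there q) → q }))
  where
  head : ∀ x y → (zero ∈ₛ (x ∷ d) → zero ∈ₛ (y ∷ e)) → (zero ∈ₛ (y ∷ e) → zero ∈ₛ (x ∷ d)) → x ≡ y
  head true  true  _ _ = refl
  head false false _ _ = refl
  head true  false f _ = case f here of λ ()
  head false true  _ g = case g here of λ ()

∈-insert : ∀ {n} (e : Subset n) v → v ∈ₛ e [ v ]≔ true
∈-insert e v = Vecₚ.lookup⇒[]= v _ (Vecₚ.lookup∘update v e true)

∈-update⁺ : ∀ {n} (e : Subset n) {b v u} → u ≢ v → u ∈ₛ e → u ∈ₛ e [ v ]≔ b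
∈-update⁺ e {b} u≢v u∈ = Vecₚ.lookup⇒[]= _ _ (Eq.trans (Vecₚ.lookup∘update′ u≢v e b) (Vecₚ.[]=⇒lookup u∈))

∈-update⁻ : ∀ {n} (e : Subset n) {b v u} → u ≢ v → u ∈ₛ e [ v ]≔ b → u ∈ₛ e
∈-update⁻ e {b} u≢v u∈ = Vecₚ.lookup⇒[]= _ _ (Eq.trans (sym (Vecₚ.lookup∘update′ u≢v e b)) (Vecₚ.[]=⇒lookup u∈))

∉-delete : ∀ {n} (e : Subset n) v → v ∉ₛ e [ v ]≔ false
∉-delete e v v∈ = case Eq.trans (sym (Vecₚ.[]=⇒lookup v∈)) (Vecₚ.lookup∘update v e false) of λ ()

∣insert∣ : ∀ {n} (e : Subset n) v → v ∉ₛ e → ∣ e [ v ]≔ true ∣ ≡ suc ∣ e ∣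
∣insert∣ (true ∷ e)  zero    v∉ = contradiction here v∉
∣insert∣ (false ∷ e) zero    v∉ = refl
∣insert∣ (true ∷ e)  (suc v) v∉ = cong suc (∣insert∣ e v (v∉ ∘ there))
∣insert∣ (false ∷ e) (suc v) v∉ = ∣insert∣ e v (v∉ ∘ there)

∣delete∣ : ∀ {n} (e : Subset n) v → v ∈ₛ e → suc ∣ e [ v ]≔ false ∣ ≡ ∣ e ∣
∣delete∣ (true ∷ e)  zero    v∈ = refl
∣delete∣ (true ∷ e)  (suc v) (there v∈) = cong suc (∣delete∣ e v v∈)
∣delete∣ (false ∷ e) (suc v) (there v∈) = ∣delete∣ e v v∈
∣delete∣ (false ∷ e) zero    ()

-- Elementary symmetric polynomials of part sizes

∑-↭ : {xs ys : List A} (f : A → ℕ) → xs ↭ ys → ∑ xs f ≡ ∑ ys f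
∑-↭ f refl          = refl
∑-↭ f (prep x p)    = cong (f x +_) (∑-↭ f p)
∑-↭ f (swap x y p)  = Eq.trans (cong (λ s → f x + (f y + s)) (∑-↭ f p)) (exchange (f x) (f y) _)
  where
  exchange : ∀ a b c → a + (b + c) ≡ b + (a + c)
  exchange = solve-∀
∑-↭ f (trans p q)   = Eq.trans (∑-↭ f p) (∑-↭ f q)

∈⇒↭ : {x : A} {xs : List A} → x ∈ xs → ∃ λ ys → xs ↭ x ∷ ys
∈⇒↭ x∈ with ys₁ , ys₂ , refl ← ∈ₚ.∈-∃++ x∈ = ys₁ ++ ys₂ , ↭ₚ.shift _ ys₁ ys₂

esym : ℕ → List ℕ → ℕ
esym zero    _        = 1
esym (suc r) []       = 0
esym (suc r) (x ∷ xs) = esym (suc r) xs + x * esym r xs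

esym-↭ : ∀ r {xs ys} → xs ↭ ys → esym r xs ≡ esym r ys
esym-↭ zero    _          = refl
esym-↭ (suc r) refl       = refl
esym-↭ (suc r) (prep x p) = cong₂ (λ a b → a + x * b) (esym-↭ (suc r) p) (esym-↭ r p)
esym-↭ (suc zero) (swap {xs} {ys} x y p) rewrite esym-↭ 1 p = exchange (esym 1 ys) x y
  where
  exchange : ∀ a x y → (a + y * 1) + x * 1 ≡ (a + x * 1) + y * 1
  exchange = solve-∀
esym-↭ (suc (suc r)) (swap {xs} {ys} x y p)
  rewrite esym-↭ (suc (suc r)) p | esym-↭ (suc r) p | esym-↭ r p =
  exchange (esym (suc (suc r)) ys) (esym (suc r) ys) (esym r ys) x y
  where
  exchange : ∀ a b c x y → (a + y * b) + x * (b + y * c) ≡ (a + x * b) + y * (b + x * c)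
  exchange = solve-∀
esym-↭ (suc r) (trans p q) = Eq.trans (esym-↭ (suc r) p) (esym-↭ (suc r) q)

-- With the other entries fixed, a transfer of units between `x` and `y` changes only the product
-- `x * y`. Both exchange arguments below rest on this.
esym-two : ∀ d x y zs → esym (2 + d) (x ∷ y ∷ zs) ≡
           (esym (2 + d) zs + (x + y) * esym (1 + d) zs) + (x * y) * esym d zs
esym-two d x y zs = expand (esym (2 + d) zs) (esym (1 + d) zs) (esym d zs) x y
  where
  expand : ∀ a b c x y → (a + y * b) + x * (b + y * c) ≡ (a + (x + y) * b) + (x * y) * c
  expand = solve-∀

esym-≤ : ∀ r xs → esym r xs ≤ ∑ xs id ^ r
esym-≤ zero    xs       = ≤-refl
esym-≤ (suc r) []       = z≤n
esym-≤ (suc r) (x ∷ xs) = begin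
  esym (suc r) xs + x * esym r xs ≤⟨ +-mono-≤ (esym-≤ (suc r) xs) (*-monoʳ-≤ x (esym-≤ r xs)) ⟩
  s * s ^ r + x * s ^ r           ≡⟨ sym (*-distribʳ-+ (s ^ r) s x) ⟩
  (s + x) * s ^ r                 ≤⟨ *-mono-≤ (≤-reflexive (+-comm s x)) (^-monoˡ-≤ r (m≤n+m s x)) ⟩
  (x + s) * (x + s) ^ r           ∎
  where
  open ≤-Reasoning
  s = ∑ xs id

-- A single product of `d` large entries already reaches the bound.
esym-≥ : ∀ y d xs → d ≤ # xs (y ≤?_) → y ^ d ≤ esym d xs
esym-≥ y zero    xs       _ = ≤-refl
esym-≥ y (suc d) (x ∷ xs) h with y ≤? x
... | no _    = ≤-trans (esym-≥ y (suc d) xs h) (m≤m+n _ _)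
... | yes y≤x = ≤-trans (*-mono-≤ y≤x (esym-≥ y d xs (s≤s⁻¹ h))) (m≤n+m _ _)

-- A product of r+1 distinct entries must use an entry below y.
esym-few : ∀ y n r xs → # xs (y ≤?_) < suc r → ∑ xs id ≤ n →
           esym (suc r) xs ≤ 2 ^ length xs * (y * n ^ r)
esym-few y n r []       _ _ = z≤n
esym-few y n r (x ∷ xs) few sum≤n with y ≤? x
... | no y≰x = begin
  esym (suc r) xs + x * esym r xs
    ≤⟨ +-mono-≤ (esym-few y n r xs few sum′) (*-mono-≤ (<⇒≤ (≰⇒> y≰x)) (≤-trans (esym-≤ r xs) (^-monoˡ-≤ r sum′))) ⟩
  2 ^ l * (y * n ^ r) + y * n ^ r
    ≤⟨ +-monoʳ-≤ _ (m≤n*m (y * n ^ r) (2 ^ l) {{m^n≢0 2 l}}) ⟩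
  2 ^ l * (y * n ^ r) + 2 ^ l * (y * n ^ r)
    ≡⟨ double (2 ^ l) (y * n ^ r) ⟩
  2 ^ suc l * (y * n ^ r) ∎
  where
  open ≤-Reasoning
  l = length xs
  sum′ : ∑ xs id ≤ n
  sum′ = ≤-trans (m≤n+m _ x) sum≤n
  double : ∀ a b → a * b + a * b ≡ (2 * a) * b
  double = solve-∀
esym-few y n (suc r) (x ∷ xs) few sum≤n | yes _ = begin
  esym (2 + r) xs + x * esym (suc r) xs
    ≤⟨ +-mono-≤ (esym-few y n (suc r) xs (<-trans (s<s⁻¹ few) (n<1+n _)) sum′)
                (*-mono-≤ (≤-trans (m≤m+n x _) sum≤n) (esym-few y n r xs (s<s⁻¹ few) sum′)) ⟩
  2 ^ l * (y * (n * n ^ r)) + n * (2 ^ l * (y * n ^ r))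
    ≡⟨ double (2 ^ l) y n (n ^ r) ⟩
  2 ^ suc l * (y * (n * n ^ r)) ∎
  where
  open ≤-Reasoning
  l = length xs
  sum′ : ∑ xs id ≤ n
  sum′ = ≤-trans (m≤n+m _ x) sum≤n
  double : ∀ a y n p → a * (y * (n * p)) + n * (a * (y * p)) ≡ (2 * a) * (y * (n * p))
  double = solve-∀
esym-few y n zero (x ∷ xs) few sum≤n | yes _ = contradiction (s<s⁻¹ few) (λ ())

Composition : ℕ → ℕ → List ℕ → Set
Composition m n b = length b ≡ m × ∑ b id ≡ n

-- The slack is quadratic because two quadratic errors have to fit into it: the edges through
-- non-fat pairs, and the pairs inside parts that `φ` counts.
NearOptimal : ℕ → ℕ → ℕ → ℕ → List ℕ → Set
NearOptimal r c m n b = ∀ b′ → Composition m n b′ → esym r b′ ≤ esym r b + c * (n * n)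

#-all : ∀ {Q : A → Set} {xs} (Q? : Decidable Q) → All Q xs → # xs Q? ≡ length xs
#-all Q? []       = refl
#-all Q? (q ∷ qs) = cong₂ _+_ (ι-yes (Q? _) q) (#-all Q? qs)

composition-↭ : ∀ {m n b b′} → b ↭ b′ → Composition m n b → Composition m n b′
composition-↭ p (len , sum) = Eq.trans (sym (↭ₚ.↭-length p)) len , Eq.trans (sym (∑-↭ id p)) sum

-- Otherwise few entries are large and esym is small, or moving g units from a large entry to
-- a small one gains a cubic amount.
near-optimal⇒large : ∀ {d c m n g s b ref} → Composition m n b → Composition m n ref →
  NearOptimal (3 + d) c m n b → s ≤ esym (3 + d) ref →
  2 ^ m * (4 * g * n ^ (2 + d)) + c * (n * n) < s →
  c * (n * n) < 2 * (g * g) * (4 * g) → All (g ≤_) b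
near-optimal⇒large {d} {c} {m} {n} {g} {s} {b} {ref} (len , sum) ref-ok near s≤ h₂ h₃ = All.tabulate large
  where
  open ≤-Reasoning
  many : 3 + d ≤ # b (4 * g ≤?_)
  many = ≮⇒≥ λ few → <-irrefl refl (begin-strict
    s                                 ≤⟨ s≤ ⟩
    esym (3 + d) ref                  ≤⟨ near ref ref-ok ⟩
    esym (3 + d) b + c * (n * n)      ≤⟨ +-monoˡ-≤ _ (esym-few (4 * g) n (2 + d) b few (≤-reflexive sum)) ⟩
    2 ^ length b * (4 * g * n ^ (2 + d)) + c * (n * n) ≡⟨ cong (λ l → 2 ^ l * (4 * g * n ^ (2 + d)) + c * (n * n)) len ⟩
    2 ^ m * (4 * g * n ^ (2 + d)) + c * (n * n) <⟨ h₂ ⟩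
    s                                 ∎)
  g≥1 : 1 ≤ g
  g≥1 = n≢0⇒n>0 λ { refl → n≮0 h₃ }
  large : ∀ {x} → x ∈ b → g ≤ x
  large {x} x∈ with g ≤? x
  ... | yes p = p
  ... | no x≱ with rest , b↭ ← ∈⇒↭ x∈
              with many-rest ← subst (3 + d ≤_) (Eq.trans (∑-↭ _ b↭)
                     (cong (_+ # rest (4 * g ≤?_)) (ι-no (4 * g ≤? x) (λ p → x≱ (≤-trans (m≤n*m g 4) p))))) many
              with y , y∈ , y≥ ← #-pos rest (4 * g ≤?_) (≤-trans (s≤s z≤n) many-rest)
              with zs , rest↭ ← ∈⇒↭ y∈ = contradiction (near moved moved-ok) (<⇒≱ gain)
    where
    x≤ : x ≤ g
    x≤ = <⇒≤ (≰⇒> x≱)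
    -- The subtraction is exact, as `x ≤ g` and `4 * g ≤ y`. With `w = y - g` the product rises from
    -- `x (w + g)` to `(x + g) w`, that is by `g (w - x) = 2 g² + g v`.
    v = y ∸ (3 * g + x)
    w = x + 2 * g + v
    y≡ : y ≡ w + g
    y≡ = Eq.trans (sym (m+[n∸m]≡n {3 * g + x} (≤-trans (+-monoʳ-≤ (3 * g) x≤)
           (≤-trans (≤-reflexive (+-comm (3 * g) g)) y≥)))) (rearrange g x v)
      where
      rearrange : ∀ g x v → (3 * g + x) + v ≡ x + 2 * g + v + g
      rearrange = solve-∀
    moved : List ℕ
    moved = (x + g) ∷ w ∷ zs
    b↭₂ : b ↭ x ∷ (w + g) ∷ zs
    b↭₂ = subst (λ y → b ↭ x ∷ y ∷ zs) y≡ (trans b↭ (prep x rest↭))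
    moved-ok : Composition m n moved
    moved-ok with l , e ← composition-↭ b↭₂ (len , sum) =
      l , Eq.trans (rearrange x g w (∑ zs id)) e
      where
      rearrange : ∀ x p w s → (x + p) + (w + s) ≡ x + ((w + p) + s)
      rearrange = solve-∀
    E = esym (1 + d) zs
    E≥ : 4 * g ≤ E
    E≥ = begin
      4 * g                     ≤⟨ m≤m*n (4 * g) ((4 * g) ^ d) {{m^n≢0 (4 * g) d {{>-nonZero (≤-trans g≥1 (m≤n*m g 4))}}}} ⟩
      (4 * g) ^ (1 + d)         ≤⟨ esym-≥ (4 * g) (1 + d) zs (≤-trans (n≤1+n _) (s≤s⁻¹ (≤-trans many-rest (≤-trans (≤-reflexive (∑-↭ _ rest↭))
                                     (+-monoˡ-≤ (# zs (4 * g ≤?_)) (ι≤1 (4 * g ≤? y))))))) ⟩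
      E                          ∎
    gain : esym (3 + d) b + c * (n * n) < esym (3 + d) moved
    gain = begin-strict
      esym (3 + d) b + c * (n * n)
        ≡⟨ cong (_+ c * (n * n)) (Eq.trans (esym-↭ (3 + d) b↭₂) (esym-two (1 + d) x (w + g) zs)) ⟩
      before + c * (n * n)                          <⟨ +-monoʳ-< before h₃ ⟩
      before + 2 * (g * g) * (4 * g)                ≤⟨ +-monoʳ-≤ before (*-monoʳ-≤ (2 * (g * g)) E≥) ⟩
      before + 2 * (g * g) * E                      ≤⟨ m≤m+n _ (g * v * E) ⟩
      before + 2 * (g * g) * E + g * v * E          ≡⟨ rearrange a a′ E x g v ⟩
      a + ((x + g) + w) * a′ + (x + g) * w * E      ≡⟨ sym (esym-two (1 + d) (x + g) w zs) ⟩
      esym (3 + d) moved                            ∎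
      where
      a = esym (3 + d) zs
      a′ = esym (2 + d) zs
      before = a + (x + (w + g)) * a′ + x * (w + g) * E
      rearrange : ∀ a a′ E x g v →
        (a + (x + ((x + 2 * g + v) + g)) * a′ + x * ((x + 2 * g + v) + g) * E) + 2 * (g * g) * E + g * v * E
        ≡ a + ((x + g) + (x + 2 * g + v)) * a′ + (x + g) * (x + 2 * g + v) * E
      rearrange = solve-∀

quotient : ∀ K n → 1 ≤ K → ∃ λ q → K * q ≤ n × n < K * suc q
quotient K n K≥1 = n / K , ≤-trans (≤-reflexive (*-comm K _)) (m/n*n≤m n K) ,
  (begin-strict
    n                    ≡⟨ m≡m%n+[m/n]*n n K ⟩
    n % K + n / K * K    <⟨ +-monoˡ-< _ (m%n<n n K) ⟩
    K + n / K * K        ≡⟨ cong (K +_) (*-comm _ K) ⟩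
    K + K * (n / K)      ≡⟨ sym (*-suc K _) ⟩
    K * suc (n / K)      ∎)
  where
  open ≤-Reasoning
  instance K≢0 = >-nonZero K≥1

^-distribʳ-* : ∀ r a b → (a * b) ^ r ≡ a ^ r * b ^ r
^-distribʳ-* zero    a b = refl
^-distribʳ-* (suc r) a b = Eq.trans (cong (a * b *_) (^-distribʳ-* r a b)) (exchange a b (a ^ r) (b ^ r))
  where
  exchange : ∀ a b c d → a * b * (c * d) ≡ a * c * (b * d)
  exchange = solve-∀

∑-replicate : ∀ m w → ∑ (List.replicate m w) id ≡ m * w
∑-replicate zero    w = refl
∑-replicate (suc m) w = cong (w +_) (∑-replicate m w)

large-parts : ∀ m d c → 3 + d ≤ m → ∃ λ K → ∃ λ N → ∀ n → N ≤ n → ∃ λ q → n ≤ K * q ×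
              (∀ b → Composition m n b → NearOptimal (3 + d) c m n b → All (4 * q ≤_) b)
large-parts m@(suc m′) d c r≤m = 2 * K , N , proof
  where
  open ≤-Reasoning
  -- `T` compares `n ^ r` with `w ^ r`, where `w` is the quotient of `n` by `m`; `a` is the factor
  -- lost in `esym-few`. `K * q ≤ n` keeps the main error of `h₂` below half of `w ^ r`. The first
  -- summand of `N` makes `q` large enough for `h₃`, the second makes `n` exceed `2 * T * c` and
  -- `m`.
  T = (2 * m) ^ (3 + d)
  a = 2 ^ m
  K₀ = T * a * 8
  K = K₀ * 4
  N = K * suc (c * (2 * K) * (2 * K)) + (suc (2 * T * c) + m)
  T≥1 : 1 ≤ T
  T≥1 = m^n>0 (2 * m) (3 + d)
  K≥1 : 1 ≤ K
  K≥1 = *-mono-≤ {1} {_} {1} (*-mono-≤ {1} {_} {1} (*-mono-≤ T≥1 (m^n>0 2 m)) (s≤s z≤n)) (s≤s z≤n)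
  proof : ∀ n → N ≤ n → ∃ λ q → n ≤ 2 * K * q ×
          (∀ b → Composition m n b → NearOptimal (3 + d) c m n b → All (4 * q ≤_) b)
  proof n N≤n with q , Kq≤n , n<Kq ← quotient K n K≥1 | w , mw≤n , n<mw ← quotient m n (s≤s z≤n) =
    q , n≤2Kq , λ b b-ok near → near-optimal⇒large {c = c} {g = 4 * q} {ref = ref} b-ok ref-ok near ref-large h₂ h₃
    where
    q> : c * (2 * K) * (2 * K) < q
    q> = s<s⁻¹ (*-cancelˡ-< K _ _ (≤-<-trans (≤-trans (m≤m+n _ _) N≤n) n<Kq))
    n>2Tc : 2 * T * c < n
    n>2Tc = ≤-trans (≤-trans (m≤m+n _ m) (m≤n+m _ (K * suc (c * (2 * K) * (2 * K))))) N≤n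
    m≤n : m ≤ n
    m≤n = ≤-trans (≤-trans (m≤n+m m (suc (2 * T * c))) (m≤n+m _ (K * suc (c * (2 * K) * (2 * K))))) N≤n
    q≥1 : 1 ≤ q
    q≥1 = ≤-<-trans z≤n q>
    w≥1 : 1 ≤ w
    w≥1 = s<s⁻¹ (*-cancelˡ-< m 1 (suc w) (≤-<-trans (≤-trans (≤-reflexive (*-identityʳ m)) m≤n) n<mw))
    doubling : ∀ K q → 1 ≤ q → n < K * suc q → n ≤ 2 * K * q
    doubling K q q≥1 h = begin
      n             ≤⟨ <⇒≤ h ⟩
      K * suc q     ≤⟨ *-monoʳ-≤ K (+-monoˡ-≤ q q≥1) ⟩
      K * (q + q)   ≡⟨ rearrange K q ⟩
      2 * K * q     ∎
      where
      rearrange : ∀ K q → K * (q + q) ≡ 2 * K * q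
      rearrange = solve-∀
    n≤2Kq = doubling K q q≥1 n<Kq
    g = 4 * q
    q≤g : q ≤ g
    q≤g = m≤n*m q 4
    instance
      n≢0 = >-nonZero (≤-<-trans z≤n n>2Tc)
      T≢0 = >-nonZero T≥1
      q≢0 = >-nonZero q≥1
    m′w≤n : m′ * w ≤ n
    m′w≤n = ≤-trans (m≤n+m _ w) mw≤n
    -- Only the lower bound `w` on every entry matters, so the whole remainder may sit in the first
    -- one.
    ref = (n ∸ m′ * w) ∷ List.replicate m′ w
    ref-ok : Composition m n ref
    ref-ok = cong suc (Listₚ.length-replicate m′) , Eq.trans (cong (n ∸ m′ * w +_) (∑-replicate m′ w)) (m∸n+n≡m m′w≤n)
    ref≥ : All (w ≤_) ref
    ref≥ = m+n≤o⇒m≤o∸n w mw≤n ∷ Allₚ.replicate⁺ m′ ≤-refl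
    ref-large : w ^ (3 + d) ≤ esym (3 + d) ref
    ref-large = esym-≥ w (3 + d) ref (≤-trans r≤m (≤-reflexive (sym (Eq.trans (#-all (w ≤?_) ref≥) (proj₁ ref-ok)))))
    h₂ : a * (4 * g * n ^ (2 + d)) + c * (n * n) < w ^ (3 + d)
    h₂ = *-cancelˡ-< (2 * T) _ _ (begin-strict
      2 * T * (a * (4 * g * p) + c * (n * n)) ≡⟨ rearrange T a g p c n ⟩
      K₀ * g * p + 2 * T * c * (n * n)         <⟨ +-mono-≤-< (*-monoˡ-≤ p (≤-trans (≤-reflexive (sym (*-assoc K₀ 4 q))) Kq≤n)) (*-monoˡ-< (n * n) {{m*n≢0 n n}} n>2Tc) ⟩
      n * p + n * (n * n)                      ≤⟨ +-monoʳ-≤ (n * p) (*-monoʳ-≤ n (*-monoʳ-≤ n (m≤m*n n (n ^ d) {{m^n≢0 n d}}))) ⟩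
      n * p + n * p                            ≤⟨ +-mono-≤ n^r≤ n^r≤ ⟩
      T * W + T * W                            ≡⟨ double T W ⟩
      2 * T * W                                ∎)
      where
      p = n ^ (2 + d)
      W = w ^ (3 + d)
      n^r≤ : n * p ≤ T * W
      n^r≤ = begin
        n ^ (3 + d)           ≤⟨ ^-monoˡ-≤ (3 + d) (doubling m w w≥1 n<mw) ⟩
        (2 * m * w) ^ (3 + d) ≡⟨ ^-distribʳ-* (3 + d) (2 * m) w ⟩
        T * W                 ∎
      double : ∀ a b → a * b + a * b ≡ 2 * a * b
      double = solve-∀
      rearrange : ∀ T a g p c n → 2 * T * (a * (4 * g * p) + c * (n * n)) ≡ T * a * 8 * g * p + 2 * T * c * (n * n)
      rearrange = solve-∀
    h₃ : c * (n * n) < 2 * (g * g) * (4 * g)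
    h₃ = begin-strict
      c * (n * n)                             ≤⟨ *-monoʳ-≤ c (*-mono-≤ n≤2Kq n≤2Kq) ⟩
      c * ((2 * K * q) * (2 * K * q))         ≡⟨ rearrange c (2 * K) q ⟩
      c * (2 * K) * (2 * K) * (q * q)         <⟨ *-monoˡ-< (q * q) {{m*n≢0 q q}} q> ⟩
      q * (q * q)                             ≤⟨ *-mono-≤ q≤g (*-mono-≤ q≤g q≤g) ⟩
      g * (g * g)                             ≡⟨ *-comm g (g * g) ⟩
      g * g * g                               ≤⟨ *-mono-≤ (m≤n*m (g * g) 2) (m≤n*m g 4) ⟩
      2 * (g * g) * (4 * g)                   ∎
      where
      rearrange : ∀ c k q → c * ((k * q) * (k * q)) ≡ c * k * k * (q * q)
      rearrange = solve-∀

-- Part sizes that maximise the size of `𝒬`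

tri : ℕ → ℕ
tri zero    = 0
-- A further vertex forms a pair with each of the `x` earlier ones, so `tri x` is `x` choose 2.
tri (suc x) = x + tri x

tri-≤ : ∀ x → tri x ≤ x * x
tri-≤ zero    = z≤n
tri-≤ (suc x) = ≤-trans (+-mono-≤ (n≤1+n x) (tri-≤ x)) (+-monoʳ-≤ (suc x) (*-monoʳ-≤ x (n≤1+n x)))

∑-tri-≤ : ∀ b → ∑ b tri ≤ ∑ b id * ∑ b id
∑-tri-≤ []      = z≤n
∑-tri-≤ (x ∷ b) = begin
  tri x + ∑ b tri                       ≤⟨ +-mono-≤ (tri-≤ x) (∑-tri-≤ b) ⟩
  x * x + s * s                         ≤⟨ m≤m+n _ (2 * x * s) ⟩
  x * x + s * s + 2 * x * s             ≡⟨ square x s ⟩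
  (x + s) * (x + s)                     ∎
  where
  open ≤-Reasoning
  s = ∑ b id
  square : ∀ x s → x * x + s * s + 2 * x * s ≡ (x + s) * (x + s)
  square = solve-∀

-- The size of 𝒬ʳ_t when the parts have sizes b and s = t - 1.
φ : ℕ → ℕ → List ℕ → ℕ
φ r s b = esym r b + s * ∑ b tri

Optimal : ℕ → ℕ → ℕ → ℕ → List ℕ → Set
Optimal r s m n b = ∀ b′ → Composition m n b′ → φ r s b′ ≤ φ r s b

tuples : ℕ → ℕ → List (List ℕ)
tuples zero    n = [] ∷ []
tuples (suc m) n = List.cartesianProductWith _∷_ (List.upTo (suc n)) (tuples m n)

∈-tuples : ∀ {n} b → ∑ b id ≤ n → b ∈ tuples (length b) n
∈-tuples []      _ = here refl
∈-tuples (x ∷ b) h = ∈ₚ.∈-cartesianProductWith⁺ _∷_ (∈ₚ.∈-upTo⁺ (s≤s (≤-trans (m≤m+n x _) h)))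
                       (∈-tuples b (≤-trans (m≤n+m _ x) h))

composition? : ∀ m n → Decidable (Composition m n)
composition? m n b = (length b ℕₚ.≟ m) ×-dec (∑ b id ℕₚ.≟ n)

-- The maximum is taken over the finitely many lists with entries at most `n`. It stays inexplicit;
-- all that is known of it later is derived from optimality.
optimal-exists : ∀ r s m n → ∃ λ b → Composition (suc m) n b × Optimal r s (suc m) n b
optimal-exists r s m n = let b , b∈ , max = max-∃ (φ r s) candidates (complete (n ∷ List.replicate m 0) start)
  in b , proj₂ (∈ₚ.∈-filter⁻ (composition? (suc m) n) {xs = tuples (suc m) n} b∈) , λ b′ ok → max (complete b′ ok)
  where
  candidates : List (List ℕ)
  candidates = filter (composition? (suc m) n) (tuples (suc m) n)
  complete : ∀ b → Composition (suc m) n b → b ∈ candidates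
  complete b ok@(len , sum) = ∈ₚ.∈-filter⁺ (composition? (suc m) n)
    (subst (λ l → b ∈ tuples l n) len (∈-tuples b (≤-reflexive sum))) ok
  start : Composition (suc m) n (n ∷ List.replicate m 0)
  start = cong suc (Listₚ.length-replicate m) ,
          Eq.trans (cong (n +_) (Eq.trans (∑-replicate m 0) (*-zeroʳ m))) (+-identityʳ n)

-- The inner pairs contribute at most `s * (n * n)` to `φ`, so an optimum of `φ` loses at most that
-- much in `esym`. Hence `large-parts` applies to it.
optimal⇒near-optimal : ∀ {r s c m n b} → s ≤ c → Composition m n b → Optimal r s m n b → NearOptimal r c m n b
optimal⇒near-optimal {r} {s} {c} {m} {n} {b} s≤c (_ , sum) opt b′ ok = begin
  esym r b′                  ≤⟨ m≤m+n _ _ ⟩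
  φ r s b′                   ≤⟨ opt b′ ok ⟩
  esym r b + s * ∑ b tri     ≤⟨ +-monoʳ-≤ _ (*-mono-≤ s≤c (∑-tri-≤ b)) ⟩
  esym r b + c * (∑ b id * ∑ b id) ≡⟨ cong (λ x → esym r b + c * (x * x)) sum ⟩
  esym r b + c * (n * n)     ∎
  where open ≤-Reasoning

-- If `u = v + 2 + w`, moving one vertex from the larger part to the smaller raises the product of
-- the two sizes by `w + 1` and lowers the number of inner pairs by `w + 1`. The net change of `φ`
-- is `(w + 1) (E - s)`, where `E` has degree `r - 2 ≥ 1` in parts of size at least `y > s` and is
-- therefore above `s`.
optimal⇒balanced : ∀ {d s m n y b} → 3 + d ≤ m → Composition m n b → Optimal (3 + d) s m n b →
  s < y → All (y ≤_) b → ∀ {u v zs} → b ↭ u ∷ v ∷ zs → u ≤ v + 1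
optimal⇒balanced {d} {s} {m} {n} {y} {b} r≤m ok opt s<y b≥ {u} {v} {zs} b↭ = ≮⇒≥ λ v<u →
  contradiction (opt moved (moved-ok (gap v<u))) (<⇒≱ (gain (gap v<u)))
  where
  open ≤-Reasoning
  gap : v + 1 < u → u ≡ v + 2 + (u ∸ (v + 2))
  gap v<u = sym (m+[n∸m]≡n (≤-trans (≤-reflexive (+-suc v 1)) v<u))
  w = u ∸ (v + 2)
  moved : List ℕ
  moved = suc v ∷ suc (v + w) ∷ zs
  moved-ok : u ≡ v + 2 + w → Composition m n moved
  moved-ok u≡ with l , e ← composition-↭ b↭ ok = l , Eq.trans (rearrange v w _) (Eq.trans (cong (_+ (v + ∑ zs id)) (sym u≡)) e)
    where
    rearrange : ∀ v w s → suc v + (suc (v + w) + s) ≡ (v + 2 + w) + (v + s)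
    rearrange = solve-∀
  E = esym (1 + d) zs
  zs≥ : All (y ≤_) zs
  zs≥ with ↭ₚ.All-resp-↭ b↭ b≥
  ... | _ ∷ _ ∷ h = h
  s<E : s < E
  s<E = begin-strict
    s             <⟨ s<y ⟩
    y             ≤⟨ m≤m*n y (y ^ d) {{m^n≢0 y d {{>-nonZero (≤-<-trans z≤n s<y)}}}} ⟩
    y ^ (1 + d)   ≤⟨ esym-≥ y (1 + d) zs (≤-trans (s≤s⁻¹ (s≤s⁻¹ (≤-trans r≤m (≤-reflexive (sym (proj₁ (composition-↭ b↭ ok)))))))
                       (≤-reflexive (sym (#-all (y ≤?_) zs≥)))) ⟩
    E             ∎
  gain : u ≡ v + 2 + w → φ (3 + d) s b < φ (3 + d) s moved
  gain u≡ = begin-strict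
    esym (3 + d) b + s * ∑ b tri
      ≡⟨ cong₂ (λ x y → x + s * y) (Eq.trans (esym-↭ (3 + d) b↭) (esym-two (1 + d) u v zs)) (∑-↭ tri b↭) ⟩
    (a + (u + v) * a′ + u * v * E) + s * (tri u + (tri v + τ))
      ≡⟨ cong (λ u → (a + (u + v) * a′ + u * v * E) + s * (tri u + (tri v + τ))) (Eq.trans u≡ (shape v w)) ⟩
    (a + (suc (suc (v + w)) + v) * a′ + suc (suc (v + w)) * v * E) + s * (suc (v + w) + tri (suc (v + w)) + (tri v + τ))
      ≡⟨ rearrange a a′ E s v w (tri (suc (v + w))) (tri v) τ ⟩
    a + (suc v + suc (v + w)) * a′ + (suc v * suc (v + w) ∸ suc w) * E + s * suc w + s * (v + tri v + (tri (suc (v + w)) + τ))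
      <⟨ +-monoˡ-< _ (+-monoʳ-< (a + (suc v + suc (v + w)) * a′ + (suc v * suc (v + w) ∸ suc w) * E) (*-monoˡ-< (suc w) s<E)) ⟩
    a + (suc v + suc (v + w)) * a′ + (suc v * suc (v + w) ∸ suc w) * E + E * suc w + s * (v + tri v + (tri (suc (v + w)) + τ))
      ≡⟨ cong (_+ s * (v + tri v + (tri (suc (v + w)) + τ))) (merge a a′ E v w) ⟩
    a + (suc v + suc (v + w)) * a′ + (suc v * suc (v + w)) * E + s * (v + tri v + (tri (suc (v + w)) + τ))
      ≡⟨ cong (_+ s * (tri (suc v) + (tri (suc (v + w)) + τ))) (sym (esym-two (1 + d) (suc v) (suc (v + w)) zs)) ⟩
    φ (3 + d) s moved ∎
    where
    a = esym (3 + d) zs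
    a′ = esym (2 + d) zs
    τ = ∑ zs tri
    shape : ∀ v w → v + 2 + w ≡ suc (suc (v + w))
    shape = solve-∀
    -- The new product of sizes exceeds the old one by exactly `suc w`, so this truncated
    -- subtraction loses nothing and isolates the gain.
    product : ∀ v w → suc v * suc (v + w) ∸ suc w ≡ suc (suc (v + w)) * v
    product v w = Eq.trans (cong (_∸ suc w) (expand v w)) (m+n∸n≡m (suc (suc (v + w)) * v) (suc w))
      where
      expand : ∀ v w → suc v * suc (v + w) ≡ suc (suc (v + w)) * v + suc w
      expand = solve-∀
    rearrange : ∀ a a′ E s v w x y τ →
      (a + (suc (suc (v + w)) + v) * a′ + suc (suc (v + w)) * v * E) + s * (suc (v + w) + x + (y + τ)) ≡
      a + (suc v + suc (v + w)) * a′ + (suc v * suc (v + w) ∸ suc w) * E + s * suc w + s * (v + y + (x + τ))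
    rearrange a a′ E s v w x y τ rewrite product v w = expand a a′ E s v w x y τ
      where
      expand : ∀ a a′ E s v w x y τ →
        (a + (suc (suc (v + w)) + v) * a′ + suc (suc (v + w)) * v * E) + s * (suc (v + w) + x + (y + τ)) ≡
        a + (suc v + suc (v + w)) * a′ + (suc (suc (v + w)) * v) * E + s * suc w + s * (v + y + (x + τ))
      expand = solve-∀
    merge : ∀ a a′ E v w →
      a + (suc v + suc (v + w)) * a′ + (suc v * suc (v + w) ∸ suc w) * E + E * suc w ≡
      a + (suc v + suc (v + w)) * a′ + (suc v * suc (v + w)) * E
    merge a a′ E v w rewrite product v w = expand a a′ E v w
      where
      expand : ∀ a a′ E v w →
        a + (suc v + suc (v + w)) * a′ + (suc (suc (v + w)) * v) * E + E * suc w ≡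
        a + (suc v + suc (v + w)) * a′ + (suc v * suc (v + w)) * E
      expand = solve-∀

-- Part sizes and transversals

size : ∀ {n m} → (Fin n → Fin m) → Fin m → ℕ
size {n} p j = # (allFin n) (λ v → p v ≟ j)

partSize≡size : ∀ {n m} (p : Fin n → Fin m) j → partSize p j ≡ size p j
partSize≡size {zero}  p j = refl
partSize≡size {suc n} p j = Eq.trans head (sym (∑-allFin-suc (λ v → ι (p v ≟ j))))
  where
  head : partSize p j ≡ ι (p zero ≟ j) + size (p ∘ suc) j
  head with p zero ≟ j
  ... | yes _ = cong suc (partSize≡size (p ∘ suc) j)
  ... | no _  = partSize≡size (p ∘ suc) j

size-suc : ∀ {n m} (p : Fin (suc n) → Fin m) j → size p j ≡ ι (p zero ≟ j) + size (p ∘ suc) j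
size-suc p j = ∑-allFin-suc (λ v → ι (p v ≟ j))

sizes : ∀ {n m} → (Fin n → Fin m) → List ℕ
sizes p = List.tabulate (size p)

#-Fin-single : ∀ {m} {Q : Fin m → Set} (Q? : Decidable Q) j → Q j → (∀ i → Q i → i ≡ j) → # (allFin m) Q? ≡ 1
#-Fin-single Q? j = #-single Q? (Uniqueₚ.allFin⁺ _) (∈ₚ.∈-allFin j)

∑-size : ∀ {n m} (p : Fin n → Fin m) → ∑ (allFin m) (size p) ≡ n
∑-size {n} {m} p = begin
  ∑ (allFin m) (size p)                                    ≡⟨ ∑-swap (allFin m) (allFin n) ⟩
  ∑ (allFin n) (λ v → ∑ (allFin m) (λ j → ι (p v ≟ j)))    ≡⟨ ∑-cong (allFin n) (λ v → #-Fin-single (p v ≟_) (p v) refl (λ _ → sym)) ⟩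
  ∑ (allFin n) (λ _ → 1)                                   ≡⟨ ∑-const (allFin n) 1 ⟩
  length (allFin n) * 1                                    ≡⟨ *-identityʳ _ ⟩
  length (allFin n)                                        ≡⟨ Listₚ.length-tabulate id ⟩
  n                                                        ∎
  where open ≡-Reasoning

sizes-composition : ∀ {n m} (p : Fin n → Fin m) → Composition m n (sizes p)
sizes-composition p = Listₚ.length-tabulate _ , Eq.trans (∑-tabulate (size p) {id}) (∑-size p)

Transversal : ∀ {n m} → (Fin n → Fin m) → Subset n → Set
Transversal p e = ∀ u v → u ∈ₛ e → v ∈ₛ e → p u ≡ p v → u ≡ v

abstract
  transversal? : ∀ {n m} (p : Fin n → Fin m) → Decidable (Transversal p)
  transversal? p e = Finₚ.all? λ u → Finₚ.all? λ v → (u ∈? e) →-dec ((v ∈? e) →-dec ((p u ≟ p v) →-dec (u ≟ v)))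

abstract
  TEdge? : ∀ {n m} r (p : Fin n → Fin m) → Decidable (TEdge r p)
  TEdge? r p e = (∣ e ∣ ℕₚ.≟ r) ×-dec transversal? p e

-- `esym` is linear in each entry. Think of `f⁺` as `f` with one more vertex in part `i`, and of
-- `f⁰` as `f` with that part emptied: the transversals gained consist of the new vertex and `r`
-- vertices of other parts.
esym-bump : ∀ r {m} (f f⁺ f⁰ : Fin m → ℕ) i → f⁺ i ≡ suc (f i) → f⁰ i ≡ 0 →
            (∀ j → j ≢ i → f⁺ j ≡ f j) → (∀ j → j ≢ i → f⁰ j ≡ f j) →
            esym (suc r) (List.tabulate f⁺) ≡ esym (suc r) (List.tabulate f) + esym r (List.tabulate f⁰)
esym-bump r f f⁺ f⁰ zero e⁺ e⁰ h⁺ h⁰ = begin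
  esym (suc r) (List.tabulate f⁺)
    ≡⟨ cong₂ (λ x xs → esym (suc r) (x ∷ xs)) e⁺ (Listₚ.tabulate-cong λ j → h⁺ (suc j) λ ()) ⟩
  esym (suc r) t + suc (f zero) * esym r t
    ≡⟨ rearrange (esym (suc r) t) (f zero) (esym r t) ⟩
  esym (suc r) t + f zero * esym r t + esym r t
    ≡⟨ cong (esym (suc r) t + f zero * esym r t +_) (sym (skip r)) ⟩
  esym (suc r) t + f zero * esym r t + esym r (0 ∷ t)
    ≡⟨ cong (λ l → esym (suc r) t + f zero * esym r t + esym r l) (sym (cong₂ _∷_ e⁰ (Listₚ.tabulate-cong λ j → h⁰ (suc j) λ ()))) ⟩
  esym (suc r) t + f zero * esym r t + esym r (List.tabulate f⁰) ∎
  where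
  open ≡-Reasoning
  t = List.tabulate (f ∘ suc)
  skip : ∀ r → esym r (0 ∷ t) ≡ esym r t
  skip zero    = refl
  skip (suc r) = +-identityʳ _
  rearrange : ∀ a x b → a + suc x * b ≡ a + x * b + b
  rearrange = solve-∀
esym-bump zero f f⁺ f⁰ (suc i) e⁺ e⁰ h⁺ h⁰ = begin
  esym 1 t⁺ + f⁺ zero * 1 ≡⟨ cong₂ (λ a x → a + x * 1) (esym-bump 0 (f ∘ suc) (f⁺ ∘ suc) (f⁰ ∘ suc) i e⁺ e⁰ (λ j j≢ → h⁺ (suc j) (j≢ ∘ Finₚ.suc-injective)) (λ j j≢ → h⁰ (suc j) (j≢ ∘ Finₚ.suc-injective))) (h⁺ zero λ ()) ⟩
  esym 1 t + 1 + f zero * 1 ≡⟨ rearrange (esym 1 t) (f zero) ⟩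
  esym 1 t + f zero * 1 + 1 ∎
  where
  open ≡-Reasoning
  t = List.tabulate (f ∘ suc)
  t⁺ = List.tabulate (f⁺ ∘ suc)
  rearrange : ∀ a x → a + 1 + x * 1 ≡ a + x * 1 + 1
  rearrange = solve-∀
esym-bump (suc r) f f⁺ f⁰ (suc i) e⁺ e⁰ h⁺ h⁰ = begin
  esym (2 + r) t⁺ + f⁺ zero * esym (suc r) t⁺
    ≡⟨ cong (λ x → esym (2 + r) t⁺ + x * esym (suc r) t⁺) (h⁺ zero λ ()) ⟩
  esym (2 + r) t⁺ + f zero * esym (suc r) t⁺
    ≡⟨ cong₂ (λ a b → a + f zero * b) (ih (suc r)) (ih r) ⟩
  (esym (2 + r) t + esym (suc r) t⁰) + f zero * (esym (suc r) t + esym r t⁰)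
    ≡⟨ rearrange (esym (2 + r) t) (esym (suc r) t⁰) (f zero) (esym (suc r) t) (esym r t⁰) ⟩
  esym (2 + r) t + f zero * esym (suc r) t + (esym (suc r) t⁰ + f zero * esym r t⁰)
    ≡⟨ cong (λ x → esym (2 + r) t + f zero * esym (suc r) t + (esym (suc r) t⁰ + x * esym r t⁰)) (sym (h⁰ zero λ ())) ⟩
  esym (2 + r) t + f zero * esym (suc r) t + (esym (suc r) t⁰ + f⁰ zero * esym r t⁰) ∎
  where
  open ≡-Reasoning
  t = List.tabulate (f ∘ suc)
  t⁺ = List.tabulate (f⁺ ∘ suc)
  t⁰ = List.tabulate (f⁰ ∘ suc)
  ih : ∀ r → esym (suc r) t⁺ ≡ esym (suc r) t + esym r t⁰
  ih r = esym-bump r (f ∘ suc) (f⁺ ∘ suc) (f⁰ ∘ suc) i e⁺ e⁰ (λ j j≢ → h⁺ (suc j) (j≢ ∘ Finₚ.suc-injective)) (λ j j≢ → h⁰ (suc j) (j≢ ∘ Finₚ.suc-injective))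
  rearrange : ∀ a b x c d → (a + b) + x * (c + d) ≡ a + x * c + (b + x * d)
  rearrange = solve-∀

-- The first vertex uses up its part, so the induction on n counts the transversals that stay
-- within a set of parts still allowed.
Within : ∀ {n m} → ℕ → (Fin n → Fin m) → (Fin m → Bool) → Subset n → Set
Within r p av e = TEdge r p e × (∀ u → u ∈ₛ e → av (p u) ≡ true)

abstract
  within? : ∀ {n m} r (p : Fin n → Fin m) av → Decidable (Within r p av)
  within? r p av e = TEdge? r p e ×-dec Finₚ.all? λ u → (u ∈? e) →-dec (av (p u) Boolₚ.≟ true)

without : ∀ {m} → (Fin m → Bool) → Fin m → Fin m → Bool
without av i j with i ≟ j
... | yes _ = false
... | no _  = av j

without-≡ : ∀ {m} (av : Fin m → Bool) i → without av i i ≡ false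
without-≡ av i with i ≟ i
... | yes _ = refl
... | no ne = contradiction refl ne

without-≢ : ∀ {m} (av : Fin m → Bool) {i j} → i ≢ j → without av i j ≡ av j
without-≢ av {i} {j} i≢j with i ≟ j
... | yes e = contradiction e i≢j
... | no _  = refl

restrict : ∀ {m} → (Fin m → Bool) → (Fin m → ℕ) → Fin m → ℕ
restrict av f j with av j
... | true  = f j
... | false = 0

restrict-true : ∀ {m} (av : Fin m → Bool) f {j} → av j ≡ true → restrict av f j ≡ f j
restrict-true av f {j} e with av j
... | true = refl

restrict-false : ∀ {m} (av : Fin m → Bool) f {j} → av j ≡ false → restrict av f j ≡ 0
restrict-false av f {j} e with av j
... | false = refl

restrict-cong : ∀ {m} (av av′ : Fin m → Bool) (f f′ : Fin m → ℕ) {j} → av j ≡ av′ j → f j ≡ f′ j → restrict av f j ≡ restrict av′ f′ j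
restrict-cong av av′ f f′ {j} e e′ with av j | av′ j
restrict-cong av av′ f f′ refl e′ | true  | .true  = e′
restrict-cong av av′ f f′ refl e′ | false | .false = refl

#-within : ∀ {n m} r (p : Fin n → Fin m) av → # (subs n) (within? r p av) ≡ esym r (List.tabulate (restrict av (size p)))
#-within {zero} zero p av = cong (_+ 0) (ι-yes (within? 0 p av []) ((refl , λ ()) , λ ()))
#-within {zero} {m} (suc r) p av = Eq.trans (cong (_+ 0) (ι-no (within? (suc r) p av []) λ { ((() , _) , _) })) (sym (vanish m (restrict av (size p)) λ j → zero-size j))
  where
  zero-size : ∀ j → restrict av (size p) j ≡ 0
  zero-size j with av j
  ... | true  = refl
  ... | false = refl
  vanish : ∀ m (f : Fin m → ℕ) → (∀ j → f j ≡ 0) → esym (suc r) (List.tabulate f) ≡ 0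
  vanish zero    f h = refl
  vanish (suc m) f h = cong₂ (λ a x → a + x * esym r (List.tabulate (f ∘ suc))) (vanish m (f ∘ suc) (h ∘ suc)) (h zero)
#-within {suc n} r p av = Eq.trans (∑-subs-suc (λ e → ι (within? r p av e))) (Eq.trans (cong (∑ (subs n) (λ e → ι (within? r p av (true ∷ e))) +_) outside-count) (go r (av (p zero)) refl))
  where
  outside-count : # (subs n) (λ e → within? r p av (false ∷ e)) ≡ esym r (List.tabulate (restrict av (size (p ∘ suc))))
  outside-count = Eq.trans
    (#-cong (subs n) _ (within? r (p ∘ suc) av)
      (λ e ((len , tr) , w) → (len , λ u v u∈ v∈ eq → Finₚ.suc-injective (tr (suc u) (suc v) (there u∈) (there v∈) eq)) , λ u u∈ → w (suc u) (there u∈))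
      (λ e ((len , tr) , w) → (len , λ { (suc u) (suc v) (there u∈) (there v∈) eq → cong suc (tr u v u∈ v∈ eq) }) , λ { (suc u) (there u∈) → w u u∈ }))
    (#-within r (p ∘ suc) av)
  same : av (p zero) ≡ false → ∀ j → restrict av (size p) j ≡ restrict av (size (p ∘ suc)) j
  same e j = by (p zero ≟ j)
    where
    by : Dec (p zero ≡ j) → restrict av (size p) j ≡ restrict av (size (p ∘ suc)) j
    by (yes refl) = Eq.trans (restrict-false av _ e) (sym (restrict-false av _ e))
    by (no ne)    = restrict-cong av av _ _ refl (Eq.trans (size-suc p j) (cong (_+ size (p ∘ suc) j) (ι-no (p zero ≟ j) ne)))
  -- The first summand counts the sets containing the first vertex. There are none if its part is
  -- forbidden; otherwise their remaining vertices avoid this part, and `esym-bump` adds up the two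
  -- counts.
  go : ∀ r b → av (p zero) ≡ b → # (subs n) (λ e → within? r p av (true ∷ e)) + esym r (List.tabulate (restrict av (size (p ∘ suc))))
                ≡ esym r (List.tabulate (restrict av (size p)))
  go r false e = cong₂ _+_ (#-none (subs n) _ λ d (_ , w) → case Eq.trans (sym e) (w zero here) of λ ())
                           (cong (esym r) (Listₚ.tabulate-cong (λ j → sym (same e j))))
  go zero true e = cong (_+ 1) (#-none (subs n) (λ e → within? 0 p av (true ∷ e)) λ { d ((() , _) , _) })
  go (suc r) true e = begin
    # (subs n) (λ d → within? (suc r) p av (true ∷ d)) + esym (suc r) (List.tabulate f)
      ≡⟨ cong (_+ esym (suc r) (List.tabulate f)) (#-cong (subs n) _ (within? r (p ∘ suc) av′) to from) ⟩
    # (subs n) (within? r (p ∘ suc) av′) + esym (suc r) (List.tabulate f)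
      ≡⟨ cong (_+ esym (suc r) (List.tabulate f)) (#-within r (p ∘ suc) av′) ⟩
    esym r (List.tabulate f⁰) + esym (suc r) (List.tabulate f)
      ≡⟨ +-comm _ (esym (suc r) (List.tabulate f)) ⟩
    esym (suc r) (List.tabulate f) + esym r (List.tabulate f⁰)
      ≡⟨ sym (esym-bump r f f⁺ f⁰ i e⁺ (restrict-false av′ _ (without-≡ av i)) h⁺ λ j j≢ → restrict-cong av′ av _ _ (without-≢ av (j≢ ∘ sym)) refl) ⟩
    esym (suc r) (List.tabulate f⁺) ∎
    where
    open ≡-Reasoning
    i = p zero
    av′ = without av i
    f = restrict av (size (p ∘ suc))
    f⁺ = restrict av (size p)
    f⁰ = restrict av′ (size (p ∘ suc))
    e⁺ : f⁺ i ≡ suc (f i)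
    e⁺ = Eq.trans (restrict-true av _ e) (Eq.trans (size-suc p i) (cong₂ _+_ (ι-yes (i ≟ i) refl) (sym (restrict-true av _ e))))
    h⁺ : ∀ j → j ≢ i → f⁺ j ≡ f j
    h⁺ j j≢ = restrict-cong av av _ _ refl (Eq.trans (size-suc p j) (cong (_+ size (p ∘ suc) j) (ι-no (i ≟ j) (j≢ ∘ sym))))
    to : ∀ d → Within (suc r) p av (true ∷ d) → Within r (p ∘ suc) av′ d
    to d ((len , tr) , w) =
      (ℕₚ.suc-injective len , λ u v u∈ v∈ eq → Finₚ.suc-injective (tr (suc u) (suc v) (there u∈) (there v∈) eq)) ,
      λ u u∈ → Eq.trans (without-≢ av {i} (λ i≡ → case tr zero (suc u) here (there u∈) i≡ of λ ())) (w (suc u) (there u∈))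
    avoid : ∀ {d} → Within r (p ∘ suc) av′ d → ∀ {u} → u ∈ₛ d → i ≢ p (suc u)
    avoid (_ , w) {u} u∈ eq = case Eq.trans (sym (w u u∈)) (Eq.trans (cong av′ (sym eq)) (without-≡ av i)) of λ ()
    from : ∀ d → Within r (p ∘ suc) av′ d → Within (suc r) p av (true ∷ d)
    from d W@((len , tr) , w) = (cong suc len , tr′) , w′
      where
      tr′ : Transversal p (true ∷ d)
      tr′ zero    zero    _ _ _ = refl
      tr′ zero    (suc v) _ (there v∈) eq = contradiction eq (avoid W v∈)
      tr′ (suc u) zero    (there u∈) _ eq = contradiction (sym eq) (avoid W u∈)
      tr′ (suc u) (suc v) (there u∈) (there v∈) eq = cong suc (tr u v u∈ v∈ eq)
      w′ : ∀ u → u ∈ₛ true ∷ d → av (p u) ≡ true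
      w′ zero    _          = e
      w′ (suc u) (there u∈) = Eq.trans (sym (without-≢ av (avoid W u∈))) (w u u∈)

#-TEdge : ∀ {n m} r (p : Fin n → Fin m) → # (subs n) (TEdge? r p) ≡ esym r (sizes p)
#-TEdge {n} r p = Eq.trans
  (#-cong (subs n) (TEdge? r p) (within? r p (λ _ → true)) (λ _ t → t , λ _ _ → refl) (λ _ → proj₁))
  (#-within r p (λ _ → true))

SamePair : ∀ {n m} → (Fin n → Fin m) → Fin n → Fin n → Set
SamePair p u v = u <ᶠ v × p u ≡ p v

samePair? : ∀ {n m} (p : Fin n → Fin m) u v → Dec (SamePair p u v)
samePair? p u v = (u Finₚ.<? v) ×-dec (p u ≟ p v)

#-samePairs : ∀ {n m} (p : Fin n → Fin m) →
  ∑ (allFin n) (λ u → # (allFin n) (samePair? p u)) ≡ ∑ (sizes p) tri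
#-samePairs {n} {m} p = Eq.trans (go n p) (sym (∑-tabulate (size p) {tri}))
  where
  open ≡-Reasoning
  tri-ι : ∀ {P : Set} (d : Dec P) x → tri (ι d + x) ≡ ι d * x + tri x
  tri-ι (yes _) x = cong (_+ tri x) (sym (+-identityʳ x))
  tri-ι (no _)  x = refl
  go : ∀ n (p : Fin n → Fin m) → ∑ (allFin n) (λ u → # (allFin n) (samePair? p u)) ≡ ∑ (allFin m) (tri ∘ size p)
  go zero p = sym (Eq.trans (∑-cong (allFin m) λ _ → refl) (∑-0 (allFin m)))
  go (suc n) p = begin
    ∑ (allFin (suc n)) (λ u → # (allFin (suc n)) (samePair? p u))
      ≡⟨ ∑-allFin-suc (λ u → # (allFin (suc n)) (samePair? p u)) ⟩
    # (allFin (suc n)) (samePair? p zero) + ∑ (allFin n) (λ u → # (allFin (suc n)) (samePair? p (suc u)))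
      ≡⟨ cong₂ _+_ first (∑-cong (allFin n) rest) ⟩
    size (p ∘ suc) i + ∑ (allFin n) (λ u → # (allFin n) (samePair? (p ∘ suc) u))
      ≡⟨ cong (size (p ∘ suc) i +_) (go n (p ∘ suc)) ⟩
    size (p ∘ suc) i + ∑ (allFin m) (tri ∘ size (p ∘ suc))
      ≡⟨ cong (_+ ∑ (allFin m) (tri ∘ size (p ∘ suc))) (sym only-i) ⟩
    ∑ (allFin m) (λ j → ι (i ≟ j) * size (p ∘ suc) j) + ∑ (allFin m) (tri ∘ size (p ∘ suc))
      ≡⟨ sym (∑-+ (allFin m)) ⟩
    ∑ (allFin m) (λ j → ι (i ≟ j) * size (p ∘ suc) j + tri (size (p ∘ suc) j))
      ≡⟨ ∑-cong (allFin m) (λ j → sym (Eq.trans (cong tri (size-suc p j)) (tri-ι (i ≟ j) _))) ⟩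
    ∑ (allFin m) (tri ∘ size p) ∎
    where
    i = p zero
    first : # (allFin (suc n)) (samePair? p zero) ≡ size (p ∘ suc) i
    first = Eq.trans (∑-allFin-suc (λ v → ι (samePair? p zero v)))
      (#-cong (allFin n) (λ v → samePair? p zero (suc v)) (λ v → p (suc v) ≟ i) (λ _ → sym ∘ proj₂) (λ _ e → z<s , sym e))
    rest : ∀ u → # (allFin (suc n)) (samePair? p (suc u)) ≡ # (allFin n) (samePair? (p ∘ suc) u)
    rest u = Eq.trans (∑-allFin-suc (λ v → ι (samePair? p (suc u) v)))
      (#-cong (allFin n) (λ v → samePair? p (suc u) (suc v)) (samePair? (p ∘ suc) u) (λ { _ (s<s l , e) → l , e }) (λ { _ (l , e) → s<s l , e }))
    only-i : ∑ (allFin m) (λ j → ι (i ≟ j) * size (p ∘ suc) j) ≡ size (p ∘ suc) i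
    only-i = Eq.trans (∑-cong (allFin m) pointwise) (Eq.trans (∑-*ʳ (allFin m) (size (p ∘ suc) i))
      (Eq.trans (cong (_* size (p ∘ suc) i) (#-Fin-single (i ≟_) i refl (λ _ → sym))) (*-identityˡ _)))
      where
      pointwise : ∀ j → ι (i ≟ j) * size (p ∘ suc) j ≡ ι (i ≟ j) * size (p ∘ suc) i
      pointwise j with i ≟ j
      ... | yes refl = refl
      ... | no _     = refl

realise : (b : List ℕ) → ∃ λ (p : Fin (∑ b id) → Fin (length b)) → ∀ j → size p j ≡ List.lookup b j
realise []      = (λ ()) , λ ()
realise (x ∷ b) with p , ok ← realise b = add x , add-ok x
  where
  add : ∀ x → Fin (x + ∑ b id) → Fin (suc (length b))
  add zero    v       = suc (p v)
  add (suc x) zero    = zero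
  add (suc x) (suc v) = add x v
  add-ok : ∀ x j → size (add x) j ≡ List.lookup (x ∷ b) j
  add-ok zero zero    = #-none (allFin (∑ b id)) (λ v → suc (p v) ≟ zero) λ _ ()
  add-ok zero (suc j) = Eq.trans (#-cong (allFin (∑ b id)) _ (λ v → p v ≟ j) (λ _ → Finₚ.suc-injective) (λ _ → cong suc)) (ok j)
  add-ok (suc x) zero    = Eq.trans (size-suc (add (suc x)) zero) (cong suc (add-ok x zero))
  add-ok (suc x) (suc j) = Eq.trans (size-suc (add (suc x)) (suc j)) (add-ok x (suc j))

partition : ∀ {m n b} → Composition m n b → ∃ λ (p : Fin n → Fin m) → sizes p ≡ b
partition {b = b} (refl , refl) with p , ok ← realise b = p , Eq.trans (Listₚ.tabulate-cong ok) (Listₚ.tabulate-lookup b)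

#-≤ι : {Q : A → Set} {xs : List A} (Q? : Decidable Q) (d : Dec P) → Unique xs →
       (∀ x y → Q x → Q y → x ≡ y) → (∀ x → Q x → P) → # xs Q? ≤ ι d
#-≤ι {xs = xs} Q? (yes p) u uniq to = #-≤1 Q? u uniq
#-≤ι {xs = xs} Q? (no ¬p) u uniq to = ≤-reflexive (#-none xs Q? λ x q → ¬p (to x q))

ι-disjoint : (d : Dec P) (e : Dec R) (f : Dec S) → (P → S) → (R → S) → (P → ¬ R) → ι d + ι e ≤ ι f
ι-disjoint (yes p) (yes r) f _ _ h = contradiction r (h p)
ι-disjoint (yes p) (no _)  f g _ _ = ι-≥1 f (g p)
ι-disjoint (no _)  e       f _ g _ = ι-mono e f g

_∈ᶠ?_ : ∀ {m} (j : Fin m) js → Dec (j ∈ js)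
_∈ᶠ?_ = DecMembership._∈?_ _≟_

-- When `a` avoids the parts in `js` and `js` has no repetitions, this says that `e` is `a` with one
-- vertex of each part in `js` added: the last clause allows at most one per part, and the
-- cardinality then forces one.
Extends : ∀ {n m} → (Fin n → Fin m) → Subset n → List (Fin m) → Subset n → Set
Extends p a js e =
  (∀ u → u ∈ₛ a → u ∈ₛ e) ×
  ∣ e ∣ ≡ ∣ a ∣ + length js ×
  (∀ u → u ∈ₛ e → u ∈ₛ a ⊎ p u ∈ js) ×
  (∀ u w → u ∈ₛ e → w ∈ₛ e → p u ≡ p w → p u ∈ js → u ≡ w)

abstract
  extends? : ∀ {n m} (p : Fin n → Fin m) a js → Decidable (Extends p a js)
  extends? p a js e =
    Finₚ.all? (λ u → (u ∈? a) →-dec (u ∈? e)) ×-dec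
    (∣ e ∣ ℕₚ.≟ ∣ a ∣ + length js) ×-dec
    Finₚ.all? (λ u → (u ∈? e) →-dec ((u ∈? a) ⊎-dec (p u ∈ᶠ? js))) ×-dec
    Finₚ.all? (λ u → Finₚ.all? λ w → (u ∈? e) →-dec ((w ∈? e) →-dec ((p u ≟ p w) →-dec ((p u ∈ᶠ? js) →-dec (u ≟ w)))))

∈-insert⁻ : ∀ {n} (e : Subset n) {v u} → u ∈ₛ e [ v ]≔ true → u ≡ v ⊎ u ∈ₛ e
∈-insert⁻ e {v} {u} u∈ with u ≟ v
... | yes u≡v = inj₁ u≡v
... | no u≢v  = inj₂ (∈-update⁻ e u≢v u∈)

∈-insert⁺ : ∀ {n} (e : Subset n) {v u} → u ∈ₛ e → u ∈ₛ e [ v ]≔ true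
∈-insert⁺ e {v} {u} u∈ with u ≟ v
... | yes refl = ∈-insert e v
... | no u≢v   = ∈-update⁺ e u≢v u∈

#-extends : ∀ {n m} (p : Fin n → Fin m) y js a → Unique js → (∀ u → u ∈ₛ a → p u ∉ js) →
            (∀ j → j ∈ js → y ≤ size p j) → y ^ length js ≤ # (subs n) (extends? p a js)
#-extends p y [] a _ _ _ =
  #-∈ (extends? p a []) (∈-subs a) ((λ _ → id) , sym (+-identityʳ _) , (λ _ → inj₁) , λ { _ _ _ _ _ () })
#-extends {n} p y (j ∷ js) a (j∉ ∷ uniq) avoid big = begin
  y * y ^ length js
    ≤⟨ *-monoˡ-≤ (y ^ length js) (big j (here refl)) ⟩
  size p j * y ^ length js
    ≡⟨ sym (∑-*ʳ (allFin n) (y ^ length js)) ⟩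
  ∑ (allFin n) (λ v → ι (p v ≟ j) * y ^ length js)
    ≤⟨ ∑-mono (allFin n) (λ v → ι-*ˡ (p v ≟ j) (λ pv≡j → #-extends p y js (a [ v ]≔ true) uniq (avoid′ v pv≡j) (λ j j∈ → big j (there j∈)))) ⟩
  ∑ (allFin n) (λ v → ι (p v ≟ j) * # (subs n) (extends? p (a [ v ]≔ true) js))
    ≡⟨ ∑-cong (allFin n) (λ v → Eq.trans (sym (∑-*ˡ (subs n) (ι (p v ≟ j)))) (∑-cong (subs n) λ e → sym (ι-* (p v ≟ j) (extends? p (a [ v ]≔ true) js e)))) ⟩
  ∑ (allFin n) (λ v → # (subs n) (step? v))
    ≡⟨ ∑-swap (allFin n) (subs n) ⟩
  ∑ (subs n) (λ e → # (allFin n) (λ v → step? v e))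
    ≤⟨ ∑-mono (subs n) (λ e → #-≤ι (λ v → step? v e) (extends? p a (j ∷ js) e) (Uniqueₚ.allFin⁺ n) (same e) (widen e)) ⟩
  # (subs n) (extends? p a (j ∷ js)) ∎
  where
  open ≤-Reasoning
  Step : Fin n → Subset n → Set
  Step v e = p v ≡ j × Extends p (a [ v ]≔ true) js e
  step? : ∀ v → Decidable (Step v)
  step? v e = (p v ≟ j) ×-dec extends? p (a [ v ]≔ true) js e
  j∉js : j ∉ js
  j∉js j∈ = All.lookup j∉ j∈ refl
  avoid′ : ∀ v → p v ≡ j → ∀ u → u ∈ₛ a [ v ]≔ true → p u ∉ js
  avoid′ v refl u u∈ pu∈ with ∈-insert⁻ a u∈
  ... | inj₁ refl = j∉js pu∈
  ... | inj₂ u∈a  = avoid u u∈a (there pu∈)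
  -- The added vertex can be read off from `e` as its only vertex in part `j`, since neither `a` nor
  -- the parts in `js` reach that part. Hence no set is counted for two choices of `v`.
  in-part : ∀ {e v u} → Step v e → u ∈ₛ e → p u ≡ j → u ≡ v
  in-part (_ , _ , _ , cover , _) u∈ refl with cover _ u∈
  ... | inj₂ pu∈ = contradiction pu∈ j∉js
  ... | inj₁ u∈′ with ∈-insert⁻ a u∈′
  ... | inj₁ u≡v = u≡v
  ... | inj₂ u∈a = contradiction (here refl) (avoid _ u∈a)
  same : ∀ e v v′ → Step v e → Step v′ e → v ≡ v′
  same e v v′ (pv , sub , _) st′ = in-part st′ (sub v (∈-insert a v)) pv
  widen : ∀ e v → Step v e → Extends p a (j ∷ js) e
  widen e v st@(pv≡j , sub , len , cover , inj) =
    (λ u u∈ → sub u (∈-insert⁺ a u∈)) ,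
    Eq.trans len (Eq.trans (cong (_+ length js) (∣insert∣ a v λ v∈ → avoid v v∈ (here pv≡j))) (sym (+-suc ∣ a ∣ (length js)))) ,
    (λ u u∈ → case cover u u∈ of λ where
      (inj₂ pu∈) → inj₂ (there pu∈)
      (inj₁ u∈′) → case ∈-insert⁻ a u∈′ of λ where
        (inj₁ refl) → inj₂ (here pv≡j)
        (inj₂ u∈a)  → inj₁ u∈a) ,
    λ where
      u w u∈ w∈ pu≡pw (here pu≡j)  → Eq.trans (in-part st u∈ pu≡j) (sym (in-part st w∈ (Eq.trans (sym pu≡pw) pu≡j)))
      u w u∈ w∈ pu≡pw (there pu∈) → inj u w u∈ w∈ pu≡pw pu∈

take-length : ∀ k (xs : List A) → k ≤ length xs → length (take k xs) ≡ k
take-length k xs k≤ = Eq.trans (Listₚ.length-take k xs) (m≤n⇒m⊓n≡m k≤)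

-- The two excluded parts may coincide, as they do for a pair inside a part. The call for
-- `1 + d = r - 2` parts uses `r ≤ k - 1`.
other-parts : ∀ {m} d → 2 + d ≤ m → (i i′ : Fin m) →
              ∃ λ js → length js ≡ d × Unique js × All (λ j → j ≢ i × j ≢ i′) js
other-parts {m} d d≤m i i′ = take d js , take-length d js enough , Uniqueₚ.take⁺ d (Uniqueₚ.filter⁺ other? (Uniqueₚ.allFin⁺ m)) ,
  Allₚ.take⁺ d (Allₚ.all-filter other? (allFin m))
  where
  open ≤-Reasoning
  other? : Decidable (λ j → j ≢ i × j ≢ i′)
  other? j = ¬? (j ≟ i) ×-dec ¬? (j ≟ i′)
  js = filter other? (allFin m)
  pointwise : ∀ j → 1 ≤ ι (other? j) + (ι (j ≟ i) + ι (j ≟ i′))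
  pointwise j with j ≟ i | j ≟ i′
  ... | yes _ | yes _ = s≤s z≤n
  ... | yes _ | no _  = s≤s z≤n
  ... | no _  | yes _ = s≤s z≤n
  ... | no _  | no _  = s≤s z≤n
  enough : d ≤ length js
  enough = +-cancelʳ-≤ 2 _ _ (begin
    d + 2                                      ≡⟨ +-comm d 2 ⟩
    2 + d                                      ≤⟨ d≤m ⟩
    m                                          ≡⟨ sym (Listₚ.length-tabulate {n = m} id) ⟩
    length (allFin m)                          ≡⟨ sym (*-identityʳ _) ⟩
    length (allFin m) * 1                      ≡⟨ sym (∑-const (allFin m) 1) ⟩
    ∑ (allFin m) (λ _ → 1)                     ≤⟨ ∑-mono (allFin m) pointwise ⟩
    ∑ (allFin m) (λ j → ι (other? j) + (ι (j ≟ i) + ι (j ≟ i′))) ≡⟨ ∑-+ (allFin m) ⟩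
    # (allFin m) other? + ∑ (allFin m) (λ j → ι (j ≟ i) + ι (j ≟ i′)) ≡⟨ cong (# (allFin m) other? +_) (∑-+ (allFin m)) ⟩
    # (allFin m) other? + (# (allFin m) (_≟ i) + # (allFin m) (_≟ i′))
      ≡⟨ cong₂ _+_ (sym (length-filter-# (allFin m) other?)) (cong₂ _+_ (#-Fin-single (_≟ i) i refl λ _ → id) (#-Fin-single (_≟ i′) i′ refl λ _ → id)) ⟩
    length js + 2 ∎)

pairSet : ∀ {n} → Fin n → Fin n → Subset n
pairSet x y = ⊥ [ x ]≔ true [ y ]≔ true

∈-pairSet⁻ : ∀ {n} {x y u : Fin n} → u ∈ₛ pairSet x y → u ≡ x ⊎ u ≡ y
∈-pairSet⁻ {x = x} u∈ with ∈-insert⁻ (⊥ [ x ]≔ true) u∈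
... | inj₁ u≡y = inj₂ u≡y
... | inj₂ u∈′ with ∈-insert⁻ ⊥ u∈′
... | inj₁ u≡x = inj₁ u≡x
... | inj₂ u∈⊥ = contradiction u∈⊥ ∉⊥

∈-pairSetˡ : ∀ {n} (x y : Fin n) → x ∈ₛ pairSet x y
∈-pairSetˡ x y = ∈-insert⁺ (⊥ [ x ]≔ true) (∈-insert ⊥ x)

∈-pairSetʳ : ∀ {n} (x y : Fin n) → y ∈ₛ pairSet x y
∈-pairSetʳ x y = ∈-insert (⊥ [ x ]≔ true) y

∣pairSet∣ : ∀ {n} {x y : Fin n} → x ≢ y → ∣ pairSet x y ∣ ≡ 2
∣pairSet∣ {n} {x} {y} x≢y = Eq.trans (∣insert∣ (⊥ [ x ]≔ true) y λ y∈ → case ∈-insert⁻ ⊥ y∈ of λ where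
    (inj₁ y≡x) → x≢y (sym y≡x)
    (inj₂ y∈⊥) → ∉⊥ y∈⊥)
  (cong suc (Eq.trans (∣insert∣ ⊥ x ∉⊥) (cong suc (∣⊥∣≡0 n))))

abstract
  PairEdge? : ∀ {n m} r (p : Fin n → Fin m) u v → Decidable (PairEdge r p u v)
  PairEdge? r p u v e =
    (u ∈? e) ×-dec (v ∈? e) ×-dec (∣ e ∣ ℕₚ.≟ r) ×-dec
    Finₚ.all? (λ w → (w ∈? e) →-dec ((p w ≟ p u) →-dec ((w ≟ u) ⊎-dec (w ≟ v)))) ×-dec
    Finₚ.all? (λ w → Finₚ.all? λ w′ → (w ∈? e) →-dec ((w′ ∈? e) →-dec ((p w ≟ p w′) →-dec ((¬? (p w ≟ p u)) →-dec (w ≟ w′)))))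

abstract
  CrossEdge? : ∀ {n m} r (p : Fin n → Fin m) u v → Decidable (λ e → TEdge r p e × u ∈ₛ e × v ∈ₛ e)
  CrossEdge? r p u v e = TEdge? r p e ×-dec (u ∈? e) ×-dec (v ∈? e)

module _ {n m : ℕ} (p : Fin n → Fin m) {d y : ℕ} (d≤m : 3 + d ≤ m) (big : ∀ j → y ≤ size p j) where

  private
    -- Completing `u` and `v` by one vertex from each of `r - 2` fixed further parts gives at least
    -- `y ^ (r - 2)` sets. They serve for pairs inside a part and for cross pairs alike.
    extensions : ∀ {u v} → ∃ λ js → length js ≡ 1 + d × Unique js × All (λ j → j ≢ p u × j ≢ p v) js ×
                 y ^ (1 + d) ≤ # (subs n) (extends? p (pairSet u v) js)
    extensions {u} {v} with js , len , uniq , avoid ← other-parts (1 + d) d≤m (p u) (p v) =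
      js , len , uniq , avoid , ≤-trans (≤-reflexive (cong (y ^_) (sym len)))
        (#-extends p y js (pairSet u v) uniq
          (λ w w∈ pw∈ → case ∈-pairSet⁻ w∈ of λ where
            (inj₁ refl) → proj₁ (All.lookup avoid pw∈) refl
            (inj₂ refl) → proj₂ (All.lookup avoid pw∈) refl)
          (λ j _ → big j))

  #-PairEdge : ∀ {u v} → u ≢ v → p u ≡ p v → y ^ (1 + d) ≤ # (subs n) (PairEdge? (3 + d) p u v)
  #-PairEdge {u} {v} u≢v pu≡pv with js , len , uniq , avoid , bound ← extensions {u} {v} =
    ≤-trans bound (#-mono (subs n) (extends? p (pairSet u v) js) (PairEdge? (3 + d) p u v)
      λ e (sub , size-e , cover , inj) →
        sub u (∈-pairSetˡ u v) , sub v (∈-pairSetʳ u v) , Eq.trans size-e (cong₂ _+_ (∣pairSet∣ u≢v) len) ,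
        (λ w w∈ pw → case cover w w∈ of λ where
          (inj₁ w∈′) → ∈-pairSet⁻ w∈′
          (inj₂ pw∈) → contradiction pw (proj₁ (All.lookup avoid pw∈))) ,
        λ w w′ w∈ w′∈ pw≡ pw≢ → case cover w w∈ of λ where
          (inj₂ pw∈) → inj w w′ w∈ w′∈ pw≡ pw∈
          (inj₁ w∈′) → case ∈-pairSet⁻ w∈′ of λ where
            (inj₁ refl) → contradiction refl pw≢
            (inj₂ refl) → contradiction (sym pu≡pv) pw≢)

  #-CrossEdge : ∀ {u v} → p u ≢ p v → y ^ (1 + d) ≤ # (subs n) (CrossEdge? (3 + d) p u v)
  #-CrossEdge {u} {v} pu≢pv with js , len , uniq , avoid , bound ← extensions {u} {v} =
    ≤-trans bound (#-mono (subs n) (extends? p (pairSet u v) js) (CrossEdge? (3 + d) p u v)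
      λ e (sub , size-e , cover , inj) →
        (Eq.trans size-e (cong₂ _+_ (∣pairSet∣ (pu≢pv ∘ cong p)) len) ,
          λ w w′ w∈ w′∈ pw≡ → case cover w w∈ , cover w′ w′∈ of λ where
            (inj₂ pw∈ , _) → inj w w′ w∈ w′∈ pw≡ pw∈
            (_ , inj₂ pw′∈) → sym (inj w′ w w′∈ w∈ (sym pw≡) pw′∈)
            (inj₁ a , inj₁ b) → both pw≡ (∈-pairSet⁻ a) (∈-pairSet⁻ b)) ,
        sub u (∈-pairSetˡ u v) , sub v (∈-pairSetʳ u v))
    where
    both : ∀ {w w′} → p w ≡ p w′ → w ≡ u ⊎ w ≡ v → w′ ≡ u ⊎ w′ ≡ v → w ≡ w′
    both e (inj₁ refl) (inj₁ refl) = refl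
    both e (inj₁ refl) (inj₂ refl) = contradiction e pu≢pv
    both e (inj₂ refl) (inj₁ refl) = contradiction (sym e) pu≢pv
    both e (inj₂ refl) (inj₂ refl) = refl

#-supersets : ∀ {n} c r (X : Subset n) → r ≡ c + ∣ X ∣ →
              # (subs n) (λ e → (∣ e ∣ ℕₚ.≟ r) ×-dec (X ⊆? e)) ≤ n ^ c
#-supersets {zero} zero    r [] eq = ≤-trans (≤-reflexive (+-identityʳ _)) (ι≤1 ((0 ℕₚ.≟ r) ×-dec ([] ⊆? [])))
#-supersets {zero} (suc c) .(suc (c + 0)) [] refl = z≤n
#-supersets {suc n} c r (true ∷ X) eq = begin
  # (subs (suc n)) (λ e → (∣ e ∣ ℕₚ.≟ r) ×-dec ((true ∷ X) ⊆? e))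
    ≡⟨ ∑-subs-suc (λ e → ι ((∣ e ∣ ℕₚ.≟ r) ×-dec ((true ∷ X) ⊆? e))) ⟩
  # (subs n) (λ e → (suc ∣ e ∣ ℕₚ.≟ r) ×-dec ((true ∷ X) ⊆? (true ∷ e))) + # (subs n) (λ e → (∣ e ∣ ℕₚ.≟ r) ×-dec ((true ∷ X) ⊆? (false ∷ e)))
    ≤⟨ +-mono-≤ (#-mono (subs n) _ (λ e → (∣ e ∣ ℕₚ.≟ c + ∣ X ∣) ×-dec (X ⊆? e)) λ e (len , sub) → ℕₚ.suc-injective (Eq.trans len r≡) , drop-∷-⊆ sub)
                (≤-reflexive (#-none (subs n) _ λ e (_ , sub) → case sub here of λ ())) ⟩
  # (subs n) (λ e → (∣ e ∣ ℕₚ.≟ c + ∣ X ∣) ×-dec (X ⊆? e)) + 0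
    ≤⟨ +-monoˡ-≤ 0 (#-supersets c (c + ∣ X ∣) X refl) ⟩
  n ^ c + 0        ≡⟨ +-identityʳ _ ⟩
  n ^ c            ≤⟨ ^-monoˡ-≤ c (n≤1+n n) ⟩
  suc n ^ c        ∎
  where
  open ≤-Reasoning
  r≡ : r ≡ suc (c + ∣ X ∣)
  r≡ = Eq.trans eq (+-suc c ∣ X ∣)
#-supersets {suc n} c r (false ∷ X) eq = begin
  # (subs (suc n)) (λ e → (∣ e ∣ ℕₚ.≟ r) ×-dec ((false ∷ X) ⊆? e))
    ≡⟨ ∑-subs-suc (λ e → ι ((∣ e ∣ ℕₚ.≟ r) ×-dec ((false ∷ X) ⊆? e))) ⟩
  # (subs n) (λ e → (suc ∣ e ∣ ℕₚ.≟ r) ×-dec ((false ∷ X) ⊆? (true ∷ e))) + # (subs n) (λ e → (∣ e ∣ ℕₚ.≟ r) ×-dec ((false ∷ X) ⊆? (false ∷ e)))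
    ≤⟨ +-mono-≤ (containing c eq) (≤-trans
        (#-mono (subs n) _ (λ e → (∣ e ∣ ℕₚ.≟ r) ×-dec (X ⊆? e)) λ e (len , sub) → len , drop-∷-⊆ sub)
        (#-supersets c r X eq)) ⟩
  pred^ c + n ^ c    ≤⟨ combine c ⟩
  suc n ^ c          ∎
  where
  open ≤-Reasoning
  -- This bounds the sets that contain the first vertex: they have one free vertex fewer, and there
  -- are none when `c = 0`.
  pred^ : ℕ → ℕ
  pred^ zero    = 0
  pred^ (suc c) = n ^ c
  combine : ∀ c → pred^ c + n ^ c ≤ suc n ^ c
  combine zero    = ≤-refl
  combine (suc c) = *-monoʳ-≤ (suc n) (^-monoˡ-≤ c (n≤1+n n))
  containing : ∀ c → r ≡ c + ∣ X ∣ → # (subs n) (λ e → (suc ∣ e ∣ ℕₚ.≟ r) ×-dec ((false ∷ X) ⊆? (true ∷ e))) ≤ pred^ c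
  containing zero eq = ≤-reflexive (#-none (subs n) _ λ e (len , sub) →
    1+n≰n (≤-trans (≤-reflexive (Eq.trans len eq)) (p⊆q⇒∣p∣≤∣q∣ (drop-∷-⊆ sub))))
  containing (suc c) eq = ≤-trans
    (#-mono (subs n) _ (λ e → (∣ e ∣ ℕₚ.≟ c + ∣ X ∣) ×-dec (X ⊆? e)) λ e (len , sub) → ℕₚ.suc-injective (Eq.trans len eq) , drop-∷-⊆ sub)
    (#-supersets c (c + ∣ X ∣) X refl)

#-containing-pair : ∀ {n} c {x y : Fin n} → x ≢ y →
  # (subs n) (λ e → (∣ e ∣ ℕₚ.≟ c + 2) ×-dec ((x ∈? e) ×-dec (y ∈? e))) ≤ n ^ c
#-containing-pair {n} c {x} {y} x≢y = ≤-trans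
  (#-mono (subs n) _ (λ e → (∣ e ∣ ℕₚ.≟ c + 2) ×-dec (pairSet x y ⊆? e)) λ e (len , x∈ , y∈) →
    len , λ u∈ → case ∈-pairSet⁻ u∈ of λ { (inj₁ refl) → x∈ ; (inj₂ refl) → y∈ })
  (#-supersets c (c + 2) (pairSet x y) (cong (c +_) (sym (∣pairSet∣ x≢y))))

-- The hypergraph 𝒬

-- A pair edge contains only one pair of vertices from a common part. So the edges added to `𝒬` for
-- different pairs are distinct, and none of them raises the codegree of another inner pair.
pair-determined : ∀ {n m r} {p : Fin n → Fin m} {u v u′ v′ e} → SamePair p u v → SamePair p u′ v′ →
                  PairEdge r p u′ v′ e → u ∈ₛ e → v ∈ₛ e → u ≡ u′ × v ≡ v′
pair-determined {p = p} {u} {v} {u′} {v′} (u<v , pu≡pv) (u′<v′ , pu′≡pv′) (_ , _ , _ , only , rest) u∈ v∈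
  with p u ≟ p u′
... | no pu≢ = contradiction u<v (Finₚ.<-irrefl (rest u v u∈ v∈ pu≡pv pu≢))
... | yes pu≡ with only u u∈ pu≡ | only v v∈ (Eq.trans (sym pu≡pv) pu≡)
... | inj₁ refl | inj₂ refl = refl , refl
... | inj₁ refl | inj₁ refl = contradiction u<v (Finₚ.<-irrefl refl)
... | inj₂ refl | inj₂ refl = contradiction u<v (Finₚ.<-irrefl refl)
... | inj₂ refl | inj₁ refl = contradiction u<v (Finₚ.<-asym u′<v′)

module Construction {n m : ℕ} (d s : ℕ) (p : Fin n → Fin m)
  (enough : {u v : Fin n} → SamePair p u v → s ≤ # (subs n) (PairEdge? (3 + d) p u v)) where

  private
    r = 3 + d

  chosen : Fin n → Fin n → List (Subset n)
  chosen u v = take s (filter (PairEdge? r p u v) (subs n))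

  chosen-unique : ∀ u v → Unique (chosen u v)
  chosen-unique u v = Uniqueₚ.take⁺ s (Uniqueₚ.filter⁺ (PairEdge? r p u v) (subs-unique n))

  chosen-pair : ∀ u v → All (PairEdge r p u v) (chosen u v)
  chosen-pair u v = Allₚ.take⁺ s (Allₚ.all-filter (PairEdge? r p u v) (subs n))

  chosen-length : ∀ {u v} → SamePair p u v → length (chosen u v) ≡ s
  chosen-length {u} {v} uv = take-length s _ (subst (s ≤_) (sym (length-filter-# (subs n) (PairEdge? r p u v))) (enough uv))

  Chosen : Fin n → Fin n → Subset n → Set
  Chosen u v e = SamePair p u v × e ∈ chosen u v

  abstract
    chosen? : ∀ u v e → Dec (Chosen u v e)
    chosen? u v e = samePair? p u v ×-dec DecMembership._∈?_ _≟ₛ_ e (chosen u v)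

  SomeChosen : Subset n → Set
  SomeChosen e = ∃ λ u → ∃ λ v → Chosen u v e

  abstract
    someChosen? : Decidable SomeChosen
    someChosen? e = Finₚ.any? λ u → Finₚ.any? λ v → chosen? u v e

  QEdge : Subset n → Set
  QEdge e = TEdge r p e ⊎ SomeChosen e

  abstract
    QEdge? : Decidable QEdge
    QEdge? e = TEdge? r p e ⊎-dec someChosen? e

  Q : Hypergraph n
  Q = hg (filter QEdge? (subs n)) (Uniqueₚ.filter⁺ QEdge? (subs-unique n))

  ∈Q⁺ : ∀ {e} → QEdge e → e ∈ edges Q
  ∈Q⁺ {e} = ∈ₚ.∈-filter⁺ QEdge? (∈-subs e)

  ∈Q⁻ : ∀ {e} → e ∈ edges Q → QEdge e
  ∈Q⁻ e∈ = proj₂ (∈ₚ.∈-filter⁻ QEdge? {xs = subs n} e∈)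

  chosen⇒pairEdge : ∀ {u v e} → Chosen u v e → PairEdge r p u v e
  chosen⇒pairEdge {u} {v} (_ , e∈) = All.lookup (chosen-pair u v) e∈

  -- Transversals contain no inner pair, and edges chosen for other pairs do not contain this one.
  -- The codegree of an inner pair in `Q` is therefore at most `s = t - 1`.
  containing-pair⇒chosen : ∀ {u v e} → SamePair p u v → QEdge e → u ∈ₛ e → v ∈ₛ e → e ∈ chosen u v
  containing-pair⇒chosen uv@(u<v , pu≡pv) (inj₁ (_ , tr)) u∈ v∈ =
    contradiction u<v (Finₚ.<-irrefl (tr _ _ u∈ v∈ pu≡pv))
  containing-pair⇒chosen uv (inj₂ (u′ , v′ , ch)) u∈ v∈
    with refl , refl ← pair-determined uv (proj₁ ch) (chosen⇒pairEdge ch) u∈ v∈ = proj₂ ch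

  Q-isQ : Balanced p → IsQ r (suc s) m Q
  Q-isQ balanced = p , balanced , (λ e tr → ∈Q⁺ (inj₁ tr)) ,
    (λ e e∈ → case ∈Q⁻ e∈ of λ where
      (inj₁ tr) → inj₁ tr
      (inj₂ (u , v , ch@((u<v , pu≡pv) , _))) → inj₂ (u , v , u<v , pu≡pv , chosen⇒pairEdge ch)) ,
    λ u v u<v pu≡pv → chosen u v , chosen-length (u<v , pu≡pv) , chosen-unique u v ,
      All.tabulate (λ {e} e∈ → ∈Q⁺ (inj₂ (u , v , (u<v , pu≡pv) , e∈))) , chosen-pair u v ,
      λ e e∈ (u∈ , v∈ , _) → containing-pair⇒chosen (u<v , pu≡pv) (∈Q⁻ e∈) u∈ v∈

  Q-uniform : Uniform r Q
  Q-uniform = All.tabulate λ e∈ → case ∈Q⁻ e∈ of λ where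
    (inj₁ (len , _)) → len
    (inj₂ (_ , _ , ch)) → let _ , _ , len , _ = chosen⇒pairEdge ch in len

  -- An edge is chosen for at most one pair, and a transversal for none, so the contributions add up
  -- without overlap.
  Q-size : φ r s (sizes p) ≤ ∣E∣ Q
  Q-size = begin
    esym r (sizes p) + s * ∑ (sizes p) tri
      ≡⟨ cong₂ _+_ (sym (#-TEdge r p)) (Eq.trans (cong (s *_) (sym (#-samePairs p))) (*-comm s _)) ⟩
    # (subs n) (TEdge? r p) + ∑ (allFin n) (λ u → # (allFin n) (samePair? p u)) * s
      ≡⟨ cong (# (subs n) (TEdge? r p) +_) (Eq.trans (sym (∑-*ʳ (allFin n) s)) (∑-cong (allFin n) λ u → sym (∑-*ʳ (allFin n) s))) ⟩
    # (subs n) (TEdge? r p) + ∑ (allFin n) (λ u → ∑ (allFin n) (λ v → ι (samePair? p u v) * s))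
      ≤⟨ +-monoʳ-≤ _ (∑-mono (allFin n) λ u → ∑-mono (allFin n) λ v → count-chosen u v (samePair? p u v)) ⟩
    # (subs n) (TEdge? r p) + ∑ (allFin n) (λ u → ∑ (allFin n) (λ v → # (subs n) (chosen? u v)))
      ≡⟨ cong (# (subs n) (TEdge? r p) +_) (Eq.trans (∑-cong (allFin n) λ u → ∑-swap (allFin n) (subs n)) (∑-swap (allFin n) (subs n))) ⟩
    # (subs n) (TEdge? r p) + ∑ (subs n) (λ e → ∑ (allFin n) (λ u → # (allFin n) (λ v → chosen? u v e)))
      ≡⟨ sym (∑-+ (subs n)) ⟩
    ∑ (subs n) (λ e → ι (TEdge? r p e) + ∑ (allFin n) (λ u → # (allFin n) (λ v → chosen? u v e)))
      ≤⟨ ∑-mono (subs n) pointwise ⟩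
    # (subs n) QEdge? ≡⟨ sym (length-filter-# (subs n) QEdge?) ⟩
    ∣E∣ Q ∎
    where
    open ≤-Reasoning
    count-chosen : ∀ u v (d : Dec (SamePair p u v)) → ι d * s ≤ # (subs n) (chosen? u v)
    count-chosen u v (no _)   = z≤n
    count-chosen u v (yes uv) = ≤-trans (≤-reflexive (Eq.trans (*-identityˡ s) (sym (chosen-length uv))))
      (#-≥length (chosen? u v) (chosen-unique u v) (All.tabulate (uv ,_)) (λ _ → ∈-subs _))
    agree : ∀ {e u v u′ v′} → Chosen u v e → Chosen u′ v′ e → u ≡ u′ × v ≡ v′
    agree ch ch′ = let u∈ , v∈ , _ = chosen⇒pairEdge ch in pair-determined (proj₁ ch) (proj₁ ch′) (chosen⇒pairEdge ch′) u∈ v∈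
    inner? : ∀ u e → Dec (∃ λ v → Chosen u v e)
    inner? u e = Finₚ.any? λ v → chosen? u v e
    pointwise : ∀ e → ι (TEdge? r p e) + ∑ (allFin n) (λ u → # (allFin n) (λ v → chosen? u v e)) ≤ ι (QEdge? e)
    pointwise e = ≤-trans (+-monoʳ-≤ _ (≤-trans
        (∑-mono (allFin n) λ u → #-≤ι (λ v → chosen? u v e) (inner? u e) (Uniqueₚ.allFin⁺ n) (λ v v′ c c′ → proj₂ (agree c c′)) (λ v c → v , c))
        (#-≤ι (λ u → inner? u e) (someChosen? e) (Uniqueₚ.allFin⁺ n) (λ u u′ (_ , c) (_ , c′) → proj₁ (agree c c′)) (λ u (v , c) → u , v , c))))
      (ι-disjoint (TEdge? r p e) (someChosen? e) (QEdge? e) inj₁ inj₂ λ (_ , tr) (u , v , ch) →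
        let u∈ , v∈ , _ = chosen⇒pairEdge ch ; (u<v , pu≡pv) , _ = ch in Finₚ.<-irrefl (tr u v u∈ v∈ pu≡pv) u<v)

  -- Two vertices of the copy share a part by the pigeonhole principle, and an inner pair lies in
  -- only `s` edges.
  Q-heavy-free : ∀ {k} → m < k → ¬ ContainsHeavy (suc s) k Q
  Q-heavy-free m<k (F , F⊑Q , copy) with Finₚ.pigeonhole m<k (p ∘ HeavyCopy.i copy)
  ... | x , y , x<y , px≡py = 1+n≰n (begin
    suc s                ≡⟨ sym (h-size x y x<y) ⟩
    length (h x y x<y)   ≤⟨ bounded (Finₚ.<-cmp (i x) (i y)) ⟩
    s                    ∎)
    where
    open ≤-Reasoning
    open HeavyCopy copy
    fits : ∀ {u v} → SamePair p u v → (∀ {e} → e ∈ h x y x<y → u ∈ₛ e × v ∈ₛ e) → length (h x y x<y) ≤ s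
    fits uv contains = subst (length (h x y x<y) ≤_) (chosen-length uv)
      (unique-⊆-length (h-distinct x y x<y) λ e∈ →
        containing-pair⇒chosen uv (∈Q⁻ (F⊑Q (All.lookup (h-in x y x<y) e∈))) (proj₁ (contains e∈)) (proj₂ (contains e∈)))
    bounded : Tri (i x <ᶠ i y) (i x ≡ i y) (i y <ᶠ i x) → length (h x y x<y) ≤ s
    bounded (tri< l _ _) = fits (l , px≡py) λ e∈ → All.lookup (h-contains x y x<y) e∈
    bounded (tri≈ _ e _) = contradiction x<y (Finₚ.<-irrefl (i-inj e))
    bounded (tri> _ _ g) = fits (g , sym px≡py) λ e∈ → let a , b = All.lookup (h-contains x y x<y) e∈ in b , a

-- Greedy construction of Berge copies

module Greedy {I : Set} (_≟ᴵ_ : (i j : I) → Dec (i ≡ j)) {n : ℕ} (t : ℕ) (cand : I → List (Subset n))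
              (cand-unique : (i : I) → Unique (cand i)) where

  -- The number of used sets grows by `t` along the list, so the first entry requires the fewest
  -- candidates. With nothing used at the start it requires only `t`, which admits one pair of
  -- codegree exactly `t`.
  Enough : ℕ → List I → Set
  Enough a []       = ⊤
  Enough a (i ∷ xs) = a + t ≤ length (cand i) × Enough (t + a) xs

  enough : ∀ a xs → (∀ {i} → i ∈ xs → a + length xs * t ≤ length (cand i)) → Enough a xs
  enough a []       _ = _
  enough a (i ∷ xs) h = ≤-trans (+-monoʳ-≤ a (m≤m+n t _)) (h (here refl)) ,
    enough (t + a) xs λ j∈ → ≤-trans (≤-reflexive (rearrange t a (length xs * t))) (h (there j∈))
    where
    rearrange : ∀ t a x → t + a + x ≡ a + (t + x)
    rearrange = solve-∀

  record Choice (used : List (Subset n)) (xs : List I) : Set where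
    field
      pick     : I → List (Subset n)
      size-t   : ∀ {i} → i ∈ xs → length (pick i) ≡ t
      unique   : ∀ {i} → i ∈ xs → Unique (pick i)
      from     : ∀ {i e} → i ∈ xs → e ∈ pick i → e ∈ cand i
      fresh    : ∀ {i e} → i ∈ xs → e ∈ pick i → e ∉ used
      disjoint : ∀ {i j e} → i ∈ xs → j ∈ xs → e ∈ pick i → e ∈ pick j → i ≡ j

  choose : ∀ used xs → Unique xs → Enough (length used) xs → Choice used xs
  choose used [] _ _ = record { pick = λ _ → [] ; size-t = λ () ; unique = λ () ; from = λ () ; fresh = λ () ; disjoint = λ () }
  choose used (i ∷ xs) (i∉ ∷ uniq) (room , rest) = record
    { pick = pick′ ; size-t = size′ ; unique = unique′ ; from = from′ ; fresh = fresh′ ; disjoint = disjoint′ }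
    where
    used? : Decidable (_∈ used)
    used? e = DecMembership._∈?_ _≟ₛ_ e used
    avail = filter (λ e → ¬? (used? e)) (cand i)
    E = take t avail
    |E| : length E ≡ t
    |E| = take-length t avail (+-cancelˡ-≤ (length used) _ _ (begin
      length used + t                                        ≤⟨ room ⟩
      length (cand i)                                        ≡⟨ sym (*-identityʳ _) ⟩
      length (cand i) * 1                                    ≡⟨ sym (∑-const (cand i) 1) ⟩
      ∑ (cand i) (λ _ → 1)                                   ≡⟨ ∑-cong (cand i) (λ e → split (used? e)) ⟩
      ∑ (cand i) (λ e → ι (used? e) + ι (¬? (used? e)))      ≡⟨ ∑-+ (cand i) ⟩
      # (cand i) used? + # (cand i) (λ e → ¬? (used? e))     ≡⟨ cong₂ _+_ (sym (length-filter-# (cand i) used?)) (sym (length-filter-# (cand i) _)) ⟩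
      length (filter used? (cand i)) + length avail
        ≤⟨ +-monoˡ-≤ _ (unique-⊆-length (Uniqueₚ.filter⁺ used? (cand-unique i)) λ e∈ → proj₂ (∈ₚ.∈-filter⁻ used? {xs = cand i} e∈)) ⟩
      length used + length avail ∎))
      where
      open ≤-Reasoning
      split : ∀ {P : Set} (d : Dec P) → 1 ≡ ι d + ι (¬? d)
      split (yes _) = refl
      split (no _)  = refl
    E-from : ∀ {e} → e ∈ E → e ∈ cand i × e ∉ used
    E-from = All.lookup (Allₚ.take⁺ t (All.tabulate λ e∈ → ∈ₚ.∈-filter⁻ (λ e → ¬? (used? e)) {xs = cand i} e∈))
    open Choice (choose (E ++ used) xs uniq
      (subst (λ a → Enough a xs) (sym (Eq.trans (Listₚ.length-++ E) (cong (_+ length used) |E|))) rest))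
    choice : ∀ {j} → Dec (j ≡ i) → List (Subset n)
    choice {j} (yes _) = E
    choice {j} (no _)  = pick j
    pick′ : I → List (Subset n)
    pick′ j = choice (j ≟ᴵ i)
    later : ∀ {j} → j ≢ i → j ∈ i ∷ xs → j ∈ xs
    later j≢i (here e)  = contradiction e j≢i
    later j≢i (there p) = p
    size′ : ∀ {j} → j ∈ i ∷ xs → length (pick′ j) ≡ t
    size′ {j} j∈ with j ≟ᴵ i
    ... | yes _  = |E|
    ... | no j≢i = size-t (later j≢i j∈)
    unique′ : ∀ {j} → j ∈ i ∷ xs → Unique (pick′ j)
    unique′ {j} j∈ with j ≟ᴵ i
    ... | yes _  = Uniqueₚ.take⁺ t (Uniqueₚ.filter⁺ (λ e → ¬? (used? e)) (cand-unique i))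
    ... | no j≢i = unique (later j≢i j∈)
    from′ : ∀ {j e} → j ∈ i ∷ xs → e ∈ pick′ j → e ∈ cand j
    from′ {j} j∈ e∈ with j ≟ᴵ i
    ... | yes refl = proj₁ (E-from e∈)
    ... | no j≢i   = from (later j≢i j∈) e∈
    fresh′ : ∀ {j e} → j ∈ i ∷ xs → e ∈ pick′ j → e ∉ used
    fresh′ {j} j∈ e∈ with j ≟ᴵ i
    ... | yes refl = proj₂ (E-from e∈)
    ... | no j≢i   = fresh (later j≢i j∈) e∈ ∘ ∈ₚ.∈-++⁺ʳ E
    disjoint′ : ∀ {j l e} → j ∈ i ∷ xs → l ∈ i ∷ xs → e ∈ pick′ j → e ∈ pick′ l → j ≡ l
    disjoint′ {j} {l} j∈ l∈ e∈j e∈l with j ≟ᴵ i | l ≟ᴵ i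
    ... | yes j≡i | yes l≡i = Eq.trans j≡i (sym l≡i)
    ... | yes _   | no l≢i  = contradiction (∈ₚ.∈-++⁺ˡ e∈j) (fresh (later l≢i l∈) e∈l)
    ... | no j≢i  | yes _   = contradiction (∈ₚ.∈-++⁺ˡ e∈l) (fresh (later j≢i j∈) e∈j)
    ... | no j≢i  | no l≢i  = disjoint (later j≢i j∈) (later l≢i l∈) e∈j e∈l

  module _ {used : List (Subset n)} {xs : List I} (c : Choice used xs) where
    open Choice c

    gather : List I → List (Subset n)
    gather []       = []
    gather (i ∷ is) = pick i ++ gather is

    ∈-gather⁺ : ∀ {i e is} → i ∈ is → e ∈ pick i → e ∈ gather is
    ∈-gather⁺ (here refl) e∈ = ∈ₚ.∈-++⁺ˡ e∈
    ∈-gather⁺ {is = j ∷ _} (there i∈) e∈ = ∈ₚ.∈-++⁺ʳ (pick j) (∈-gather⁺ i∈ e∈)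

    ∈-gather⁻ : ∀ {e} is → e ∈ gather is → ∃ λ i → i ∈ is × e ∈ pick i
    ∈-gather⁻ (i ∷ is) e∈ with ∈ₚ.∈-++⁻ (pick i) e∈
    ... | inj₁ p = i , here refl , p
    ... | inj₂ p with j , j∈ , e∈j ← ∈-gather⁻ is p = j , there j∈ , e∈j

    gather-length : ∀ is → (∀ {i} → i ∈ is → i ∈ xs) → length (gather is) ≡ length is * t
    gather-length []       _   = refl
    gather-length (i ∷ is) sub = Eq.trans (Listₚ.length-++ (pick i))
      (cong₂ _+_ (size-t (sub (here refl))) (gather-length is (sub ∘ there)))

    gather-unique : ∀ {is} → Unique is → (∀ {i} → i ∈ is → i ∈ xs) → Unique (gather is)
    gather-unique [] _ = []
    gather-unique {i ∷ is} (i∉ ∷ u) sub = Uniqueₚ.++⁺ (unique (sub (here refl))) (gather-unique u (sub ∘ there))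
      λ (p , q) → let j , j∈ , e∈j = ∈-gather⁻ is q in
        All.lookup i∉ j∈ (disjoint (sub (here refl)) (sub (there j∈)) p e∈j)

-- The order matters: for `k ≥ 2` the enumeration begins with the pair of the first two vertices,
-- the one pair that `berge` allows to be thinner than `D`.
pairs : ∀ k → List (Fin k × Fin k)
pairs zero    = []
pairs (suc k) = map (λ y → zero , suc y) (allFin k) ++ map (λ (x , y) → suc x , suc y) (pairs k)

pairs-< : ∀ k {x y} → (x , y) ∈ pairs k → x <ᶠ y
pairs-< (suc k) p∈ with ∈ₚ.∈-++⁻ (map (λ y → zero , suc y) (allFin k)) p∈
... | inj₁ q with _ , _ , refl ← ∈ₚ.∈-map⁻ (λ y → zero , suc y) q = z<s
... | inj₂ q with _ , r , refl ← ∈ₚ.∈-map⁻ (λ (x , y) → suc x , suc y) q = s<s (pairs-< k r)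

∈-pairs : ∀ {k} {x y : Fin k} → x <ᶠ y → (x , y) ∈ pairs k
∈-pairs {suc k} {zero}  {suc y} _         = ∈ₚ.∈-++⁺ˡ (∈ₚ.∈-map⁺ (λ y → zero , suc y) (∈ₚ.∈-allFin y))
∈-pairs {suc k} {suc x} {suc y} (s<s x<y) = ∈ₚ.∈-++⁺ʳ (map (λ y → zero , suc y) (allFin k)) (∈ₚ.∈-map⁺ (λ (x , y) → suc x , suc y) (∈-pairs x<y))

pairs-unique : ∀ k → Unique (pairs k)
pairs-unique zero    = []
pairs-unique (suc k) = Uniqueₚ.++⁺
  (Uniqueₚ.map⁺ (Finₚ.suc-injective ∘ cong proj₂) (Uniqueₚ.allFin⁺ k))
  (Uniqueₚ.map⁺ (λ e → cong₂ _,_ (Finₚ.suc-injective (cong proj₁ e)) (Finₚ.suc-injective (cong proj₂ e))) (pairs-unique k))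
  λ (p , q) → case ∈ₚ.∈-map⁻ (λ y → zero , suc y) p , ∈ₚ.∈-map⁻ (λ (x , y) → suc x , suc y) q of λ { ((_ , _ , refl) , (_ , _ , ())) }

length-pairs : ∀ k → length (pairs k) ≡ k C 2
length-pairs zero    = refl
length-pairs (suc k) = begin
  length (pairs (suc k))         ≡⟨ Listₚ.length-++ (map (λ y → zero , suc y) (allFin k)) ⟩
  length (map (λ y → zero , suc y) (allFin k)) + length (map (λ (x , y) → suc x , suc y) (pairs k))
    ≡⟨ cong₂ _+_ (Eq.trans (Listₚ.length-map (λ y → zero , suc y) (allFin k)) (Listₚ.length-tabulate id)) (Listₚ.length-map (λ (x , y) → suc x , suc y) (pairs k)) ⟩
  k + length (pairs k)           ≡⟨ cong₂ _+_ (sym (nC1≡n k)) (length-pairs k) ⟩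
  (k C 1) + (k C 2)              ≡⟨ nCk+nC[k+1]≡[n+1]C[k+1] k 1 ⟩
  suc k C 2                      ∎
  where open ≡-Reasoning

AllPairs-lookup : {R : A → A → Set} {xs : List A} → AllPairs R xs → ∀ {i j} → i <ᶠ j → R (List.lookup xs i) (List.lookup xs j)
AllPairs-lookup (r ∷ rs) {zero}  {suc j} _         = All.lookup r (∈ₚ.∈-lookup j)
AllPairs-lookup (r ∷ rs) {suc i} {suc j} (s<s i<j) = AllPairs-lookup rs i<j

module _ {n : ℕ} (H : Hypergraph n) where

  contains? : ∀ (u v : Fin n) → Decidable (λ (e : Subset n) → u ∈ₛ e × v ∈ₛ e)
  contains? u v e = (u ∈? e) ×-dec (v ∈? e)

  link : Fin n → Fin n → List (Subset n)
  link u v = filter (contains? u v) (edges H)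

  codeg : Fin n → Fin n → ℕ
  codeg u v = length (link u v)

  Fat : ℕ → Fin n → Fin n → Set
  Fat D u v = u ≢ v × D ≤ codeg u v

  -- The pair `u`, `v` is served first, so `t` edges suffice for it. Every other pair has `D`
  -- candidates, enough even after all the remaining pairs have taken their `t` edges.
  berge : ∀ {t k u v ys} → let D = t + (k C 2) * t in
          2 + length ys ≡ k → u ≢ v → t ≤ codeg u v → All (Fat D u) ys → All (Fat D v) ys → AllPairs (Fat D) ys →
          ContainsBerge t k H
  berge {t} {k} {u} {v} {ys} refl u≢v t≤ fat-u fat-v fat-ys = F , F⊑H , record
    { heavy = record
      { i = i ; i-inj = i-inj ; h = λ x y _ → pick (x , y)
      ; h-size = λ _ _ x<y → size-t (∈-pairs x<y)
      ; h-distinct = λ _ _ x<y → unique (∈-pairs x<y)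
      ; h-in = λ _ _ x<y → All.tabulate (∈-gather⁺ choice (∈-pairs x<y))
      ; h-contains = λ _ _ x<y → All.tabulate λ e∈ → proj₂ (from-link (from (∈-pairs x<y) e∈)) }
    ; size = Eq.trans (gather-length choice (pairs k) id) (Eq.trans (cong (_* t) (length-pairs k)) (*-comm (k C 2) t))
    ; disjoint = λ x y x<y x′ y′ x′<y′ e e∈ e∈′ →
        let eq = disjoint (∈-pairs x<y) (∈-pairs x′<y′) e∈ e∈′ in cong proj₁ eq , cong proj₂ eq }
    where
    vs = u ∷ v ∷ ys
    D = t + (k C 2) * t
    i : Fin k → Fin n
    i = List.lookup vs
    cand : Fin k × Fin k → List (Subset n)
    cand (x , y) = link (i x) (i y)
    vs-unique : Unique vs
    vs-unique = (u≢v ∷ All.map proj₁ fat-u) ∷ All.map proj₁ fat-v ∷ AllPairs.map proj₁ fat-ys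
    i-inj : ∀ {x y} → i x ≡ i y → x ≡ y
    i-inj {x} {y} e with Finₚ.<-cmp x y
    ... | tri< l _ _ = contradiction e (AllPairs-lookup vs-unique l)
    ... | tri≈ _ r _ = r
    ... | tri> _ _ g = contradiction (sym e) (AllPairs-lookup vs-unique g)
    fat : ∀ {x y} → x <ᶠ y → (x , y) ≢ (zero , suc zero) → D ≤ codeg (i x) (i y)
    fat {zero}  {suc zero} _ ne = contradiction refl ne
    fat {zero}  {suc (suc y)} _ _ = proj₂ (All.lookup fat-u (∈ₚ.∈-lookup y))
    fat {suc zero} {suc (suc y)} _ _ = proj₂ (All.lookup fat-v (∈ₚ.∈-lookup y))
    fat {suc (suc x)} {suc (suc y)} (s<s (s<s x<y)) _ = proj₂ (AllPairs-lookup fat-ys x<y)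
    fat {suc zero} {suc zero} (s<s ()) _
    from-link : ∀ {x y e} → e ∈ link x y → e ∈ edges H × (x ∈ₛ e × y ∈ₛ e)
    from-link {x} {y} = ∈ₚ.∈-filter⁻ (contains? x y) {xs = edges H}
    open Greedy (Productₚ.≡-dec _≟_ _≟_) t cand (λ (x , y) → Uniqueₚ.filter⁺ (contains? (i x) (i y)) (distinct H))
    tail-pairs : List (Fin k × Fin k)
    tail-pairs = List.drop 1 (pairs k)
    room : ∀ {ij} → ij ∈ tail-pairs → t + 0 + length tail-pairs * t ≤ length (cand ij)
    room {x , y} ij∈ = ≤-trans (+-mono-≤ (≤-reflexive (+-identityʳ t)) (*-monoˡ-≤ t (≤-trans (n≤1+n _) (≤-reflexive (length-pairs k)))))
      (fat (pairs-< k (there ij∈)) λ { refl → case pairs-unique k of λ { (a ∷ _) → All.lookup a ij∈ refl } })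
    choice : Choice [] (pairs k)
    choice = choose [] (pairs k) (pairs-unique k) (t≤ , enough (t + 0) tail-pairs room)
    open Choice choice
    F : Hypergraph n
    F = hg (gather choice (pairs k)) (gather-unique choice (pairs-unique k) id)
    F⊑H : F ⊑ H
    F⊑H e∈ = let _ , ij∈ , e∈′ = ∈-gather⁻ choice (pairs k) e∈ in proj₁ (from-link (from ij∈ e∈′))

-- Symmetrisation of r-cliques

#-≥2 : {Q : A → Set} {xs : List A} (Q? : Decidable Q) {x y : A} → x ∈ xs → y ∈ xs → x ≢ y → Q x → Q y → 2 ≤ # xs Q?
#-≥2 Q? x∈ y∈ x≢y qx qy = #-≥length Q? ((x≢y ∷ []) ∷ [] ∷ []) (qx ∷ qy ∷ [])
  λ { (here refl) → x∈ ; (there (here refl)) → y∈ }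

#-inject : ∀ {n} {P Q : Subset n → Set} (P? : Decidable P) (Q? : Decidable Q) (f : Subset n → Subset n) →
           (∀ {e} → P e → Q (f e)) → (∀ {d e} → P d → P e → f d ≡ f e → d ≡ e) → # (subs n) P? ≤ # (subs n) Q?
#-inject {n} P? Q? f to inj = begin
  # (subs n) P?                                              ≤⟨ ∑-mono (subs n) (λ e → ι-≤ (P? e) λ p → #-∈ (λ e′ → image? e e′) (∈-subs (f e)) (p , refl)) ⟩
  ∑ (subs n) (λ e → # (subs n) (λ e′ → image? e e′))         ≡⟨ ∑-swap (subs n) (subs n) ⟩
  ∑ (subs n) (λ e′ → # (subs n) (λ e → image? e e′))
    ≤⟨ ∑-mono (subs n) (λ e′ → #-≤ι (λ e → image? e e′) (Q? e′) (subs-unique n)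
         (λ d e (pd , fd) (pe , fe) → inj pd pe (Eq.trans fd (sym fe))) (λ { e (p , refl) → to p })) ⟩
  # (subs n) Q?                                              ∎
  where
  open ≤-Reasoning
  image? : ∀ e e′ → Dec (_ × f e ≡ e′)
  image? e e′ = P? e ×-dec (f e ≟ₛ e′)

module Symmetrisation {n : ℕ} (r : ℕ) where

  RClique : (Fin n → Fin n → Set) → Subset n → Set
  RClique G e = ∣ e ∣ ≡ r × (∀ u v → u ∈ₛ e → v ∈ₛ e → u ≢ v → G u v)

  abstract
    rclique? : ∀ {G} → (∀ u v → Dec (G u v)) → Decidable (RClique G)
    rclique? G? e = (∣ e ∣ ℕₚ.≟ r) ×-dec
      Finₚ.all? λ u → Finₚ.all? λ v → (u ∈? e) →-dec ((v ∈? e) →-dec ((¬? (u ≟ v)) →-dec G? u v))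

  TwoIn : (Fin n → Fin n → Set) → (Fin n → Fin n → Set) → Subset n → Set
  TwoIn G R e = RClique G e × ∃ λ u → ∃ λ v → u ∈ₛ e × v ∈ₛ e × u ≢ v × R u v

  abstract
    twoIn? : ∀ {G R} → (∀ u v → Dec (G u v)) → (∀ u v → Dec (R u v)) → Decidable (TwoIn G R)
    twoIn? G? R? e = rclique? G? e ×-dec
      Finₚ.any? λ u → Finₚ.any? λ v → (u ∈? e) ×-dec (v ∈? e) ×-dec ¬? (u ≟ v) ×-dec R? u v

  -- One Zykov step: the non-neighbours Far of x in A become independent and joined to all other vertices.
  module Step (G : Fin n → Fin n → Set) (G? : ∀ u v → Dec (G u v)) (A : Fin n → Set) (A? : Decidable A)
    (G-sym : ∀ {u v} → G u v → G v u) (G-irr : ∀ {u} → ¬ G u u)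
    (joined : ∀ {u v} → A u → ¬ A v → G u v) (x : Fin n) (x∈A : A x) where

    deg : Fin n → ℕ
    deg y = # (subs n) (λ e → rclique? G? e ×-dec (y ∈? e))

    Far : Fin n → Set
    Far y = A y × ¬ G x y

    Far? : Decidable Far
    Far? y = A? y ×-dec ¬? (G? x y)

    G′ : Fin n → Fin n → Set
    G′ u v = (Far u → ¬ Far v) × (¬ Far u → ¬ Far v → G u v)

    G′? : ∀ u v → Dec (G′ u v)
    G′? u v = (Far? u →-dec ¬? (Far? v)) ×-dec (¬? (Far? u) →-dec (¬? (Far? v) →-dec G? u v))

    A′ : Fin n → Set
    A′ y = A y × G x y

    A′? : Decidable A′
    A′? y = A? y ×-dec G? x y

    A∖Far⊆A′ : ∀ {y} → A y → ¬ Far y → A′ y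
    A∖Far⊆A′ {y} a ¬b with G? x y
    ... | yes g = a , g
    ... | no ¬g = contradiction (a , ¬g) ¬b

    BB : Fin n → Fin n → Set
    BB u v = Far u × Far v

    BB? : ∀ u v → Dec (BB u v)
    BB? u v = Far? u ×-dec Far? v

    module _ {y : Fin n} (y∈Far : Far y) where
      move : Subset n → Subset n
      move e = e [ x ]≔ false [ y ]≔ true

      y∉ : ∀ {e} → RClique G e × x ∈ₛ e → y ∉ₛ e [ x ]≔ false
      y∉ {e} ((_ , cl) , x∈) y∈ with y ≟ x
      ... | yes refl = ∉-delete e x y∈
      ... | no y≢x   = proj₂ y∈Far (cl x y x∈ (∈-update⁻ e y≢x y∈) (y≢x ∘ sym))

      ∈-move⁻ : ∀ {e u} → u ∈ₛ move e → u ≡ y ⊎ (u ∈ₛ e × u ≢ x)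
      ∈-move⁻ {e} {u} u∈ with ∈-insert⁻ (e [ x ]≔ false) u∈
      ... | inj₁ u≡y = inj₁ u≡y
      ... | inj₂ u∈′ with u ≟ x
      ... | yes refl = contradiction u∈′ (∉-delete e x)
      ... | no u≢x   = inj₂ (∈-update⁻ e u≢x u∈′ , u≢x)

      move-clique : ∀ {e} → RClique G e × x ∈ₛ e → RClique G′ (move e) × y ∈ₛ move e
      move-clique {e} pe@((len , cl) , x∈) =
        (Eq.trans (∣insert∣ (e [ x ]≔ false) y (y∉ pe)) (Eq.trans (∣delete∣ e x x∈) len) ,
         λ u v u∈ v∈ u≢v → adjacent u≢v (∈-move⁻ u∈) (∈-move⁻ v∈)) , ∈-insert (e [ x ]≔ false) y
        where
        outside-Far : ∀ {u} → u ∈ₛ e → u ≢ x → ¬ Far u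
        outside-Far u∈ u≢x (_ , ¬g) = ¬g (cl x _ x∈ u∈ (u≢x ∘ sym))
        adjacent : ∀ {u v} → u ≢ v → u ≡ y ⊎ (u ∈ₛ e × u ≢ x) → v ≡ y ⊎ (v ∈ₛ e × v ≢ x) → G′ u v
        adjacent u≢v (inj₁ refl) (inj₁ refl) = contradiction refl u≢v
        adjacent u≢v (inj₁ refl) (inj₂ (v∈ , v≢x)) = (λ _ → outside-Far v∈ v≢x) , λ ¬b → contradiction y∈Far ¬b
        adjacent u≢v (inj₂ (u∈ , u≢x)) (inj₁ refl) = (λ b → contradiction b (outside-Far u∈ u≢x)) , λ _ ¬b → contradiction y∈Far ¬b
        adjacent u≢v (inj₂ (u∈ , u≢x)) (inj₂ (v∈ , v≢x)) = (λ b → contradiction b (outside-Far u∈ u≢x)) , λ _ _ → cl _ _ u∈ v∈ u≢v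

      move-⊆ : ∀ {d e} → RClique G d × x ∈ₛ d → RClique G e × x ∈ₛ e → move d ≡ move e → ∀ u → u ∈ₛ d → u ∈ₛ e
      move-⊆ {d} {e} pd pe eq u u∈ with u ≟ x
      ... | yes refl = proj₂ pe
      ... | no u≢x with ∈-move⁻ (subst (u ∈ₛ_) eq (∈-insert⁺ (d [ x ]≔ false) (∈-update⁺ d u≢x u∈)))
      ... | inj₁ refl     = contradiction (∈-update⁺ d u≢x u∈) (y∉ pd)
      ... | inj₂ (u∈e , _) = u∈e

      -- Exchanging `x` for `y` is injective on the cliques through `x`. The result is a clique of
      -- `G′`, because the other vertices are neighbours of `x`, hence outside `Far`, and `G′` joins
      -- them to `y`.
      deg≤ : deg x ≤ # (subs n) (λ e → rclique? G′? e ×-dec (y ∈? e))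
      deg≤ = #-inject (λ e → rclique? G? e ×-dec (x ∈? e)) (λ e → rclique? G′? e ×-dec (y ∈? e)) move move-clique
        λ pd pe eq → ext-∈ (move-⊆ pd pe eq) (move-⊆ pe pd (sym eq))

    touching? : ∀ {H : Fin n → Fin n → Set} (H? : ∀ u v → Dec (H u v)) y e → Dec (Far y × RClique H e × y ∈ₛ e)
    touching? H? y e = Far? y ×-dec (rclique? H? e ×-dec (y ∈? e))

    ∑-touching : ∀ {H : Fin n → Fin n → Set} (H? : ∀ u v → Dec (H u v)) →
      ∑ (allFin n) (λ y → ι (Far? y) * # (subs n) (λ e → rclique? H? e ×-dec (y ∈? e))) ≡
      ∑ (subs n) (λ e → # (allFin n) (λ y → touching? H? y e))
    ∑-touching H? = Eq.trans
      (∑-cong (allFin n) λ y → Eq.trans (sym (∑-*ˡ (subs n) (ι (Far? y)))) (∑-cong (subs n) λ e → sym (ι-* (Far? y) _)))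
      (∑-swap (allFin n) (subs n))

    -- Both sides are compared through incidences with `Far`. In `G` a clique that meets `Far` has
    -- at least one incidence, and at least two if it lies in the extra term. In `G′` it has exactly
    -- one. Each `y` in `Far` has degree at most `deg x` in `G` and, by `deg≤`, at least `deg x` in
    -- `G′`. Cliques that miss `Far` survive.
    step : (∀ {y} → A y → deg y ≤ deg x) →
           # (subs n) (rclique? G?) + # (subs n) (twoIn? G? BB?) ≤ # (subs n) (rclique? G′?)
    step max = begin
      # (subs n) (rclique? G?) + # (subs n) (twoIn? G? BB?)  ≡⟨ sym (∑-+ (subs n)) ⟩
      ∑ (subs n) (λ e → ι (rclique? G? e) + ι (twoIn? G? BB? e))
        ≤⟨ ∑-mono (subs n) split ⟩
      ∑ (subs n) (λ e → ι (clear? G? e) + # (allFin n) (λ y → touching? G? y e))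
        ≡⟨ ∑-+ (subs n) ⟩
      # (subs n) (clear? G?) + ∑ (subs n) (λ e → # (allFin n) (λ y → touching? G? y e))
        ≡⟨ cong (# (subs n) (clear? G?) +_) (sym (∑-touching G?)) ⟩
      # (subs n) (clear? G?) + ∑ (allFin n) (λ y → ι (Far? y) * deg y)
        ≤⟨ +-mono-≤ (#-mono (subs n) (clear? G?) (clear? G′?) (λ e ((len , cl) , none) → (len , λ u v u∈ v∈ u≢v →
             (λ b → contradiction (u , u∈ , b) none) , λ _ _ → cl u v u∈ v∈ u≢v) , none))
           (∑-mono (allFin n) λ y → ι-*ˡ (Far? y) λ b → ≤-trans (max (proj₁ b)) (deg≤ b)) ⟩
      # (subs n) (clear? G′?) + ∑ (allFin n) (λ y → ι (Far? y) * # (subs n) (λ e → rclique? G′? e ×-dec (y ∈? e)))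
        ≡⟨ cong (# (subs n) (clear? G′?) +_) (∑-touching G′?) ⟩
      # (subs n) (clear? G′?) + ∑ (subs n) (λ e → # (allFin n) (λ y → touching? G′? y e))
        ≡⟨ sym (∑-+ (subs n)) ⟩
      ∑ (subs n) (λ e → ι (clear? G′? e) + # (allFin n) (λ y → touching? G′? y e))
        ≤⟨ ∑-mono (subs n) merge ⟩
      # (subs n) (rclique? G′?) ∎
      where
      open ≤-Reasoning
      Touches : Subset n → Set
      Touches e = ∃ λ y → y ∈ₛ e × Far y
      abstract
        touches? : Decidable Touches
        touches? e = Finₚ.any? λ y → (y ∈? e) ×-dec Far? y
      clear? : ∀ {H : Fin n → Fin n → Set} (H? : ∀ u v → Dec (H u v)) → Decidable (λ e → RClique H e × ¬ Touches e)
      clear? H? e = rclique? H? e ×-dec ¬? (touches? e)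
      split : ∀ e → ι (rclique? G? e) + ι (twoIn? G? BB? e) ≤ ι (clear? G? e) + # (allFin n) (λ y → touching? G? y e)
      split e = go (rclique? G? e) (twoIn? G? BB? e) (touches? e)
        where
        go : (p : Dec (RClique G e)) (q : Dec (TwoIn G BB e)) → Dec (Touches e) →
             ι p + ι q ≤ ι (clear? G? e) + # (allFin n) (λ y → touching? G? y e)
        go (no ¬c) q _ rewrite ι-no q (¬c ∘ proj₁) = z≤n
        go (yes c) (yes (_ , u , v , u∈ , v∈ , u≢v , bu , bv)) _ =
          ≤-trans (#-≥2 (λ y → touching? G? y e) (∈ₚ.∈-allFin u) (∈ₚ.∈-allFin v) u≢v (bu , c , u∈) (bv , c , v∈)) (m≤n+m _ _)
        go (yes c) (no _) (yes (y , y∈ , b)) = ≤-trans (#-∈ (λ y → touching? G? y e) (∈ₚ.∈-allFin y) (b , c , y∈)) (m≤n+m _ _)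
        go (yes c) (no _) (no ¬t) = ≤-trans (ι-≥1 (clear? G? e) (c , ¬t)) (m≤m+n _ _)
      merge : ∀ e → ι (clear? G′? e) + # (allFin n) (λ y → touching? G′? y e) ≤ ι (rclique? G′? e)
      merge e = ≤-trans (+-monoʳ-≤ (ι (clear? G′? e))
          (#-≤ι (λ y → touching? G′? y e) (rclique? G′? e ×-dec touches? e) (Uniqueₚ.allFin⁺ n) same (λ y (b , c , y∈) → c , y , y∈ , b)))
        (ι-disjoint (clear? G′? e) (rclique? G′? e ×-dec touches? e) (rclique? G′? e) proj₁ proj₁ λ (_ , ¬t) (_ , t) → ¬t t)
        where
        same : ∀ y y′ → Far y × RClique G′ e × y ∈ₛ e → Far y′ × RClique G′ e × y′ ∈ₛ e → y ≡ y′
        same y y′ (b , (_ , cl) , y∈) (b′ , _ , y′∈) with y ≟ y′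
        ... | yes e = e
        ... | no ne = contradiction b′ (proj₁ (cl y y′ y∈ y′∈ ne) b)

  Mono : (Fin n → Set) → (Fin n → ℕ) → Fin n → Fin n → Set
  Mono A c u v = A u × A v × c u ≡ c v

  mono? : ∀ {A} → Decidable A → ∀ c u v → Dec (Mono A c u v)
  mono? A? c u v = A? u ×-dec A? v ×-dec (c u ℕₚ.≟ c v)

  -- On `A` this is the complete multipartite graph whose classes are the colours of `c`; pairs that
  -- leave `A` are those of `G`.
  Recoloured : (Fin n → Fin n → Set) → (Fin n → Set) → (Fin n → ℕ) → Fin n → Fin n → Set
  Recoloured G A c u v = (A u → A v → c u ≢ c v) × (¬ A u → G u v) × (¬ A v → G u v)

  recoloured? : ∀ {G A} → (∀ u v → Dec (G u v)) → Decidable A → ∀ c u v → Dec (Recoloured G A c u v)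
  recoloured? G? A? c u v = (A? u →-dec (A? v →-dec ¬? (c u ℕₚ.≟ c v))) ×-dec (¬? (A? u) →-dec G? u v) ×-dec (¬? (A? v) →-dec G? u v)

  CliqueIn : ℕ → (Fin n → Fin n → Set) → (Fin n → Set) → Set
  CliqueIn d G A = ∃ λ vs → length vs ≡ d × All A vs × AllPairs G vs

  -- Let `x` lie in most `r`-cliques among the vertices of `A`. Its non-neighbours in `A` become a
  -- colour class, with the new colour `d`, and the induction continues on its neighbours in `A`.
  -- There the clique number has dropped, since `x` extends every clique. Each step books the
  -- cliques with two vertices in the new class as a gain.
  symmetrise : ∀ d (G : Fin n → Fin n → Set) (G? : ∀ u v → Dec (G u v)) (A : Fin n → Set) (A? : Decidable A) →
    (∀ {u v} → G u v → G v u) → (∀ {u} → ¬ G u u) → (∀ {u v} → A u → ¬ A v → G u v) →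
    ¬ CliqueIn (suc d) G A →
    ∃ λ c → (∀ u → A u → c u < d) ×
      # (subs n) (rclique? G?) + # (subs n) (twoIn? G? (mono? A? c)) ≤ # (subs n) (rclique? (recoloured? G? A? c))
  symmetrise d G G? A A? G-sym G-irr joined no-clique with Finₚ.any? A?
  ... | no empty = (λ _ → 0) , (λ u a → contradiction (u , a) empty) , (begin
    # (subs n) (rclique? G?) + # (subs n) (twoIn? G? (mono? A? (λ _ → 0)))
      ≡⟨ cong (# (subs n) (rclique? G?) +_) (#-none (subs n) (twoIn? G? (mono? A? (λ _ → 0))) λ e (_ , u , _ , _ , _ , _ , a , _) → empty (u , a)) ⟩
    # (subs n) (rclique? G?) + 0   ≡⟨ +-identityʳ _ ⟩
    # (subs n) (rclique? G?)
      ≤⟨ #-mono (subs n) (rclique? G?) (rclique? (recoloured? G? A? (λ _ → 0))) (λ e (len , cl) → len , λ u v u∈ v∈ u≢v →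
           (λ a → contradiction (u , a) empty) , (λ _ → cl u v u∈ v∈ u≢v) , λ _ → cl u v u∈ v∈ u≢v) ⟩
    # (subs n) (rclique? (recoloured? G? A? (λ _ → 0))) ∎)
    where open ≤-Reasoning
  symmetrise zero G G? A A? G-sym G-irr joined no-clique | yes (x , a) = contradiction (x ∷ [] , refl , a ∷ [] , [] ∷ []) no-clique
  symmetrise (suc d) G G? A A? G-sym G-irr joined no-clique | yes (x₀ , a₀) = c , c< , (begin
    K + # (subs n) (twoIn? G? (mono? A? c))
      ≤⟨ +-monoʳ-≤ K (∑-mono (subs n) λ e → ι-⊎ (twoIn? G? (mono? A? c) e) (twoIn? G? BB? e) (twoIn? G′? (mono? A′? c′) e) (mono-split e)) ⟩
    K + ∑ (subs n) (λ e → ι (twoIn? G? BB? e) + ι (twoIn? G′? (mono? A′? c′) e))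
      ≡⟨ cong (K +_) (∑-+ (subs n)) ⟩
    K + (# (subs n) (twoIn? G? BB?) + # (subs n) (twoIn? G′? (mono? A′? c′)))
      ≡⟨ sym (+-assoc K _ _) ⟩
    K + # (subs n) (twoIn? G? BB?) + # (subs n) (twoIn? G′? (mono? A′? c′))
      ≤⟨ +-monoˡ-≤ _ (step maximal) ⟩
    # (subs n) (rclique? G′?) + # (subs n) (twoIn? G′? (mono? A′? c′))
      ≤⟨ proj₂ (proj₂ ih) ⟩
    # (subs n) (rclique? (recoloured? G′? A′? c′))
      ≤⟨ #-mono (subs n) (rclique? (recoloured? G′? A′? c′)) (rclique? (recoloured? G? A? c)) (λ e (len , cl) → len , λ u v u∈ v∈ u≢v → recolour (cl u v u∈ v∈ u≢v)) ⟩
    # (subs n) (rclique? (recoloured? G? A? c)) ∎)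
    where
    open ≤-Reasoning
    K = # (subs n) (rclique? G?)
    degree : Fin n → ℕ
    degree y = # (subs n) (λ e → rclique? G? e ×-dec (y ∈? e))
    best = max-∃ degree (filter A? (allFin n)) (∈ₚ.∈-filter⁺ A? (∈ₚ.∈-allFin x₀) a₀)
    x = proj₁ best
    a = proj₂ (∈ₚ.∈-filter⁻ A? {xs = allFin n} (proj₁ (proj₂ best)))
    open Step G G? A A? G-sym G-irr joined x a
    maximal : ∀ {y} → A y → deg y ≤ deg x
    maximal {y} ay = proj₂ (proj₂ best) (∈ₚ.∈-filter⁺ A? (∈ₚ.∈-allFin y) ay)
    ¬Far : ∀ {y} → A′ y → ¬ Far y
    ¬Far (_ , g) (_ , ¬g) = ¬g g
    G′⇒G : ∀ {vs} → All A′ vs → AllPairs G′ vs → AllPairs G vs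
    G′⇒G [] [] = []
    G′⇒G (av ∷ avs) (gs ∷ ps) = All.zipWith (λ (av′ , g) → proj₂ g (¬Far av) (¬Far av′)) (avs , gs) ∷ G′⇒G avs ps
    ih = symmetrise d G′ G′? A′ A′?
      (λ (h , k) → (λ bv bu → h bu bv) , λ bv bu → G-sym (k bu bv))
      (λ (h , k) → let nb = λ b → h b b in G-irr (k nb nb))
      (λ a′u ¬a′v → (λ b → contradiction b (¬Far a′u)) , λ _ ¬bv → joined (proj₁ a′u) λ av → ¬a′v (A∖Far⊆A′ av ¬bv))
      (λ (vs , len , all , ps) → no-clique (x ∷ vs , cong suc len , a ∷ All.map proj₁ all , All.map proj₂ all ∷ G′⇒G all ps))
    c′ = proj₁ ih
    c′< = proj₁ (proj₂ ih)
    colour : ∀ u → Dec (Far u) → ℕ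
    colour u (yes _) = d
    colour u (no _)  = c′ u
    c : Fin n → ℕ
    c u = colour u (Far? u)
    c< : ∀ u → A u → c u < suc d
    c< u au with Far? u
    ... | yes _ = n<1+n d
    ... | no ¬b = m<n⇒m<1+n (c′< u (A∖Far⊆A′ au ¬b))
    -- A clique with two vertices of one colour is booked either now, if two of its vertices lie in
    -- `Far`, or later: with at most one vertex in `Far` it is still a clique of `G′`, and its
    -- monochromatic pair lies in `A′`.
    mono-split : ∀ e → TwoIn G (Mono A c) e → TwoIn G BB e ⊎ TwoIn G′ (Mono A′ c′) e
    mono-split e (rc@(len , cl) , u , v , u∈ , v∈ , u≢v , au , av , cu≡cv) with twoIn? G? BB? e
    ... | yes two = inj₁ two
    ... | no ¬two with Far? u | Far? v
    ... | yes bu | yes bv = contradiction (rc , u , v , u∈ , v∈ , u≢v , bu , bv) ¬two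
    ... | yes bu | no ¬bv = contradiction (Eq.trans (sym cu≡cv) refl) (<⇒≢ (c′< v (A∖Far⊆A′ av ¬bv)))
    ... | no ¬bu | yes bv = contradiction cu≡cv (<⇒≢ (c′< u (A∖Far⊆A′ au ¬bu)))
    ... | no ¬bu | no ¬bv = inj₂ ((len , λ a b a∈ b∈ a≢b →
      (λ Ba Bb → ¬two (rc , a , b , a∈ , b∈ , a≢b , Ba , Bb)) , λ _ _ → cl a b a∈ b∈ a≢b) ,
      u , v , u∈ , v∈ , u≢v , A∖Far⊆A′ au ¬bu , A∖Far⊆A′ av ¬bv , cu≡cv)
    recolour : ∀ {u v} → Recoloured G′ A′ c′ u v → Recoloured G A c u v
    recolour {u} {v} (differ , left , right) = differ′ , left′ , right′
      where
      differ′ : A u → A v → c u ≢ c v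
      differ′ au av cu≡cv with Far? u | Far? v
      ... | yes bu | yes bv = proj₁ (left λ a′u → ¬Far a′u bu) bu bv
      ... | yes bu | no ¬bv = <⇒≢ (c′< v (A∖Far⊆A′ av ¬bv)) (sym cu≡cv)
      ... | no ¬bu | yes bv = <⇒≢ (c′< u (A∖Far⊆A′ au ¬bu)) cu≡cv
      ... | no ¬bu | no ¬bv = differ (A∖Far⊆A′ au ¬bu) (A∖Far⊆A′ av ¬bv) cu≡cv
      left′ : ¬ A u → G u v
      left′ ¬au with Far? v
      ... | yes (av , _) = G-sym (joined av ¬au)
      ... | no ¬bv       = proj₂ (left (¬au ∘ proj₁)) (¬au ∘ proj₁) ¬bv
      right′ : ¬ A v → G u v
      right′ ¬av with Far? u
      ... | yes (au , _) = joined au ¬av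
      ... | no ¬bu       = proj₂ (right (¬av ∘ proj₁)) ¬bu (¬av ∘ proj₁)

  -- With `A` the whole vertex set, the recoloured graph is complete multipartite with colours below
  -- `m`. Its `r`-cliques are transversals, and a clique with no monochromatic pair is one as well.
  clique-partition : ∀ m (G : Fin n → Fin n → Set) (G? : ∀ u v → Dec (G u v)) →
    (∀ {u v} → G u v → G v u) → (∀ {u} → ¬ G u u) →
    ¬ (∃ λ vs → length vs ≡ suc m × AllPairs G vs) →
    ∃ λ (p : Fin n → Fin m) →
      # (subs n) (rclique? G?) + # (subs n) (λ e → rclique? G? e ×-dec ¬? (transversal? p e)) ≤ # (subs n) (TEdge? r p)
  clique-partition m G G? G-sym G-irr no-clique
    with c , c< , bound ← symmetrise m G G? (λ _ → ⊤) (λ _ → yes _) G-sym G-irr (λ _ ¬t → contradiction _ ¬t)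
                            (λ (vs , len , _ , ps) → no-clique (vs , len , ps)) = p , (begin
    # (subs n) (rclique? G?) + # (subs n) (λ e → rclique? G? e ×-dec ¬? (transversal? p e))
      ≤⟨ +-monoʳ-≤ (# (subs n) (rclique? G?)) (#-mono (subs n) (λ e → rclique? G? e ×-dec ¬? (transversal? p e)) (twoIn? G? (mono? (λ _ → yes _) c)) mono) ⟩
    # (subs n) (rclique? G?) + # (subs n) (twoIn? G? (mono? (λ _ → yes _) c)) ≤⟨ bound ⟩
    # (subs n) (rclique? (recoloured? G? (λ _ → yes _) c))
      ≤⟨ #-mono (subs n) (rclique? (recoloured? G? (λ _ → yes _) c)) (TEdge? r p) transversal ⟩
    # (subs n) (TEdge? r p) ∎)
    where
    open ≤-Reasoning
    p : Fin n → Fin m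
    p u = fromℕ< (c< u _)
    p⇒c : ∀ {u v} → p u ≡ p v → c u ≡ c v
    p⇒c {u} {v} e = Eq.trans (sym (Finₚ.toℕ-fromℕ< (c< u _))) (Eq.trans (cong toℕ e) (Finₚ.toℕ-fromℕ< (c< v _)))
    transversal : ∀ e → RClique (Recoloured G (λ _ → ⊤) c) e → TEdge r p e
    transversal e (len , cl) = len , λ u v u∈ v∈ pu≡pv → case u ≟ v of λ where
      (yes u≡v) → u≡v
      (no u≢v)  → contradiction (p⇒c pu≡pv) (proj₁ (cl u v u∈ v∈ u≢v) _ _)
    mono : ∀ e → RClique G e × ¬ Transversal p e → TwoIn G (Mono (λ _ → ⊤) c) e
    mono e (rc , ¬tr) with twoIn? G? (mono? (λ _ → yes _) c) e
    ... | yes two = two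
    ... | no ¬two = contradiction (λ u v u∈ v∈ pu≡pv → case u ≟ v of λ where
      (yes u≡v) → u≡v
      (no u≢v)  → contradiction (rc , u , v , u∈ , v∈ , u≢v , _ , _ , p⇒c pu≡pv) ¬two) ¬tr

-- Stability

module Counting {n : ℕ} (d s m : ℕ) (r≤m : 3 + d ≤ m) (H : Hypergraph n) (uniform : Uniform (3 + d) H)
                (berge-free : ¬ ContainsBerge (suc s) (suc m) H) where

  open ≤-Reasoning

  r D : ℕ
  r = 3 + d
  D = suc s + (suc m C 2) * suc s

  V : List (Fin n)
  V = allFin n

  E : Subset n → Set
  E e = e ∈ edges H

  abstract
    E? : Decidable E
    E? e = DecMembership._∈?_ _≟ₛ_ e (edges H)

  fat : Fin n → Fin n → Set
  fat = Fat H D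

  abstract
    fat? : ∀ u v → Dec (fat u v)
    fat? u v = ¬? (u ≟ v) ×-dec (D ≤? codeg H u v)

  fat-sym : ∀ {u v} → fat u v → fat v u
  fat-sym {u} {v} (u≢v , D≤) = u≢v ∘ sym , ≤-trans D≤ (unique-⊆-length (Uniqueₚ.filter⁺ (contains? H u v) (distinct H))
    λ e∈ → let e∈H , u∈ , v∈ = ∈ₚ.∈-filter⁻ (contains? H u v) {xs = edges H} e∈ in ∈ₚ.∈-filter⁺ (contains? H v u) e∈H (v∈ , u∈))

  thin : ∀ {u v} → u ≢ v → ¬ fat u v → codeg H u v ≤ D
  thin u≢v ¬f = <⇒≤ (≰⇒> λ D≤ → ¬f (u≢v , D≤))

  length-filter-edges : {P : Subset n → Set} (P? : Decidable P) → length (filter P? (edges H)) ≡ # (subs n) (λ e → E? e ×-dec P? e)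
  length-filter-edges P? = ≤-antisym
    (#-≥length (λ e → E? e ×-dec P? e) (Uniqueₚ.filter⁺ P? (distinct H)) (All.tabulate (∈ₚ.∈-filter⁻ P? {xs = edges H})) (λ _ → ∈-subs _))
    (subst (_≤ length (filter P? (edges H))) (length-filter-# (subs n) (λ e → E? e ×-dec P? e))
      (unique-⊆-length (Uniqueₚ.filter⁺ (λ e → E? e ×-dec P? e) (subs-unique n)) λ e∈ →
        let e∈H , pe = proj₂ (∈ₚ.∈-filter⁻ (λ e → E? e ×-dec P? e) {xs = subs n} e∈) in ∈ₚ.∈-filter⁺ P? e∈H pe))

  Through : Fin n → Fin n → Subset n → Set
  Through u v e = E e × (u ∈ₛ e × v ∈ₛ e)

  through? : ∀ u v → Decidable (Through u v)
  through? u v e = E? e ×-dec contains? H u v e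

  codeg≡ : ∀ u v → codeg H u v ≡ # (subs n) (through? u v)
  codeg≡ u v = length-filter-edges (contains? H u v)

  ∣E∣≤ : ∣E∣ H ≤ # (subs n) E?
  ∣E∣≤ = #-≥length E? (distinct H) (All.tabulate id) (λ _ → ∈-subs _)

  edge-size : ∀ {e} → E e → ∣ e ∣ ≡ r
  edge-size = All.lookup uniform

  no-fat-clique : ¬ (∃ λ vs → length vs ≡ suc m × AllPairs fat vs)
  no-fat-clique (u ∷ v ∷ ys , len , ((f ∷ fu) ∷ fv ∷ fys)) =
    berge-free (berge H len (proj₁ f) (≤-trans (m≤m+n (suc s) _) (proj₂ f)) fu fv fys)
  no-fat-clique (u ∷ [] , refl , _) = contradiction r≤m λ ()

  open Symmetrisation {n} r

  Clique : Subset n → Set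
  Clique = RClique fat

  clique? : Decidable Clique
  clique? = rclique? fat?

  -- An edge is a clique of the fat graph unless it contains one of at most n² thin pairs.
  edges-vs-cliques : # (subs n) E? ≤ # (subs n) (λ e → E? e ×-dec clique? e) + D * (n * n)
  edges-vs-cliques = begin
    # (subs n) E?
      ≤⟨ ∑-mono (subs n) pointwise ⟩
    ∑ (subs n) (λ e → ι (E? e ×-dec clique? e) + ∑ V (λ u → # V (λ v → thin? u v e)))
      ≡⟨ ∑-+ (subs n) ⟩
    # (subs n) (λ e → E? e ×-dec clique? e) + ∑ (subs n) (λ e → ∑ V (λ u → # V (λ v → thin? u v e)))
      ≤⟨ +-monoʳ-≤ (# (subs n) (λ e → E? e ×-dec clique? e)) (begin
           ∑ (subs n) (λ e → ∑ V (λ u → # V (λ v → thin? u v e)))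
             ≡⟨ Eq.trans (∑-swap (subs n) V) (∑-cong V λ u → ∑-swap (subs n) V) ⟩
           ∑ V (λ u → ∑ V (λ v → # (subs n) (thin? u v)))
             ≤⟨ ∑-mono V (λ u → ∑-mono V (λ v → few u v)) ⟩
           ∑ V (λ _ → ∑ V (λ _ → D))
             ≡⟨ Eq.trans (∑-cong V λ _ → ∑-const V D) (∑-const V (length V * D)) ⟩
           length V * (length V * D)
             ≡⟨ cong (λ l → l * (l * D)) (Listₚ.length-tabulate {n = n} id) ⟩
           n * (n * D)
             ≡⟨ rearrange n D ⟩
           D * (n * n) ∎) ⟩
    # (subs n) (λ e → E? e ×-dec clique? e) + D * (n * n) ∎
    where
    Thin : Fin n → Fin n → Subset n → Set
    Thin u v e = (u ≢ v × ¬ fat u v) × Through u v e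
    thin? : ∀ u v → Decidable (Thin u v)
    thin? u v e = (¬? (u ≟ v) ×-dec ¬? (fat? u v)) ×-dec through? u v e
    some-thin? : ∀ e → Dec (∃ λ u → ∃ λ v → Thin u v e)
    some-thin? e = Finₚ.any? λ u → Finₚ.any? λ v → thin? u v e
    rearrange : ∀ n D → n * (n * D) ≡ D * (n * n)
    rearrange = solve-∀
    few : ∀ u v → # (subs n) (thin? u v) ≤ D
    few u v = by (u ≟ v) (fat? u v)
      where
      by : Dec (u ≡ v) → Dec (fat u v) → # (subs n) (thin? u v) ≤ D
      by (no u≢v)  (no ¬f) = ≤-trans (≤-trans (#-mono (subs n) (thin? u v) (through? u v) (λ _ → proj₂)) (≤-reflexive (sym (codeg≡ u v)))) (thin u≢v ¬f)
      by (yes u≡v) _       = ≤-trans (≤-reflexive (#-none (subs n) (thin? u v) λ e ((u≢v , _) , _) → u≢v u≡v)) z≤n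
      by (no _)    (yes f) = ≤-trans (≤-reflexive (#-none (subs n) (thin? u v) λ e ((_ , ¬f) , _) → ¬f f)) z≤n
    pointwise : ∀ e → ι (E? e) ≤ ι (E? e ×-dec clique? e) + ∑ V (λ u → # V (λ v → thin? u v e))
    pointwise e = ι-≤ (E? e) λ e∈H → case some-thin? e of λ where
      (yes (u , v , th)) → ≤-trans (≤-trans (#-∈ (λ v → thin? u v e) (∈ₚ.∈-allFin v) th)
                             (∑-∈ (λ u → # V (λ v → thin? u v e)) (∈ₚ.∈-allFin u))) (m≤n+m _ _)
      (no none) → ≤-trans (ι-≥1 (E? e ×-dec clique? e) (e∈H , edge-size e∈H , λ u v u∈ v∈ u≢v → case fat? u v of λ where
        (yes f) → f
        (no ¬f) → contradiction (u , v , (u≢v , ¬f) , e∈H , u∈ , v∈) none)) (m≤m+n _ _)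

  -- Stated for an arbitrary partition because it is applied both to the one found by symmetrisation
  -- and to its correction `p′`.
  module Missing (p : Fin n → Fin m) where

    Miss : Subset n → Set
    Miss e = TEdge r p e × ¬ E e

    miss? : Decidable Miss
    miss? e = TEdge? r p e ×-dec ¬? (E? e)

    Present : Subset n → Set
    Present e = TEdge r p e × E e

    present? : Decidable Present
    present? e = TEdge? r p e ×-dec E? e

    split-TEdge : # (subs n) (TEdge? r p) ≡ # (subs n) present? + # (subs n) miss?
    split-TEdge = Eq.trans (∑-cong (subs n) λ e → split (TEdge? r p e) (E? e)) (∑-+ (subs n))
      where
      split : ∀ {P Q : Set} (a : Dec P) (b : Dec Q) → ι a ≡ ι (a ×-dec b) + ι (a ×-dec ¬? b)
      split (yes _) (yes _) = refl
      split (yes _) (no _)  = refl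
      split (no _)  _       = refl

    missAt : Fin n → ℕ
    missAt x = # (subs n) (λ e → miss? e ×-dec (x ∈? e))

    missAt₂ : Fin n → Fin n → ℕ
    missAt₂ x y = # (subs n) (λ e → (miss? e ×-dec (x ∈? e)) ×-dec (y ∈? e))

    ∑-incidence : {P : Subset n → Set} (P? : Decidable P) → (∀ {e} → P e → ∣ e ∣ ≡ r) →
                  ∑ V (λ x → # (subs n) (λ e → P? e ×-dec (x ∈? e))) ≡ # (subs n) P? * r
    ∑-incidence P? len = Eq.trans (∑-swap V (subs n)) (Eq.trans (∑-cong (subs n) pointwise) (∑-*ʳ (subs n) r))
      where
      pointwise : ∀ e → # V (λ x → P? e ×-dec (x ∈? e)) ≡ ι (P? e) * r
      pointwise e = by (P? e)
        where
        by : (p? : Dec _) → # V (λ x → p? ×-dec (x ∈? e)) ≡ ι p? * r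
        by p?@(no ¬p) = #-none V (λ x → p? ×-dec (x ∈? e)) λ _ (p , _) → ¬p p
        by p?@(yes p) = Eq.trans (#-cong V (λ x → p? ×-dec (x ∈? e)) (_∈? e) (λ _ → proj₂) (λ _ q → p , q))
                          (Eq.trans (#-members e) (Eq.trans (len p) (sym (+-identityʳ r))))

    ∑-missAt : ∑ V missAt ≡ # (subs n) miss? * r
    ∑-missAt = ∑-incidence miss? (proj₁ ∘ proj₁)

    ∑-missAt₂ : ∑ V (λ x → ∑ V (missAt₂ x)) ≡ # (subs n) miss? * r * r
    ∑-missAt₂ = Eq.trans (∑-cong V λ x → ∑-incidence (λ e → miss? e ×-dec (x ∈? e)) (proj₁ ∘ proj₁ ∘ proj₁))
                  (Eq.trans (∑-*ʳ V r) (cong (_* r) ∑-missAt))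

    -- A cross pair lies in at least `y₀ ^ (r - 2)` transversals, and at most `D` of them are edges
    -- when the pair is not fat.
    cross-missing : ∀ {y₀ x y} → (∀ j → y₀ ≤ size p j) → p x ≢ p y → ¬ fat x y → y₀ ^ (1 + d) ≤ missAt₂ x y + D
    cross-missing {y₀} {x} {y} big px≢py ¬f = begin
      y₀ ^ (1 + d)                                     ≤⟨ #-CrossEdge p r≤m big px≢py ⟩
      # (subs n) (CrossEdge? r p x y)                  ≤⟨ ∑-mono (subs n) pointwise ⟩
      ∑ (subs n) (λ e → ι ((miss? e ×-dec (x ∈? e)) ×-dec (y ∈? e)) + ι (through? x y e)) ≡⟨ ∑-+ (subs n) ⟩
      missAt₂ x y + # (subs n) (through? x y)          ≡⟨ cong (missAt₂ x y +_) (sym (codeg≡ x y)) ⟩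
      missAt₂ x y + codeg H x y                        ≤⟨ +-monoʳ-≤ (missAt₂ x y) (thin (px≢py ∘ cong p) ¬f) ⟩
      missAt₂ x y + D                                  ∎
      where
      pointwise : ∀ e → ι (CrossEdge? r p x y e) ≤ ι ((miss? e ×-dec (x ∈? e)) ×-dec (y ∈? e)) + ι (through? x y e)
      pointwise e = ι-⊎ (CrossEdge? r p x y e) ((miss? e ×-dec (x ∈? e)) ×-dec (y ∈? e)) (through? x y e) λ (tr , x∈ , y∈) →
        case E? e of λ where
          (yes e∈) → inj₂ (e∈ , x∈ , y∈)
          (no e∉)  → inj₁ (((tr , e∉) , x∈) , y∈)

    Light : Fin n → Fin n → Set
    Light u v = p u ≢ p v × ¬ fat u v

    light? : ∀ u v → Dec (Light u v)
    light? u v = ¬? (p u ≟ p v) ×-dec ¬? (fat? u v)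

    lightdeg : Fin n → ℕ
    lightdeg u = # V (light? u)

    -- Each light pair lies in at least `q` missing transversals, while a missing transversal
    -- contains `r * r` ordered pairs.
    light-total : ∀ {y₀ q} → (∀ j → y₀ ≤ size p j) → q + D ≤ y₀ ^ (1 + d) →
                  ∑ V lightdeg * q ≤ # (subs n) miss? * r * r
    light-total {y₀} {q} big q+D≤ = begin
      ∑ V lightdeg * q                                 ≡⟨ sym (Eq.trans (∑-cong V λ u → ∑-*ʳ V q) (∑-*ʳ V q)) ⟩
      ∑ V (λ u → ∑ V (λ v → ι (light? u v) * q))       ≤⟨ ∑-mono V (λ u → ∑-mono V λ v → pointwise u v (light? u v)) ⟩
      ∑ V (λ u → ∑ V (missAt₂ u))                      ≡⟨ ∑-missAt₂ ⟩
      # (subs n) miss? * r * r                         ∎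
      where
      pointwise : ∀ u v (l : Dec (Light u v)) → ι l * q ≤ missAt₂ u v
      pointwise u v (no _) = z≤n
      pointwise u v (yes (pu≢pv , ¬f)) = ≤-trans (≤-reflexive (+-identityʳ q))
        (+-cancelʳ-≤ D _ _ (≤-trans q+D≤ (cross-missing big pu≢pv ¬f)))

  -- The chain is `K + NT ≤ T ≤ |H| ≤ EC + X ≤ K + X`. Its two ends give `NT ≤ X`. As `EC` is at
  -- most the number of present transversals plus `NT`, at most `NT + X ≤ 2 * X` transversals are
  -- missing. The inequality `|H| ≤ T + X` gives near-optimality.
  structure : (∀ b → Composition m n b → esym r b ≤ ∣E∣ H) →
    ∃ λ (p : Fin n → Fin m) → NearOptimal r D m n (sizes p) × # (subs n) (Missing.miss? p) ≤ 2 * (D * (n * n))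
  structure H-large with p , bound ← clique-partition m fat fat? fat-sym (λ f → proj₁ f refl) no-fat-clique =
    p , near , missing
    where
    open Missing p
    K NT EC T X : ℕ
    K = # (subs n) clique?
    NT = # (subs n) (λ e → clique? e ×-dec ¬? (transversal? p e))
    EC = # (subs n) (λ e → E? e ×-dec clique? e)
    T = # (subs n) (TEdge? r p)
    X = D * (n * n)
    T≡ : T ≡ esym r (sizes p)
    T≡ = #-TEdge r p
    H≤EC : ∣E∣ H ≤ EC + X
    H≤EC = ≤-trans ∣E∣≤ edges-vs-cliques
    EC≤K : EC ≤ K
    EC≤K = #-mono (subs n) (λ e → E? e ×-dec clique? e) clique? (λ _ → proj₂)
    T≤H : T ≤ ∣E∣ H
    T≤H = ≤-trans (≤-reflexive T≡) (H-large (sizes p) (sizes-composition p))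
    near : NearOptimal r D m n (sizes p)
    near b ok = begin
      esym r b            ≤⟨ H-large b ok ⟩
      ∣E∣ H               ≤⟨ H≤EC ⟩
      EC + X              ≤⟨ +-monoˡ-≤ X (≤-trans EC≤K (≤-trans (m≤m+n K NT) bound)) ⟩
      T + X               ≡⟨ cong (_+ X) T≡ ⟩
      esym r (sizes p) + X ∎
    EC≤ : EC ≤ # (subs n) present? + NT
    EC≤ = ≤-trans (∑-mono (subs n) λ e → ι-⊎ (E? e ×-dec clique? e) (present? e) (clique? e ×-dec ¬? (transversal? p e)) λ (e∈ , cl) →
      case transversal? p e of λ where
        (yes tr) → inj₁ ((proj₁ cl , tr) , e∈)
        (no ¬tr) → inj₂ (cl , ¬tr)) (≤-reflexive (∑-+ (subs n)))
    NT≤X : NT ≤ X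
    NT≤X = +-cancelˡ-≤ K _ _ (≤-trans bound (≤-trans T≤H (≤-trans H≤EC (+-monoˡ-≤ X EC≤K))))
    missing : # (subs n) miss? ≤ 2 * X
    missing = +-cancelˡ-≤ (# (subs n) present?) _ _ (begin
      # (subs n) present? + # (subs n) miss?   ≡⟨ sym split-TEdge ⟩
      T                                        ≤⟨ ≤-trans T≤H H≤EC ⟩
      EC + X                                   ≤⟨ +-monoˡ-≤ X (≤-trans EC≤ (+-monoʳ-≤ _ NT≤X)) ⟩
      # (subs n) present? + X + X              ≡⟨ double (# (subs n) present?) X ⟩
      # (subs n) present? + 2 * X              ∎)
      where
      double : ∀ a x → a + x + x ≡ a + 2 * x
      double = solve-∀

-- Correcting the partition and bounding the number of edges

module Refinement {n : ℕ} (d s m : ℕ) (r≤m : 3 + d ≤ m) (H : Hypergraph n) (uniform : Uniform (3 + d) H)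
                  (berge-free : ¬ ContainsBerge (suc s) (suc m) H) (p : Fin n → Fin m) (q σ : ℕ) where

  open ≤-Reasoning
  open Counting d s m r≤m H uniform berge-free
  open Missing p using (Light; light?; lightdeg)

  Typical : Fin n → Set
  Typical v = lightdeg v < σ

  abstract
    typical? : Decidable Typical
    typical? v = lightdeg v <? σ

  Core : Fin m → Fin n → Set
  Core j v = p v ≡ j × Typical v

  abstract
    core? : ∀ j → Decidable (Core j)
    core? j v = (p v ≟ j) ×-dec typical? v

  atypical : ℕ
  atypical = # V (λ v → ¬? (typical? v))

  -- Markov's inequality for the light degree.
  atypical-few : atypical * σ ≤ ∑ V lightdeg
  atypical-few = begin
    atypical * σ                                    ≡⟨ sym (∑-*ʳ V σ) ⟩
    ∑ V (λ v → ι (¬? (typical? v)) * σ)             ≤⟨ ∑-mono V (λ v → pointwise v (typical? v)) ⟩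
    ∑ V lightdeg                                    ∎
    where
    pointwise : ∀ v (t : Dec (Typical v)) → ι (¬? t) * σ ≤ lightdeg v
    pointwise v (yes _) = z≤n
    pointwise v (no ¬t) = ≤-trans (≤-reflexive (+-identityʳ σ)) (≮⇒≥ ¬t)

  -- Vertices of distinct cores are chosen one by one; each excludes fewer than σ later candidates.
  pick-clique : 0 < σ → ∀ js {S : Fin n → Set} (S? : Decidable S) → Unique js →
    (∀ {j} → j ∈ js → length js * σ ≤ # V (λ v → core? j v ×-dec S? v)) →
    ∃ λ vs → length vs ≡ length js × All S vs × AllPairs fat vs
  pick-clique σ>0 [] S? _ _ = [] , refl , [] , []
  pick-clique σ>0 (j ∷ js) {S} S? (j∉ ∷ uniq) room
    with v , _ , (pv≡j , typ) , sv ← #-pos V (λ v → core? j v ×-dec S? v) (≤-trans (≤-trans σ>0 (m≤m+n σ _)) (room (here refl))) =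
    let vs , len , all , ps = pick-clique σ>0 js S′? uniq room′
    in v ∷ vs , cong suc len , sv ∷ All.map proj₁ all , All.map proj₂ all ∷ ps
    where
    S′? : Decidable (λ w → S w × fat v w)
    S′? w = S? w ×-dec fat? v w
    room′ : ∀ {j′} → j′ ∈ js → length js * σ ≤ # V (λ w → core? j′ w ×-dec S′? w)
    room′ {j′} j′∈ = +-cancelˡ-≤ σ _ _ (begin
      suc (length js) * σ                                        ≤⟨ room (there j′∈) ⟩
      # V (λ w → core? j′ w ×-dec S? w)                          ≤⟨ ∑-mono V pointwise ⟩
      ∑ V (λ w → ι (light? v w) + ι (core? j′ w ×-dec S′? w))    ≡⟨ ∑-+ V ⟩
      lightdeg v + # V (λ w → core? j′ w ×-dec S′? w)            ≤⟨ +-monoˡ-≤ _ (<⇒≤ typ) ⟩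
      σ + # V (λ w → core? j′ w ×-dec S′? w)                     ∎)
      where
      pointwise : ∀ w → ι (core? j′ w ×-dec S? w) ≤ ι (light? v w) + ι (core? j′ w ×-dec S′? w)
      pointwise w = ι-⊎ (core? j′ w ×-dec S? w) (light? v w) (core? j′ w ×-dec S′? w) λ (c , sw) → case fat? v w of λ where
        (yes f) → inj₂ (c , sw , f)
        (no ¬f) → inj₁ ((λ pv≡pw → All.lookup j∉ j′∈ (Eq.trans (sym pv≡j) (Eq.trans pv≡pw (proj₁ c)))) , ¬f)

  fat-core : Fin n → Fin m → ℕ
  fat-core x j = # V (λ v → core? j v ×-dec fat? x v)

  thin-core : Fin n → Fin m → ℕ
  thin-core x j = # V (λ v → core? j v ×-dec ¬? (fat? x v))

  module _ (σ>0 : 0 < σ) (mσ+σ≤q : m * σ + σ ≤ q) (big : ∀ j → 4 * q ≤ size p j) (W≤q : atypical ≤ q) where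

    core-big : ∀ j → 3 * q ≤ # V (core? j)
    core-big j = +-cancelʳ-≤ q _ _ (begin
      3 * q + q                                          ≡⟨ +-comm (3 * q) q ⟩
      4 * q                                              ≤⟨ big j ⟩
      size p j                                           ≤⟨ ∑-mono V pointwise ⟩
      ∑ V (λ v → ι (core? j v) + ι (¬? (typical? v)))    ≡⟨ ∑-+ V ⟩
      # V (core? j) + atypical                           ≤⟨ +-monoʳ-≤ _ W≤q ⟩
      # V (core? j) + q                                  ∎)
      where
      pointwise : ∀ v → ι (p v ≟ j) ≤ ι (core? j v) + ι (¬? (typical? v))
      pointwise v = ι-⊎ (p v ≟ j) (core? j v) (¬? (typical? v)) λ e → case typical? v of λ where
        (yes t) → inj₁ (e , t)
        (no ¬t) → inj₂ ¬t

    q<3q : q < 3 * q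
    q<3q = m<m+n q (≤-trans (≤-trans σ>0 (m≤n+m σ (m * σ))) (≤-trans mσ+σ≤q (m≤m+n q _)))

    abstract
      -- If `x` had more than `m * σ` fat neighbours in every core, a fat clique on `m` of them
      -- could be picked greedily, and with `x` it would be a fat `K_k`.
      assign : ∀ x → ∃ λ j → fat-core x j ≤ m * σ
      assign x with Finₚ.any? (λ j → fat-core x j ≤? m * σ)
      ... | yes found = found
      ... | no none =
        let vs , len , fx , ps = pick-clique σ>0 (allFin m) (fat? x) (Uniqueₚ.allFin⁺ m)
              (λ {j} _ → subst (λ l → l * σ ≤ fat-core x j) (sym (Listₚ.length-tabulate {n = m} id)) (≰⇒≥ λ le → none (j , le)))
        in contradiction (x ∷ vs , cong suc (Eq.trans len (Listₚ.length-tabulate {n = m} id)) , fx ∷ ps) no-fat-clique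

    p′ : Fin n → Fin m
    p′ x = proj₁ (assign x)

    -- A core other than its own has at least `3 * q` vertices, and a typical vertex is fat to all
    -- but fewer than `σ` of them. This exceeds the `m * σ` that `assign` permits.
    core⇒p′ : ∀ {v} → Typical v → p′ v ≡ p v
    core⇒p′ {v} typ with p′ v ≟ p v
    ... | yes e = e
    ... | no ne = contradiction (begin-strict
      q                                                  <⟨ q<3q ⟩
      3 * q                                              ≤⟨ core-big (p′ v) ⟩
      # V (core? (p′ v))                                 ≤⟨ ∑-mono V pointwise ⟩
      ∑ V (λ w → ι (core? (p′ v) w ×-dec fat? v w) + ι (light? v w)) ≡⟨ ∑-+ V ⟩
      fat-core v (p′ v) + lightdeg v                     ≤⟨ +-mono-≤ (proj₂ (assign v)) (<⇒≤ typ) ⟩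
      m * σ + σ                                          ≤⟨ mσ+σ≤q ⟩
      q                                                  ∎) (<-irrefl refl)
      where
      pointwise : ∀ w → ι (core? (p′ v) w) ≤ ι (core? (p′ v) w ×-dec fat? v w) + ι (light? v w)
      pointwise w = ι-⊎ (core? (p′ v) w) (core? (p′ v) w ×-dec fat? v w) (light? v w) λ c → case fat? v w of λ where
        (yes f) → inj₁ (c , f)
        (no ¬f) → inj₂ ((λ e → ne (sym (Eq.trans e (proj₁ c)))) , ¬f)

    core⊆p′ : ∀ {j v} → Core j v → p′ v ≡ j
    core⊆p′ (pv≡j , typ) = Eq.trans (core⇒p′ typ) pv≡j

    p′-big : ∀ j → 3 * q ≤ size p′ j
    p′-big j = ≤-trans (core-big j) (#-mono V (core? j) (λ v → p′ v ≟ j) λ _ → core⊆p′)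

    Bad : Fin n → Set
    Bad x = ∃ λ j → j ≢ p′ x × q < thin-core x j

    abstract
      bad? : Decidable Bad
      bad? x = Finₚ.any? λ j → ¬? (j ≟ p′ x) ×-dec (q <? thin-core x j)

    good-thin : ∀ {x j} → ¬ Bad x → j ≢ p′ x → thin-core x j ≤ q
    good-thin good j≢ = ≮⇒≥ λ lt → good (_ , j≢ , lt)

    -- In each of the `m - 1` other cores, `u` and `v` each exclude at most `q` of at least `3 * q`
    -- vertices. The remaining `q ≥ m * σ` allow a fat clique joined to both, in which only the pair
    -- `u`, `v` need not be fat.
    good-pair : ∀ {u v} → u ≢ v → p′ u ≡ p′ v → ¬ Bad u → ¬ Bad v → codeg H u v ≤ s
    good-pair {u} {v} u≢v e good-u good-v = ≮⇒≥ λ s< →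
      let vs , len , all , ps = pick-clique σ>0 js S? js-unique room
      in berge-free (berge H (Eq.trans (cong (2 +_) len) k≡) u≢v s< (All.map proj₁ all) (All.map proj₂ all) ps)
      where
      S? : Decidable (λ w → fat u w × fat v w)
      S? w = fat? u w ×-dec fat? v w
      others : ∀ {m} (i : Fin m) → ∃ λ js → suc (length js) ≡ m × Unique js × All (_≢ i) js
      others {suc m} i = map (punchIn i) (allFin m) ,
        cong suc (Eq.trans (Listₚ.length-map (punchIn i) (allFin m)) (Listₚ.length-tabulate id)) ,
        Uniqueₚ.map⁺ (Finₚ.punchIn-injective i _ _) (Uniqueₚ.allFin⁺ m) ,
        Allₚ.map⁺ (All.tabulate λ {j} _ → Finₚ.punchInᵢ≢i i j)
      js = proj₁ (others (p′ u))
      js-unique = proj₁ (proj₂ (proj₂ (others (p′ u))))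
      js-avoid = proj₂ (proj₂ (proj₂ (others (p′ u))))
      k≡ : 2 + length js ≡ suc m
      k≡ = cong suc (proj₁ (proj₂ (others (p′ u))))
      room : ∀ {j} → j ∈ js → length js * σ ≤ # V (λ w → core? j w ×-dec S? w)
      room {j} j∈ = begin
        length js * σ     ≤⟨ *-monoˡ-≤ σ (≤-trans (n≤1+n _) (≤-reflexive (proj₁ (proj₂ (others (p′ u)))))) ⟩
        m * σ             ≤⟨ ≤-trans (m≤m+n (m * σ) σ) mσ+σ≤q ⟩
        q                 ≤⟨ +-cancelʳ-≤ (q + q) _ _ (begin
            q + (q + q)           ≡⟨ triple q ⟩
            3 * q                 ≤⟨ core-big j ⟩
            # V (core? j)         ≤⟨ ∑-mono V pointwise ⟩
            ∑ V (λ w → ι (core? j w ×-dec S? w) + (ι (core? j w ×-dec ¬? (fat? u w)) + ι (core? j w ×-dec ¬? (fat? v w)))) ≡⟨ Eq.trans (∑-+ V) (cong (# V (λ w → core? j w ×-dec S? w) +_) (∑-+ V)) ⟩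
            # V (λ w → core? j w ×-dec S? w) + (thin-core u j + thin-core v j)
              ≤⟨ +-monoʳ-≤ (# V (λ w → core? j w ×-dec S? w)) (+-mono-≤ (good-thin good-u j≢) (good-thin good-v (λ e′ → j≢ (Eq.trans e′ (sym e))))) ⟩
            # V (λ w → core? j w ×-dec S? w) + (q + q) ∎) ⟩
        # V (λ w → core? j w ×-dec S? w) ∎
        where
        j≢ = All.lookup js-avoid j∈
        triple : ∀ q → q + (q + q) ≡ 3 * q
        triple = solve-∀
        pointwise : ∀ w → ι (core? j w) ≤ ι (core? j w ×-dec S? w) + (ι (core? j w ×-dec ¬? (fat? u w)) + ι (core? j w ×-dec ¬? (fat? v w)))
        pointwise w = ι-≤ (core? j w) λ c → case fat? u w , fat? v w of λ where
          (yes f , yes g) → ≤-trans (ι-≥1 (core? j w ×-dec S? w) (c , f , g)) (m≤m+n _ _)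
          (no ¬f , _) → ≤-trans (ι-≥1 (core? j w ×-dec ¬? (fat? u w)) (c , ¬f)) (≤-trans (m≤m+n _ _) (m≤n+m _ (ι (core? j w ×-dec S? w))))
          (_ , no ¬g) → ≤-trans (ι-≥1 (core? j w ×-dec ¬? (fat? v w)) (c , ¬g)) (≤-trans (m≤n+m _ (ι (core? j w ×-dec ¬? (fat? u w)))) (m≤n+m _ (ι (core? j w ×-dec S? w))))

    Clash : Fin n → Subset n → Set
    Clash x e = ∃ λ y → (y ≢ x × p′ y ≡ p′ x) × Through x y e

    abstract
      clash? : ∀ x → Decidable (Clash x)
      clash? x e = Finₚ.any? λ y → (¬? (y ≟ x) ×-dec (p′ y ≟ p′ x)) ×-dec through? x y e

    N : ℕ
    N = n ^ (1 + d)

    codeg≤N : ∀ {x y} → x ≢ y → codeg H x y ≤ N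
    codeg≤N {x} {y} x≢y = begin
      codeg H x y                 ≡⟨ codeg≡ x y ⟩
      # (subs n) (through? x y)
        ≤⟨ #-mono (subs n) (through? x y) (λ e → (∣ e ∣ ℕₚ.≟ 1 + d + 2) ×-dec ((x ∈? e) ×-dec (y ∈? e)))
             (λ e (e∈ , xy) → Eq.trans (edge-size e∈) (cong suc (+-comm 2 d)) , xy) ⟩
      # (subs n) (λ e → (∣ e ∣ ℕₚ.≟ 1 + d + 2) ×-dec ((x ∈? e) ×-dec (y ∈? e)))
        ≤⟨ #-containing-pair (1 + d) x≢y ⟩
      N ∎

    -- A vertex `y` in the part of `x` may share up to `N` edges with `x` only if it is atypical or
    -- one of the at most `m * σ` fat core neighbours. All others share at most `D`.
    clash-few : ∀ x → # (subs n) (clash? x) ≤ (atypical + m * σ) * N + n * D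
    clash-few x = begin
      # (subs n) (clash? x)
        ≤⟨ ∑-mono (subs n) (λ e → ι-≤ (clash? x e) λ (y , c) → #-∈ (λ y → at? y e) (∈ₚ.∈-allFin y) c) ⟩
      ∑ (subs n) (λ e → # V (λ y → at? y e))
        ≡⟨ ∑-swap (subs n) V ⟩
      ∑ V (λ y → # (subs n) (at? y))
        ≤⟨ ∑-mono V (λ y → pointwise y (y ≟ x) (p′ y ≟ p′ x) (typical? y) (fat? x y)) ⟩
      ∑ V (λ y → (ι (¬? (typical? y)) + ι (core? (p′ x) y ×-dec fat? x y)) * N + D)
        ≡⟨ ∑-+ V ⟩
      ∑ V (λ y → (ι (¬? (typical? y)) + ι (core? (p′ x) y ×-dec fat? x y)) * N) + ∑ V (λ _ → D)
        ≡⟨ cong₂ _+_ (Eq.trans (∑-*ʳ V N) (cong (_* N) (∑-+ V))) (Eq.trans (∑-const V D) (cong (_* D) (Listₚ.length-tabulate {n = n} id))) ⟩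
      (atypical + fat-core x (p′ x)) * N + n * D
        ≤⟨ +-monoˡ-≤ (n * D) (*-monoˡ-≤ N (+-monoʳ-≤ atypical (proj₂ (assign x)))) ⟩
      (atypical + m * σ) * N + n * D ∎
      where
      at? : ∀ y e → Dec ((y ≢ x × p′ y ≡ p′ x) × Through x y e)
      at? y e = (¬? (y ≟ x) ×-dec (p′ y ≟ p′ x)) ×-dec through? x y e
      at≤codeg : ∀ y → # (subs n) (at? y) ≤ codeg H x y
      at≤codeg y = ≤-trans (#-mono (subs n) (at? y) (through? x y) (λ _ → proj₂)) (≤-reflexive (sym (codeg≡ x y)))
      pointwise : ∀ y → Dec (y ≡ x) → Dec (p′ y ≡ p′ x) → Dec (Typical y) → Dec (fat x y) →
                  # (subs n) (at? y) ≤ (ι (¬? (typical? y)) + ι (core? (p′ x) y ×-dec fat? x y)) * N + D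
      pointwise y (yes y≡x) _ _ _ = ≤-trans (≤-reflexive (#-none (subs n) (at? y) λ e ((y≢x , _) , _) → y≢x y≡x)) z≤n
      pointwise y _ (no ne) _ _   = ≤-trans (≤-reflexive (#-none (subs n) (at? y) λ e ((_ , eq) , _) → ne eq)) z≤n
      pointwise y (no y≢x) _ (no ¬t) _ = begin
        # (subs n) (at? y)   ≤⟨ ≤-trans (at≤codeg y) (codeg≤N (y≢x ∘ sym)) ⟩
        N                    ≡⟨ sym (*-identityˡ N) ⟩
        1 * N                ≤⟨ *-monoˡ-≤ N (≤-trans (ι-≥1 (¬? (typical? y)) ¬t) (m≤m+n _ _)) ⟩
        (ι (¬? (typical? y)) + ι (core? (p′ x) y ×-dec fat? x y)) * N       ≤⟨ m≤m+n _ D ⟩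
        (ι (¬? (typical? y)) + ι (core? (p′ x) y ×-dec fat? x y)) * N + D   ∎
      pointwise y (no y≢x) (yes eq) (yes t) (yes f) = begin
        # (subs n) (at? y)   ≤⟨ ≤-trans (at≤codeg y) (codeg≤N (y≢x ∘ sym)) ⟩
        N                    ≡⟨ sym (*-identityˡ N) ⟩
        1 * N                ≤⟨ *-monoˡ-≤ N (≤-trans (ι-≥1 (core? (p′ x) y ×-dec fat? x y) ((Eq.trans (sym (core⇒p′ t)) eq , t) , f)) (m≤n+m _ (ι (¬? (typical? y))))) ⟩
        (ι (¬? (typical? y)) + ι (core? (p′ x) y ×-dec fat? x y)) * N       ≤⟨ m≤m+n _ D ⟩
        (ι (¬? (typical? y)) + ι (core? (p′ x) y ×-dec fat? x y)) * N + D   ∎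
      pointwise y (no y≢x) (yes eq) (yes t) (no ¬f) = ≤-trans (at≤codeg y) (≤-trans (thin (y≢x ∘ sym) ¬f) (m≤n+m D _))

    open Missing p′ using (miss?; Miss; missAt; missAt₂; ∑-missAt; cross-missing; split-TEdge; present?)

    -- Each of the more than `q` non-fat core vertices in part `j` gives `M` missing transversals
    -- through `x`. A transversal has only one vertex in part `j`, so these families are disjoint.
    bad-missing : ∀ {M x} → M + D ≤ (3 * q) ^ (1 + d) → Bad x → q * M ≤ missAt x
    bad-missing {M} {x} M≤ (j , j≢ , many) = begin
      q * M                                                    ≤⟨ *-monoˡ-≤ M (<⇒≤ many) ⟩
      thin-core x j * M                                        ≡⟨ sym (∑-*ʳ V M) ⟩
      ∑ V (λ v → ι (core? j v ×-dec ¬? (fat? x v)) * M)        ≤⟨ ∑-mono V (λ v → ι-*ˡ (core? j v ×-dec ¬? (fat? x v)) λ (c , ¬f) →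
                                                                    +-cancelʳ-≤ D _ _ (≤-trans M≤ (cross-missing p′-big (λ e → j≢ (sym (Eq.trans e (core⊆p′ c)))) ¬f))) ⟩
      ∑ V (λ v → ι (core? j v ×-dec ¬? (fat? x v)) * missAt₂ x v)
        ≡⟨ ∑-cong V (λ v → Eq.trans (sym (∑-*ˡ (subs n) (ι (core? j v ×-dec ¬? (fat? x v))))) (∑-cong (subs n) λ e → sym (ι-* (core? j v ×-dec ¬? (fat? x v)) _))) ⟩
      ∑ V (λ v → # (subs n) (hit? v))                          ≡⟨ ∑-swap V (subs n) ⟩
      ∑ (subs n) (λ e → # V (λ v → hit? v e))
        ≤⟨ ∑-mono (subs n) (λ e → #-≤ι (λ v → hit? v e) (miss? e ×-dec (x ∈? e)) (Uniqueₚ.allFin⁺ n)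
             (λ v w ((c , _) , ((((_ , tr) , _) , _) , v∈)) ((c′ , _) , (_ , w∈)) → tr v w v∈ w∈ (Eq.trans (core⊆p′ c) (sym (core⊆p′ c′))))
             (λ v (_ , (me , _)) → me)) ⟩
      missAt x ∎
      where
      hit? : ∀ v e → Dec ((Core j v × ¬ fat x v) × ((Miss e × x ∈ₛ e) × v ∈ₛ e))
      hit? v e = (core? j v ×-dec ¬? (fat? x v)) ×-dec ((miss? e ×-dec (x ∈? e)) ×-dec (v ∈? e))

    clashes : ℕ
    clashes = ∑ V (λ x → ι (bad? x) * # (subs n) (clash? x))

    -- A missing transversal may be charged by all of its `r` vertices, hence the factor `r` in the
    -- hypothesis: a bad vertex misses `r` times as many transversals as it has clashing edges.
    clashes≤missing : ∀ {M} → M + D ≤ (3 * q) ^ (1 + d) → r * ((atypical + m * σ) * N + n * D) ≤ q * M →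
                      clashes ≤ # (subs n) miss?
    clashes≤missing {M} M≤ small = *-cancelʳ-≤ _ _ r (begin
      clashes * r                                              ≡⟨ sym (∑-*ʳ V r) ⟩
      ∑ V (λ x → ι (bad? x) * # (subs n) (clash? x) * r)       ≤⟨ ∑-mono V (λ x → pointwise x (bad? x)) ⟩
      ∑ V missAt                                               ≡⟨ ∑-missAt ⟩
      # (subs n) miss? * r                                     ∎)
      where
      pointwise : ∀ x (b : Dec (Bad x)) → ι b * # (subs n) (clash? x) * r ≤ missAt x
      pointwise x (no _)  = z≤n
      pointwise x (yes b) = begin
        1 * # (subs n) (clash? x) * r                ≡⟨ rearrange (# (subs n) (clash? x)) r ⟩
        r * # (subs n) (clash? x)                    ≤⟨ *-monoʳ-≤ r (clash-few x) ⟩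
        r * ((atypical + m * σ) * N + n * D)         ≤⟨ small ⟩
        q * M                                        ≤⟨ bad-missing M≤ b ⟩
        missAt x                                     ∎
        where
        rearrange : ∀ c r → 1 * c * r ≡ r * c
        rearrange = solve-∀

    -- An edge is a transversal of `p′`, contains an inner pair of good vertices, or clashes at a
    -- bad vertex. The last kind is paid for by the missing transversals, which completes the
    -- present ones to all transversals.
    edges≤ : clashes ≤ # (subs n) miss? → ∣E∣ H ≤ φ r s (sizes p′)
    edges≤ clash≤ = begin
      ∣E∣ H                    ≤⟨ ∣E∣≤ ⟩
      # (subs n) E?            ≤⟨ ∑-mono (subs n) classify ⟩
      ∑ (subs n) (λ e → ι (present? e) + (∑ V (λ x → # V (λ y → good? x y e)) + # V (λ x → bad? x ×-dec clash? x e)))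
        ≡⟨ Eq.trans (∑-+ (subs n)) (cong (# (subs n) present? +_) (∑-+ (subs n))) ⟩
      # (subs n) present? + (∑ (subs n) (λ e → ∑ V (λ x → # V (λ y → good? x y e))) + ∑ (subs n) (λ e → # V (λ x → bad? x ×-dec clash? x e)))
        ≤⟨ +-monoʳ-≤ (# (subs n) present?) (+-mono-≤ goods bads) ⟩
      # (subs n) present? + (s * ∑ (sizes p′) tri + # (subs n) miss?)
        ≡⟨ rearrange (# (subs n) present?) (s * ∑ (sizes p′) tri) (# (subs n) miss?) ⟩
      # (subs n) present? + # (subs n) miss? + s * ∑ (sizes p′) tri
        ≡⟨ cong (_+ s * ∑ (sizes p′) tri) (Eq.trans (sym split-TEdge) (#-TEdge r p′)) ⟩
      φ r s (sizes p′) ∎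
      where
      rearrange : ∀ a b c → a + (b + c) ≡ a + c + b
      rearrange = solve-∀
      Good : Fin n → Fin n → Subset n → Set
      Good x y e = (SamePair p′ x y × ¬ Bad x × ¬ Bad y) × Through x y e
      good? : ∀ x y → Decidable (Good x y)
      good? x y e = (samePair? p′ x y ×-dec ¬? (bad? x) ×-dec ¬? (bad? y)) ×-dec through? x y e
      goods : ∑ (subs n) (λ e → ∑ V (λ x → # V (λ y → good? x y e))) ≤ s * ∑ (sizes p′) tri
      goods = begin
        ∑ (subs n) (λ e → ∑ V (λ x → # V (λ y → good? x y e)))
          ≡⟨ Eq.trans (∑-swap (subs n) V) (∑-cong V λ x → ∑-swap (subs n) V) ⟩
        ∑ V (λ x → ∑ V (λ y → # (subs n) (good? x y)))
          ≤⟨ ∑-mono V (λ x → ∑-mono V λ y → few x y (samePair? p′ x y) (bad? x) (bad? y)) ⟩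
        ∑ V (λ x → ∑ V (λ y → ι (samePair? p′ x y) * s))
          ≡⟨ Eq.trans (∑-cong V λ x → ∑-*ʳ V s) (∑-*ʳ V s) ⟩
        ∑ V (λ x → # V (samePair? p′ x)) * s
          ≡⟨ Eq.trans (cong (_* s) (#-samePairs p′)) (*-comm _ s) ⟩
        s * ∑ (sizes p′) tri ∎
        where
        few : ∀ x y → (sp : Dec (SamePair p′ x y)) → Dec (Bad x) → Dec (Bad y) → # (subs n) (good? x y) ≤ ι sp * s
        few x y (no ¬sp) _ _ = ≤-trans (≤-reflexive (#-none (subs n) (good? x y) λ e ((sp , _) , _) → ¬sp sp)) z≤n
        few x y (yes _) (yes b) _ = ≤-trans (≤-reflexive (#-none (subs n) (good? x y) λ e ((_ , ¬b , _) , _) → ¬b b)) z≤n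
        few x y (yes _) _ (yes b) = ≤-trans (≤-reflexive (#-none (subs n) (good? x y) λ e ((_ , _ , ¬b) , _) → ¬b b)) z≤n
        few x y (yes (x<y , eq)) (no ¬bx) (no ¬by) = begin
          # (subs n) (good? x y)     ≤⟨ #-mono (subs n) (good? x y) (through? x y) (λ _ → proj₂) ⟩
          # (subs n) (through? x y)  ≡⟨ sym (codeg≡ x y) ⟩
          codeg H x y                ≤⟨ good-pair (λ x≡y → Finₚ.<-irrefl x≡y x<y) eq ¬bx ¬by ⟩
          s                          ≡⟨ sym (*-identityˡ s) ⟩
          1 * s                      ∎
      bads : ∑ (subs n) (λ e → # V (λ x → bad? x ×-dec clash? x e)) ≤ # (subs n) miss?
      bads = ≤-trans (≤-reflexive (Eq.trans (∑-swap (subs n) V)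
        (∑-cong V λ x → Eq.trans (∑-cong (subs n) λ e → ι-* (bad? x) (clash? x e)) (∑-*ˡ (subs n) (ι (bad? x)))))) clash≤
      classify : ∀ e → ι (E? e) ≤ ι (present? e) + (∑ V (λ x → # V (λ y → good? x y e)) + # V (λ x → bad? x ×-dec clash? x e))
      classify e = ι-≤ (E? e) λ e∈ → case some-pair? of λ where
          (no none) → ≤-trans (ι-≥1 (present? e) ((edge-size e∈ , λ u v u∈ v∈ eq → transversal none u∈ v∈ eq (u ≟ v)) , e∈)) (m≤m+n _ _)
          (yes (u , v , u<v , eq , u∈ , v∈)) → ≤-trans (pair e∈ u<v eq u∈ v∈ (bad? u) (bad? v)) (m≤n+m _ (ι (present? e)))
        where
        some-pair? : Dec (∃ λ u → ∃ λ v → u <ᶠ v × p′ u ≡ p′ v × u ∈ₛ e × v ∈ₛ e)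
        some-pair? = Finₚ.any? λ u → Finₚ.any? λ v → (u Finₚ.<? v) ×-dec (p′ u ≟ p′ v) ×-dec (u ∈? e) ×-dec (v ∈? e)
        transversal : ¬ (∃ λ u → ∃ λ v → u <ᶠ v × p′ u ≡ p′ v × u ∈ₛ e × v ∈ₛ e) →
                      ∀ {u v} → u ∈ₛ e → v ∈ₛ e → p′ u ≡ p′ v → Dec (u ≡ v) → u ≡ v
        transversal none u∈ v∈ eq (yes u≡v) = u≡v
        transversal none {u} {v} u∈ v∈ eq (no u≢v) with Finₚ.<-cmp u v
        ... | tri< l _ _ = contradiction (u , v , l , eq , u∈ , v∈) none
        ... | tri≈ _ u≡v _ = u≡v
        ... | tri> _ _ g = contradiction (v , u , g , sym eq , v∈ , u∈) none
        pair : E e → ∀ {u v} → u <ᶠ v → p′ u ≡ p′ v → u ∈ₛ e → v ∈ₛ e → Dec (Bad u) → Dec (Bad v) →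
               1 ≤ ∑ V (λ x → # V (λ y → good? x y e)) + # V (λ x → bad? x ×-dec clash? x e)
        pair e∈ {u} {v} u<v eq u∈ v∈ (yes bu) _ = ≤-trans
          (#-∈ (λ x → bad? x ×-dec clash? x e) (∈ₚ.∈-allFin u) (bu , v , ((λ v≡u → Finₚ.<-irrefl (sym v≡u) u<v) , sym eq) , e∈ , u∈ , v∈)) (m≤n+m _ _)
        pair e∈ {u} {v} u<v eq u∈ v∈ _ (yes bv) = ≤-trans
          (#-∈ (λ x → bad? x ×-dec clash? x e) (∈ₚ.∈-allFin v) (bv , u , ((λ u≡v → Finₚ.<-irrefl u≡v u<v) , eq) , e∈ , v∈ , u∈)) (m≤n+m _ _)
        pair e∈ {u} {v} u<v eq u∈ v∈ (no ¬bu) (no ¬bv) = ≤-trans (≤-trans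
          (#-∈ (λ y → good? u y e) (∈ₚ.∈-allFin v) (((u<v , eq) , ¬bu , ¬bv) , e∈ , u∈ , v∈))
          (∑-∈ (λ x → # V (λ y → good? x y e)) (∈ₚ.∈-allFin u))) (m≤m+n _ _)

-- Choice of constants

m≤m^[1+d] : ∀ {a} d → 1 ≤ a → a ≤ a ^ (1 + d)
m≤m^[1+d] {a} d a≥1 = m≤m*n a (a ^ d) {{m^n≢0 a d {{>-nonZero a≥1}}}}

m≤n*σ : ∀ {a b σ} → 0 < σ → a ≤ b → a ≤ b * σ
m≤n*σ {a} {b} {σ} σ>0 a≤b = ≤-trans a≤b (m≤m*n b σ {{>-nonZero σ>0}})

module Constants (d s m K : ℕ) where

  r D C₁ C₂ C₀ : ℕ
  r = 3 + d
  D = suc s + (suc m C 2) * suc s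
  -- `C₁ * n` bounds the total light degree: at most `2 * D * n²` missing transversals, times `r²`,
  -- divided by `q ≥ n / K`. `C₂` collects the factors in `few-clashes`, and `C₀` dominates every
  -- constant that has to satisfy an inequality against `q`.
  C₁ = 2 * D * K * r * r
  C₂ = r * ((C₁ + m) * K ^ (1 + d) + K * D)
  C₀ = C₁ + (m + 1) + D + C₂

  module _ {q σ : ℕ} (σ>0 : 0 < σ) (Cσ≤q : C₀ * σ ≤ q) where

    C₁σ≤q : C₁ * σ ≤ q
    C₁σ≤q = ≤-trans (*-monoˡ-≤ σ (≤-trans (m≤m+n C₁ (m + 1)) (≤-trans (m≤m+n _ D) (m≤m+n _ C₂)))) Cσ≤q

    mσ+σ≤q : m * σ + σ ≤ q
    mσ+σ≤q = ≤-trans (≤-reflexive (expand m σ)) (≤-trans (*-monoˡ-≤ σ (≤-trans (m≤n+m (m + 1) C₁) (≤-trans (m≤m+n _ D) (m≤m+n _ C₂)))) Cσ≤q)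
      where
      expand : ∀ m σ → m * σ + σ ≡ (m + 1) * σ
      expand = solve-∀

    D≤q : D ≤ q
    D≤q = ≤-trans (m≤n*σ σ>0 (≤-trans (m≤n+m D (C₁ + (m + 1))) (m≤m+n _ C₂))) Cσ≤q

    C₂σ≤q : C₂ * σ ≤ q
    C₂σ≤q = ≤-trans (*-monoˡ-≤ σ (m≤n+m C₂ (C₁ + (m + 1) + D))) Cσ≤q

    q≥1 : 1 ≤ q
    q≥1 = ≤-trans (s≤s z≤n) D≤q

    4q≤ : 4 * q ≤ (4 * q) ^ (1 + d)
    4q≤ = m≤m^[1+d] d (≤-trans q≥1 (m≤n*m q 4))

    q+D≤ : q + D ≤ (4 * q) ^ (1 + d)
    q+D≤ = ≤-trans (+-monoʳ-≤ q (≤-trans D≤q (m≤m+n q (q + (q + 0))))) 4q≤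

    qᵈ+D≤ : q ^ (1 + d) + D ≤ (3 * q) ^ (1 + d)
    qᵈ+D≤ = begin
      Y + D                    ≤⟨ +-monoʳ-≤ Y (≤-trans D≤q (m≤m^[1+d] d q≥1)) ⟩
      Y + Y                    ≤⟨ +-monoʳ-≤ Y (m≤m+n Y (Y + 0)) ⟩
      3 * Y                    ≤⟨ *-monoˡ-≤ Y (m≤m^[1+d] {3} d (s≤s z≤n)) ⟩
      3 ^ (1 + d) * Y          ≡⟨ sym (^-distribʳ-* (1 + d) 3 q) ⟩
      (3 * q) ^ (1 + d)        ∎
      where
      open ≤-Reasoning
      Y = q ^ (1 + d)

    -- With `n ≤ K * q` the left side is a constant times `σ * q ^ (r - 2)`, so `C₂ * σ ≤ q`
    -- suffices.
    few-clashes : ∀ {n w} → n ≤ K * q → w ≤ C₁ * σ → r * ((w + m * σ) * n ^ (1 + d) + n * D) ≤ q * q ^ (1 + d)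
    few-clashes {n} {w} n≤ w≤ = begin
      r * ((w + m * σ) * n ^ (1 + d) + n * D)
        ≤⟨ *-monoʳ-≤ r (+-mono-≤ (*-mono-≤ (+-monoˡ-≤ (m * σ) w≤) (≤-trans (^-monoˡ-≤ (1 + d) n≤) (≤-reflexive (^-distribʳ-* (1 + d) K q))))
                                 (*-monoˡ-≤ D (≤-trans n≤ (*-monoʳ-≤ K (m≤n*σ σ>0 (m≤m^[1+d] d q≥1)))))) ⟩
      r * ((C₁ * σ + m * σ) * (Z * Y) + K * (Y * σ) * D)
        ≡⟨ rearrange r C₁ σ m Z Y K D ⟩
      C₂ * σ * Y        ≤⟨ *-monoˡ-≤ Y C₂σ≤q ⟩
      q * Y             ∎
      where
      open ≤-Reasoning
      Z = K ^ (1 + d)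
      Y = q ^ (1 + d)
      rearrange : ∀ r c σ m Z Y K D → r * ((c * σ + m * σ) * (Z * Y) + K * (Y * σ) * D) ≡ r * ((c + m) * Z + K * D) * σ * Y
      rearrange = solve-∀

-- σ is about √n and q = Θ(n): every error term is a constant times σ, hence eventually below q.
upper-bound : ∀ {d s m K n q σ b} → let open Constants d s m K in 3 + d ≤ m →
  0 < σ → n ≤ σ * σ → n ≤ K * q → C₀ * σ ≤ q →
  (∀ b → Composition m n b → NearOptimal (3 + d) D m n b → All (4 * q ≤_) b) →
  Optimal (3 + d) s m n b →
  (H : Hypergraph n) → Uniform (3 + d) H → ¬ ContainsBerge (suc s) (suc m) H → ∣E∣ H ≤ φ (3 + d) s b
upper-bound {d} {s} {m} {K} {n} {q} {σ} {b} r≤m σ>0 n≤σσ n≤Kq Cσ≤q large opt H uniform free with ∣E∣ H ≤? φ (3 + d) s b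
... | yes done = done
-- Here `H` has more edges than the optimum, which supplies the hypothesis of `structure`; the bound
-- is then derived all the same.
... | no many = ≤-trans
  (edges≤ σ>0 (mσ+σ≤q σ>0 Cσ≤q) big W≤q (clashes≤missing σ>0 (mσ+σ≤q σ>0 Cσ≤q) big W≤q (qᵈ+D≤ σ>0 Cσ≤q) (few-clashes σ>0 Cσ≤q n≤Kq W≤)))
  (opt (sizes (p′ σ>0 (mσ+σ≤q σ>0 Cσ≤q) big W≤q)) (sizes-composition (p′ σ>0 (mσ+σ≤q σ>0 Cσ≤q) big W≤q)))
  where
  open ≤-Reasoning
  open Constants d s m K hiding (r; D)
  open Counting d s m r≤m H uniform free using (r; D; structure; V; module Missing)
  found = structure λ b′ ok → ≤-trans (m≤m+n _ _) (≤-trans (opt b′ ok) (≰⇒≥ many))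
  p = proj₁ found
  open Refinement d s m r≤m H uniform free p q σ
  open Missing p using (miss?; lightdeg; light-total)
  big : ∀ j → 4 * q ≤ size p j
  big = Allₚ.tabulate⁻ (large (sizes p) (sizes-composition p) (proj₁ (proj₂ found)))
  Λ = ∑ V lightdeg
  Λ≤ : Λ ≤ C₁ * n
  Λ≤ = *-cancelʳ-≤ Λ (C₁ * n) q {{>-nonZero (q≥1 σ>0 Cσ≤q)}} (begin
    Λ * q                              ≤⟨ light-total big (q+D≤ σ>0 Cσ≤q) ⟩
    # (subs n) miss? * r * r           ≤⟨ *-monoˡ-≤ r (*-monoˡ-≤ r (proj₂ (proj₂ found))) ⟩
    2 * (D * (n * n)) * r * r          ≤⟨ *-monoˡ-≤ r (*-monoˡ-≤ r (*-monoʳ-≤ 2 (*-monoʳ-≤ D (*-monoʳ-≤ n n≤Kq)))) ⟩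
    2 * (D * (n * (K * q))) * r * r    ≡⟨ rearrange D n K q r ⟩
    2 * D * K * r * r * n * q          ∎)
    where
    rearrange : ∀ D n K q r → 2 * (D * (n * (K * q))) * r * r ≡ 2 * D * K * r * r * n * q
    rearrange = solve-∀
  W≤ : atypical ≤ C₁ * σ
  W≤ = *-cancelʳ-≤ atypical (C₁ * σ) σ {{>-nonZero σ>0}} (begin
    atypical * σ      ≤⟨ atypical-few ⟩
    Λ                 ≤⟨ Λ≤ ⟩
    C₁ * n            ≤⟨ *-monoʳ-≤ C₁ n≤σσ ⟩
    C₁ * (σ * σ)      ≡⟨ sym (*-assoc C₁ σ σ) ⟩
    C₁ * σ * σ        ∎)
  W≤q : atypical ≤ q
  W≤q = ≤-trans W≤ (C₁σ≤q σ>0 Cσ≤q)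

root : ∀ n → ∃ λ a → a * a ≤ n × n < suc a * suc a
root zero    = 0 , z≤n , s≤s z≤n
root (suc n) with a , lo , hi ← root n with suc a * suc a ≤? suc n
... | yes le = suc a , le , ≤-<-trans hi (*-mono-< (n<1+n (suc a)) (n<1+n (suc a)))
... | no ¬le = a , m≤n⇒m≤1+n lo , ≰⇒> ¬le

scale : ∀ C₀ K {n q} → (1 + 2 * (C₀ * K)) * (1 + 2 * (C₀ * K)) ≤ n → n ≤ K * q →
        ∃ λ σ → 0 < σ × n ≤ σ * σ × C₀ * σ ≤ q
scale C₀ K {n} {q} n≥ n≤Kq with a , a²≤n , n<σ² ← root n = suc a , z<s , <⇒≤ n<σ² ,
  *-cancelˡ-≤ K {{K≢0 K n≤Kq}} (begin
    K * (C₀ * suc a)       ≡⟨ rearrange K C₀ (suc a) ⟩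
    C₀ * K * suc a         ≤⟨ *-monoʳ-≤ (C₀ * K) (+-monoˡ-≤ a (≤-trans (s≤s z≤n) β≤a)) ⟩
    C₀ * K * (a + a)       ≡⟨ double (C₀ * K) a ⟩
    2 * (C₀ * K) * a       ≤⟨ *-monoˡ-≤ a (≤-trans (n≤1+n _) β≤a) ⟩
    a * a                 ≤⟨ a²≤n ⟩
    n                     ≤⟨ n≤Kq ⟩
    K * q                 ∎)
  where
  open ≤-Reasoning
  -- From `β * β ≤ n` follows `a ≥ β > 2 * (C₀ * K)`, whence `C₀ * K * (a + 1) ≤ a * a ≤ n ≤ K * q`.
  β = 1 + 2 * (C₀ * K)
  β≤a : β ≤ a
  β≤a = ≮⇒≥ λ a<β → <-irrefl refl (≤-trans n<σ² (≤-trans (*-mono-≤ a<β a<β) n≥))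
  K≢0 : ∀ K → n ≤ K * q → NonZero K
  K≢0 zero    n≤0 = contradiction (≤-trans n≥ n≤0) λ ()
  K≢0 (suc K) _   = _
  rearrange : ∀ K C₀ x → K * (C₀ * x) ≡ C₀ * K * x
  rearrange = solve-∀
  double : ∀ c a → c * (a + a) ≡ 2 * c * a
  double = solve-∀

threshold : ∀ C₀ K → ∃ λ N → ∀ n q → N ≤ n → n ≤ K * q → ∃ λ σ → 0 < σ × n ≤ σ * σ × C₀ * σ ≤ q
threshold C₀ K = (1 + 2 * (C₀ * K)) * (1 + 2 * (C₀ * K)) , λ n q → scale C₀ K

-- The extremal hypergraph and the conclusion

two-parts-first : ∀ {n m} (p : Fin n → Fin m) {i j} → i ≢ j → ∃ λ zs → sizes p ↭ size p i ∷ size p j ∷ zs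
two-parts-first {m = m} p {i} {j} i≢j with js , all↭ ← ∈⇒↭ (∈ₚ.∈-allFin i) with ↭ₚ.∈-resp-↭ all↭ (∈ₚ.∈-allFin j)
... | here j≡i = contradiction (sym j≡i) i≢j
... | there j∈ with ks , js↭ ← ∈⇒↭ j∈ = map (size p) ks ,
  subst (_↭ size p i ∷ size p j ∷ map (size p) ks) (Listₚ.map-tabulate id (size p)) (↭ₚ.map⁺ (size p) (trans all↭ (prep i js↭)))

optimal-partition-balanced : ∀ {d s n m y} (p : Fin n → Fin m) → 3 + d ≤ m → Optimal (3 + d) s m n (sizes p) →
  s < y → All (y ≤_) (sizes p) → Balanced p
optimal-partition-balanced {y = y} p r≤m opt s<y large j j′ rewrite partSize≡size p j | partSize≡size p j′ with j ≟ j′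
... | yes refl = m≤m+n _ 1
... | no j≢j′  = optimal⇒balanced {y = y} r≤m (sizes-composition p) opt s<y large (proj₂ (two-parts-first p j≢j′))

-- A Berge copy is in particular a heavy copy. So heavy-freeness of `Q` gives both lower bounds, and
-- the upper bound for Berge-free hypergraphs covers the heavy-free ones.
extremal : ∀ {d s m K n q σ} → let open Constants d s (suc m) K in 3 + d ≤ suc m →
  0 < σ → n ≤ σ * σ → n ≤ K * q → C₀ * σ ≤ q →
  (∀ b → Composition (suc m) n b → NearOptimal (3 + d) D (suc m) n b → All (4 * q ≤_) b) →
  Σ (Hypergraph n) λ Q → IsQ (3 + d) (suc s) (suc m) Q ×
    ExEq (3 + d) n (ContainsBerge (suc s) (2 + m)) (∣E∣ Q) ×
    ExEq (3 + d) n (ContainsHeavy (suc s) (2 + m)) (∣E∣ Q)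
extremal {d} {s} {m} {K} {n} {q} {σ} r≤m σ>0 n≤σσ n≤Kq Cσ≤q large
  with b , b-ok , opt ← optimal-exists (3 + d) s m n
  with p , refl ← partition {b = b} b-ok =
  Q , Q-isQ (optimal-partition-balanced {y = 4 * q} p r≤m opt s<4q sizes≥) ,
  ((Q , Q-uniform , (λ (F , F⊑Q , copy) → Q-heavy-free ≤-refl (F , F⊑Q , BergeCopy.heavy copy)) , refl) , upper) ,
  ((Q , Q-uniform , Q-heavy-free ≤-refl , refl) ,
   λ H uniform free → upper H uniform λ (F , F⊑H , copy) → free (F , F⊑H , BergeCopy.heavy copy))
  where
  open Constants d s (suc m) K using (D; D≤q; 4q≤)
  s<4q : s < 4 * q
  s<4q = ≤-trans (≤-trans (m≤m+n (suc s) _) (D≤q σ>0 Cσ≤q)) (m≤n*m q 4)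
  sizes≥ : All (4 * q ≤_) (sizes p)
  sizes≥ = large (sizes p) (sizes-composition p)
    (optimal⇒near-optimal {c = D} {b = sizes p} (≤-trans (n≤1+n s) (m≤m+n (suc s) _)) (sizes-composition p) opt)
  pair-edges : ∀ {u v} → SamePair p u v → s ≤ # (subs n) (PairEdge? (3 + d) p u v)
  pair-edges (u<v , pu≡pv) = ≤-trans (<⇒≤ s<4q) (≤-trans (4q≤ σ>0 Cσ≤q)
    (#-PairEdge p r≤m (Allₚ.tabulate⁻ sizes≥) (λ u≡v → Finₚ.<-irrefl u≡v u<v) pu≡pv))
  open Construction d s p pair-edges
  upper : (H : Hypergraph n) → Uniform (3 + d) H → ¬ ContainsBerge (suc s) (2 + m) H → ∣E∣ H ≤ ∣E∣ Q
  upper H uniform free = ≤-trans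
    (upper-bound {d} {s} {suc m} {K} {n} {q} {σ} {sizes p} r≤m σ>0 n≤σσ n≤Kq Cσ≤q large opt H uniform free) Q-size

eventually-extremal : ∀ {d s m} → 3 + d ≤ suc m →
  (∃ λ K → ∃ λ N → ∀ n → N ≤ n → ∃ λ q → n ≤ K * q ×
    (∀ b → Composition (suc m) n b → NearOptimal (3 + d) (Constants.D d s (suc m) K) (suc m) n b → All (4 * q ≤_) b)) →
  Σ ℕ λ N → ∀ n → N ≤ n → Σ (Hypergraph n) λ Q → IsQ (3 + d) (suc s) (suc m) Q ×
    ExEq (3 + d) n (ContainsBerge (suc s) (2 + m)) (∣E∣ Q) ×
    ExEq (3 + d) n (ContainsHeavy (suc s) (2 + m)) (∣E∣ Q)
eventually-extremal {d} {s} {m} r≤m (K , N₀ , parts) = combine (threshold (Constants.C₀ d s (suc m) K) K)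
  where
  combine : (∃ λ N → ∀ n q → N ≤ n → n ≤ K * q → ∃ λ σ → 0 < σ × n ≤ σ * σ × Constants.C₀ d s (suc m) K * σ ≤ q) →
    Σ ℕ λ N → ∀ n → N ≤ n → Σ (Hypergraph n) λ Q → IsQ (3 + d) (suc s) (suc m) Q ×
    ExEq (3 + d) n (ContainsBerge (suc s) (2 + m)) (∣E∣ Q) ×
    ExEq (3 + d) n (ContainsHeavy (suc s) (2 + m)) (∣E∣ Q)
  combine (N₁ , scaled) = N₀ + N₁ , λ n n≥ →
    let q , n≤Kq , large = parts n (≤-trans (m≤m+n N₀ N₁) n≥)
        σ , σ>0 , n≤σσ , Cσ≤q = scaled n q (≤-trans (m≤n+m N₁ N₀) n≥) n≤Kq
    in extremal {d} {s} {m} {K} {n} {q} {σ} r≤m σ>0 n≤σσ n≤Kq Cσ≤q large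

theorem3 : (k r t : ℕ) → 2 < r → r < k → 1 ≤ t →
    Σ ℕ λ N → (n : ℕ) → N ≤ n →
    Σ (Hypergraph n) λ Q → IsQ r t (k ∸ 1) Q ×
    ExEq r n (ContainsBerge t k) (∣E∣ Q) ×
    ExEq r n (ContainsHeavy t k) (∣E∣ Q)
theorem3 _ zero                _ ()                   _ _
theorem3 _ (suc zero)          _ (s≤s ())             _ _
theorem3 _ (suc (suc zero))    _ (s≤s (s≤s ()))       _ _
theorem3 zero       (suc (suc (suc d))) _ _ ()        _
theorem3 (suc zero) (suc (suc (suc d))) _ _ (s≤s ())  _
theorem3 (suc (suc m)) (suc (suc (suc d))) (suc s) _ (s≤s r≤m) _ =
  -- Here `k = m + 2`, with `suc m` parts. The constant `D` is the same for every value of the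
  -- parameter `K`, so 0 stands in for the `K` that `large-parts` only produces from `D`; this
  -- avoids a circular choice.
  eventually-extremal r≤m (large-parts (suc m) d (Constants.D d s (suc m) 0) r≤m)
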